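{- Let $n\in\mathbf{N}$. The combing algorithm defines a bijection, and the uncombing algorithm defines the inverse bijection, between on one hand the set of cliff-shaped Schröder $n$-families, encoded by the corresponding strictly lower triangular matrices $B$ with entries in $\{0,1\}$, and on the other hand the set of disjoint Schröder $n$-families, encoded by the corresponding pairs $(B,D)$.
   Context: **Paths.** A Schröder-type path from $p$ to $q$ is a sequence $(p_0,\ldots,p_k)$ of points of $\mathbf{Z}\times\mathbf{Z}$ with $k\in\mathbf{N}$, $p_0=p$, $p_k=q$, and each $p_{i+1}-p_i\in\{(0,+1),(-1,+1),(-1,0)\}$; these steps are called horizontal, diagonal and vertical respectively. Its support is the set $\{p_0,\ldots,p_k\}$. Column $j$ is the set of points with second coordinate $j$. An $n$-family is an $n$-tuple $(P_0,\ldots,P_{n-1})$ with $P_i$ a Schröder-type path from $(i,0)$ to $(0,i)$. It is disjoint if the supports of the $P_i$ are pairwise disjoint. It is a Schröder $n$-family if for each $i$ every point $(k,l)$ in the support of $P_i$ satisfies $k+l\ge i$. A path from $(i,0)$ to $(0,i)$ is cliff-shaped if its first $i$ steps are horizontal or diagonal and any remaining steps are vertical; a cliff-shaped Schröder $n$-family is an $n$-family all of whose paths are cliff-shaped (it is then automatically a Schröder $n$-family). **Encoding.** All matrices are indexed by $[n]\times[n]$, $[n]=\{0,1,\ldots,n-1\}$. An $n$-family is encoded by a pair $(B,D)$, where $B$ is strictly lower triangular with entries in $\{0,1\}$ and $D$ is weakly lower triangular with entries in $\mathbf{N}$: for $j<i$, $B_{i,j}=0$ (resp. $1$) if the step of $P_i$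 from column $j$ to column $j+1$ is horizontal (resp. diagonal), and for $j\le i$, $D_{i,j}$ is the number of vertical steps of $P_i$ in column $j$. A cliff-shaped $n$-family is determined by $B$ alone, and every strictly lower triangular $\{0,1\}$-matrix $B$ so occurs. **Basic operations** (for $0\le k\le i<n-1$; "$\gets$" is assignment). Procedure untangle$(i,k)$: set $cur\gets0$, $d\gets0$. For $j$ from $0$ up to $k-1$: set $cur\gets cur+B[i+1,j]-B[i,j]$; if $cur>d$ then set $d\gets cur$, $B[i,j]\gets1$, $B[i+1,j]\gets0$. After the loop set $D[i,k]\gets D[i,k]-d$ and $D[i+1,k]\gets d$. Procedure cliffify$(i,k)$ (also uses an auxiliary integer array $h$): set $d\gets D[i+1,k]$ and $cur\gets h[i+1]-h[i]-1$; set $D[i+1,k]\gets0$, $D[i,k]\gets D[i,k]+d$; set $h[i+1]\gets h[i+1]-d$, $h[i]\gets h[i]+d$. Then for $j$ from $k-1$ down to $0$: set $cur\gets cur+B[i+1,j]-B[i,j]$; if $cur<d$ then set $d\gets cur$, $B[i,j]\gets0$, $B[i+1,j]\gets1$. **Combing algorithm** (input $B$; output the final pair $(B,D)$). For $k$ from $n-1$ down to $0$: set $D[k,k]\gets k-\sum_{0\le j<k}B[k,j]$; then for $i$ from $k$ up to $n-2$ execute untangle$(i,k)$. (Every weakly lower triangular entry of $D$ is assigned before being read.) **Uncombing algorithm** (input $(B,D)$; output the final $B$). For $k$ from $0$ up to $n-1$: for $i$ from $n-1$ down to $k$: if $k=0$ set $h[i]\gets i$, otherwise set $h[i]\gets h[i]-B[i,k-1]$;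 then, if $i<n-1$, execute cliffify$(i,k)$. -}

module Defs where

open import Data.Bool.Base using (if_then_else_; _∧_)
open import Data.Fin.Base using (Fin; toℕ; fromℕ<)
open import Data.Integer.Base as ℤ using (ℤ; +_; 0ℤ; 1ℤ; -1ℤ)
open import Data.Integer.Properties as ℤ using ()
open import Data.List.Base
  using (List; []; _∷_; map; foldl; foldr; filter; length; take; drop; upTo; downFrom)
open import Data.List.Membership.DecPropositional using (_∈?_)
open import Data.List.Relation.Binary.Disjoint.Propositional using (Disjoint)
open import Data.List.Relation.Unary.All using (All)
open import Data.Nat.Base as ℕ using (ℕ; zero; suc; _∸_; _≡ᵇ_)
open import Data.Nat.Properties as ℕ using ()
open import Data.Product.Base using (Σ; _×_; _,_; proj₁; proj₂)
open import Data.Product.Properties using (≡-dec)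
open import Level using (0ℓ)
open import Relation.Binary.Bundles using (Setoid)
open import Relation.Binary.Construct.Closure.ReflexiveTransitive using (Star; ε; _◅_)
open import Relation.Binary.Construct.On as On using ()
open import Relation.Binary.Definitions using (DecidableEquality)
open import Relation.Binary.PropositionalEquality using (_≡_; _≢_; refl; sym; trans)
open import Relation.Nullary.Decidable using (does; yes; no)

Point : Set
Point = ℤ × ℤ

_⊕_ : Point → Point → Point
(k , l) ⊕ (k′ , l′) = k ℤ.+ k′ , l ℤ.+ l′

data Direction : Set where
  horizontal diagonal vertical : Direction

_≟ᵈ_ : DecidableEquality Direction
horizontal ≟ᵈ horizontal = yes refl
horizontal ≟ᵈ diagonal   = no λ ()
horizontal ≟ᵈ vertical   = no λ ()
diagonal   ≟ᵈ horizontal = no λ ()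
diagonal   ≟ᵈ diagonal   = yes refl
diagonal   ≟ᵈ vertical   = no λ ()
vertical   ≟ᵈ horizontal = no λ ()
vertical   ≟ᵈ diagonal   = no λ ()
vertical   ≟ᵈ vertical   = yes refl

displacement : Direction → Point
displacement horizontal = 0ℤ  , 1ℤ
displacement diagonal   = -1ℤ , 1ℤ
displacement vertical   = -1ℤ , 0ℤ

Step : Point → Point → Set
Step p q = Σ Direction λ s → q ≡ p ⊕ displacement s

Path : Point → Point → Set
Path = Star Step

-- The sequence (p₀, …, pₖ); its members form the support of the path.
points : ∀ {p q} → Path p q → List Point
points {p} ε       = p ∷ []
points {p} (_ ◅ P) = p ∷ points P

-- Each step is listed with the column it starts in.
steps : ∀ {p q} → Path p q → List (Direction × ℤ)
steps             ε             = []
steps {p = _ , l} ((s , _) ◅ P) = (s , l) ∷ steps P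

_≟ˢ_ : DecidableEquality (Direction × ℤ)
_≟ˢ_ = ≡-dec _≟ᵈ_ ℤ._≟_

Family : ℕ → Set
Family n = (i : Fin n) → Path (+ toℕ i , 0ℤ) (0ℤ , + toℕ i)

IsDisjoint : ∀ {n} → Family n → Set
IsDisjoint P = ∀ i j → i ≢ j → Disjoint (points (P i)) (points (P j))

IsSchröder : ∀ {n} → Family n → Set
IsSchröder P = ∀ i → All (λ (k , l) → + toℕ i ℤ.≤ k ℤ.+ l) (points (P i))

IsCliffShaped : ∀ {n} → Family n → Set
IsCliffShaped P = ∀ i →
  All (λ (s , _) → s ≢ vertical) (take (toℕ i) (steps (P i))) ×
  All (λ (s , _) → s ≡ vertical) (drop (toℕ i) (steps (P i)))

-- A path is its sequence of points, so this is equality of families.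
families : ℕ → Setoid 0ℓ 0ℓ
families n = record
  { Carrier       = Family n
  ; _≈_           = λ P Q → ∀ i → points (P i) ≡ points (Q i)
  ; isEquivalence = record
    { refl  = λ i → refl
    ; sym   = λ P≈Q i → sym (P≈Q i)
    ; trans = λ P≈Q Q≈R i → trans (P≈Q i) (Q≈R i)
    }
  }

cliffShapedFamilies : ℕ → Setoid 0ℓ 0ℓ
cliffShapedFamilies n =
  On.setoid {B = Σ (Family n) IsCliffShaped} (families n) proj₁

disjointSchröderFamilies : ℕ → Setoid 0ℓ 0ℓ
disjointSchröderFamilies n =
  On.setoid {B = Σ (Family n) λ P → IsDisjoint P × IsSchröder P} (families n) proj₁

-- Integer entries, since the algorithms subtract; the {0,1} and ℕ ranges are
-- those of the encodings below.
Matrix : ℕ → Set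
Matrix n = Fin n → Fin n → ℤ

infix 4 _≐_ _≐₂_
_≐_ : ∀ {n} → Matrix n → Matrix n → Set
A ≐ A′ = ∀ i j → A i j ≡ A′ i j

_≐₂_ : ∀ {n} → Matrix n × Matrix n → Matrix n × Matrix n → Set
(B , D) ≐₂ (B′ , D′) = (B ≐ B′) × (D ≐ D′)

-- P i leaves each column j < i by exactly one non-vertical step, which is
-- horizontal unless diagonal, and never goes beyond column i.  So the entries
-- of encodeB P with j ≥ i and those of encodeD P with j > i are 0.
encodeB : ∀ {n} → Family n → Matrix n
encodeB P i j = if does (_∈?_ _≟ˢ_ (diagonal , + toℕ j) (steps (P i))) then 1ℤ else 0ℤ

encodeD : ∀ {n} → Family n → Matrix n
encodeD P i j = + length (filter ((vertical , + toℕ j) ≟ˢ_) (steps (P i)))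

encode : ∀ {n} → Family n → Matrix n × Matrix n
encode P = encodeB P , encodeD P

-- The algorithms run on unbounded arrays, so that loop indices are plain
-- numbers; only the entries indexed by [n] × [n] are meaningful.
Array Array₂ : Set
Array  = ℕ → ℤ
Array₂ = ℕ → Array

infixl 5 _[_]≔_ _[_][_]≔_

_[_]≔_ : Array → ℕ → ℤ → Array
(a [ i ]≔ x) i′ = if i ≡ᵇ i′ then x else a i′

_[_][_]≔_ : Array₂ → ℕ → ℕ → ℤ → Array₂
(A [ i ][ j ]≔ x) i′ j′ = if (i ≡ᵇ i′) ∧ (j ≡ᵇ j′) then x else A i′ j′

load : ∀ {n} → Matrix n → Array₂
load {n} A i j with i ℕ.<? n | j ℕ.<? n
... | yes i<n | yes j<n = A (fromℕ< i<n) (fromℕ< j<n)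
... | _       | _       = 0ℤ

store : ∀ {n} → Array₂ → Matrix n
store A i j = A (toℕ i) (toℕ j)

-- The numbers x with a ≤ x < b, in increasing and decreasing order.
ascending descending : ℕ → ℕ → List ℕ
ascending  a b = map (a ℕ.+_) (upTo (b ∸ a))
descending a b = map (a ℕ.+_) (downFrom (b ∸ a))

for : {S : Set} → List ℕ → (ℕ → S → S) → S → S
for xs body s = foldl (λ s x → body x s) s xs

-- (B , cur , d)
Inner : Set
Inner = Array₂ × ℤ × ℤ

untangleBody : ℕ → ℕ → Inner → Inner
untangleBody i j (B , cur , d) =
  let cur′ = cur ℤ.+ B (suc i) j ℤ.- B i j in
  if does (d ℤ.<? cur′)
  then (B [ i ][ j ]≔ 1ℤ [ suc i ][ j ]≔ 0ℤ , cur′ , cur′)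
  else (B , cur′ , d)

untangle : ℕ → ℕ → Array₂ × Array₂ → Array₂ × Array₂
untangle i k (B , D) =
  let (B′ , _ , d) = for (ascending 0 k) (untangleBody i) (B , 0ℤ , 0ℤ) in
  B′ , (D [ i ][ k ]≔ D i k ℤ.- d [ suc i ][ k ]≔ d)

cliffifyBody : ℕ → ℕ → Inner → Inner
cliffifyBody i j (B , cur , d) =
  let cur′ = cur ℤ.+ B (suc i) j ℤ.- B i j in
  if does (cur′ ℤ.<? d)
  then (B [ i ][ j ]≔ 0ℤ [ suc i ][ j ]≔ 1ℤ , cur′ , cur′)
  else (B , cur′ , d)

cliffify : ℕ → ℕ → Array₂ × Array₂ × Array → Array₂ × Array₂ × Array
cliffify i k (B , D , h) =
  let d            = D (suc i) k
      cur          = h (suc i) ℤ.- h i ℤ.- 1ℤ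
      D′           = D [ suc i ][ k ]≔ 0ℤ [ i ][ k ]≔ D i k ℤ.+ d
      h′           = h [ suc i ]≔ h (suc i) ℤ.- d [ i ]≔ h i ℤ.+ d
      (B′ , _ , _) = for (descending 0 k) (cliffifyBody i) (B , cur , d)
  in B′ , D′ , h′

sum : List ℤ → ℤ
sum = foldr ℤ._+_ 0ℤ

combRound : ℕ → ℕ → Array₂ × Array₂ → Array₂ × Array₂
combRound n k (B , D) =
  for (ascending k (n ∸ 1)) (λ i → untangle i k)
    (B , (D [ k ][ k ]≔ + k ℤ.- sum (map (B k) (upTo k))))

comb : ∀ {n} → Matrix n → Matrix n × Matrix n
comb {n} B =
  let (B′ , D′) = for (descending 0 n) (combRound n) (load B , λ _ _ → 0ℤ)
  in store B′ , store D′

updateHeight : ℕ → ℕ → Array₂ → Array → Array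
updateHeight i zero    B h = h [ i ]≔ + i
updateHeight i (suc k) B h = h [ i ]≔ h i ℤ.- B i k

uncombBody : ℕ → ℕ → ℕ → Array₂ × Array₂ × Array → Array₂ × Array₂ × Array
uncombBody n k i (B , D , h) =
  let s = B , D , updateHeight i k B h in
  if does (i ℕ.<? n ∸ 1) then cliffify i k s else s

uncomb : ∀ {n} → Matrix n × Matrix n → Matrix n
uncomb {n} (B , D) =
  let (B′ , _ , _) = for (ascending 0 n) (λ k → for (descending k n) (uncombBody n k))
                       (load B , load D , λ _ → 0ℤ)
  in store B′

{-# OPTIONS --safe #-}

-- Each algorithm is a composite of operations on two adjacent rows, and
-- untangle(i,k) and cliffify(i,k) compute one and the same relation between the
-- rows before and after, from left to right and from right to left.  This
-- relation (Untangling) is deterministic in both directions, so the algorithms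
-- undo each other step by step once every operation is known to be applied
-- within its range.  That follows from an invariant (Combed) of the states
-- between two rounds, which for the final state says that path i + 1 leaves
-- every column strictly above the point where path i enters it.  Since adjacent
-- paths cannot cross without meeting, this is equivalent to disjointness, and
-- it implies the Schröder condition.
module Submission where

open import Defs
open import Data.Bool.Base using (true; false; T; if_then_else_; _∨_)
open import Data.Empty using (⊥; ⊥-elim)
open import Data.Fin.Base using (Fin; toℕ; fromℕ<)
open import Data.Fin.Properties as Fin using ()
open import Data.Integer.Base as ℤ using (ℤ; +_; 0ℤ; 1ℤ; _+_; _-_; _≤_; _<_)
open import Data.Integer.Properties as ℤ using (≤-refl; ≤-trans; ≤-reflexive)
open import Data.Integer.Tactic.RingSolver using (solve)
open import Data.List.Base
  using (List; []; _∷_; _∷ʳ_; _++_; map; upTo; take; drop; replicate; length; filter)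
open import Data.List.Membership.DecPropositional using (_∈?_)
open import Data.List.Membership.Propositional using (_∈_; _∉_)
open import Data.List.Properties as List using ()
open import Data.List.Relation.Binary.Disjoint.Propositional using (Disjoint)
open import Data.List.Relation.Unary.All as All using (All)
open import Data.List.Relation.Unary.All.Properties as All using ()
open import Data.List.Relation.Unary.Any using (here; there)
open import Data.Nat.Base as ℕ using (ℕ; zero; suc; _∸_; _≡ᵇ_)
open import Data.Nat.Properties as ℕ using ()
open import Data.Product.Base using (Σ; ∃; _×_; _,_; proj₁; proj₂)
open import Data.Sum.Base using (_⊎_; inj₁; inj₂)
open import Data.Unit.Base using (⊤; tt)
open import Function.Base using (_∘_)
open import Function.Bundles using (Inverse)
open import Relation.Binary.Bundles using (Setoid)
open import Relation.Binary.Construct.Closure.ReflexiveTransitive using (ε; _◅_)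
open import Relation.Binary.Definitions using (Tri; tri<; tri≈; tri>)
open import Relation.Binary.PropositionalEquality
open import Relation.Nullary.Decidable using (Dec; yes; no; does; dec-true; dec-false)
open import Relation.Nullary.Negation using (¬_; contradiction)

-- The difficulty lies in the ranges. `untangle` realises `Untangling` on any two rows of bits but
-- could make `D[i,k]` negative; `cliffify` inverts the relation only if the rows are nested and the
-- verticals to absorb fit between them. Both are controlled by comparing prefix sums of rows of
-- `B`, a larger sum meaning a lower path. In a combing round the new path `x` stays between the old
-- paths `x` and `x + 1`, the path of diagonal steps alone standing in for old path `k`; in an
-- uncombing round it ends between the old paths `x` and `x - 1`. Since a row takes part in two
-- successive operations, this needs the extremal properties `first-⊑` and `second-⊒`. Within a row,
-- an operation trades diagonal steps in columns below `k` for vertical steps in column `k`, one for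
-- one, so a round fixes all heights from the exit of column `k` on. Arrays are functions compared
-- entrywise, so a run of the inverse algorithm is matched against the recorded states of the
-- original run.

linear : ∀ {a b x y} → a ≤ b → y - x ≡ b - a → x ≤ y
linear a≤b eq = ℤ.0≤i-j⇒j≤i (subst (0ℤ ≤_) (sym eq) (ℤ.i≤j⇒0≤j-i a≤b))

linear≡ : ∀ {a b x y} → a ≡ b → y - x ≡ b - a → x ≡ y
linear≡ {a} {b} a≡b eq = sym (ℤ.i-j≡0⇒i≡j _ _ (trans eq (ℤ.i≡j⇒i-j≡0 (sym a≡b))))

infixr 6 _⊞_ _⊞≡_
-- The hypotheses of a linear step are added up with `_⊞_` or `_⊞≡_`; what `linear` then asks for is
-- a ring identity. Local helpers such as `calc`, `shift` and `bound` restate such a step over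
-- variables, for `solve`.
_⊞_ : ∀ {a b x y} → a ≤ b → x ≤ y → a + x ≤ b + y
_⊞_ = ℤ.+-mono-≤

_⊞≡_ : ∀ {a b x y} → a ≡ b → x ≡ y → a + x ≡ b + y
_⊞≡_ = cong₂ _+_

<⇒1+≤ : ∀ {a b} → a < b → 1ℤ + a ≤ b
<⇒1+≤ = ℤ.i<j⇒suc[i]≤j

1≰0 : ¬ (1ℤ ≤ 0ℤ)
1≰0 (ℤ.+≤+ ())

-- Loops and arrays

module _ {S : Set} (f : ℕ → S → S) where

  ascending-snoc : ∀ {a b} → a ℕ.≤ b → ∀ s →
    for (ascending a (suc b)) f s ≡ f b (for (ascending a b) f s)
  ascending-snoc {a} {b} a≤b s = begin
    for (ascending a (suc b)) f s      ≡⟨ cong (λ xs → for xs f s) snoc ⟩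
    for (ascending a b ∷ʳ b) f s       ≡⟨ List.foldl-∷ʳ (λ s x → f x s) s b (ascending a b) ⟩
    f b (for (ascending a b) f s)      ∎
    where
    open ≡-Reasoning
    snoc : ascending a (suc b) ≡ ascending a b ∷ʳ b
    snoc = begin
      map (a ℕ.+_) (upTo (suc b ∸ a))            ≡⟨ cong (map (a ℕ.+_) ∘ upTo) (ℕ.+-∸-assoc 1 a≤b) ⟩
      map (a ℕ.+_) (upTo (suc (b ∸ a)))          ≡⟨ cong (map (a ℕ.+_)) (List.upTo-∷ʳ (b ∸ a)) ⟨
      map (a ℕ.+_) (upTo (b ∸ a) ∷ʳ (b ∸ a))     ≡⟨ List.map-++ (a ℕ.+_) (upTo (b ∸ a)) _ ⟩
      ascending a b ∷ʳ (a ℕ.+ (b ∸ a))           ≡⟨ cong (ascending a b ∷ʳ_) (ℕ.m+[n∸m]≡n a≤b) ⟩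
      ascending a b ∷ʳ b                         ∎

  ascending-empty : ∀ a s → for (ascending a a) f s ≡ s
  ascending-empty a s rewrite ℕ.n∸n≡0 a = refl

  descending-empty : ∀ a s → for (descending a a) f s ≡ s
  descending-empty a s rewrite ℕ.n∸n≡0 a = refl

  descending-cons : ∀ {a b} → a ℕ.≤ b → ∀ s →
    for (descending a (suc b)) f s ≡ for (descending a b) f (f b s)
  descending-cons {a} {b} a≤b s
    rewrite ℕ.+-∸-assoc 1 a≤b | ℕ.m+[n∸m]≡n a≤b = refl

  -- The lists begin with the largest index, so the first iteration splits off directly, the last
  -- one by recursion.
  descending-snoc : ∀ {a b} → a ℕ.< b → ∀ s →
    for (descending a b) f s ≡ f a (for (descending (suc a) b) f s)
  descending-snoc {a} {suc b} (ℕ.s≤s a≤b) s with ℕ.m≤n⇒m<n∨m≡n a≤b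
  ... | inj₁ a<b = begin
    for (descending a (suc b)) f s              ≡⟨ descending-cons a≤b s ⟩
    for (descending a b) f (f b s)              ≡⟨ descending-snoc a<b (f b s) ⟩
    f a (for (descending (suc a) b) f (f b s))  ≡⟨ cong (f a) (descending-cons a<b s) ⟨
    f a (for (descending (suc a) (suc b)) f s)  ∎
    where open ≡-Reasoning
  ... | inj₂ refl = begin
    for (descending a (suc a)) f s              ≡⟨ descending-cons a≤b s ⟩
    for (descending a a) f (f a s)              ≡⟨ descending-empty a _ ⟩
    f a s                                       ≡⟨ cong (f a) (descending-empty (suc a) s) ⟨
    f a (for (descending (suc a) (suc a)) f s)  ∎
    where open ≡-Reasoning

  for-ascending : ∀ (I : ℕ → S → Set) {a b} → a ℕ.≤ b →
    (∀ {x s} → a ℕ.≤ x → x ℕ.< b → I x s → I (suc x) (f x s)) →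
    ∀ {s} → I a s → I b (for (ascending a b) f s)
  for-ascending I {a} {b} a≤b step {s} Ias = go b a≤b ℕ.≤-refl
    where
    go : ∀ x → a ℕ.≤ x → x ℕ.≤ b → I x (for (ascending a x) f s)
    go x a≤x x≤b with ℕ.m≤n⇒m<n∨m≡n a≤x
    go x a≤x x≤b | inj₂ refl = subst (I x) (sym (ascending-empty x s)) Ias
    go (suc x) _ x<b | inj₁ (ℕ.s≤s a≤x) =
      subst (I (suc x)) (sym (ascending-snoc a≤x s))
        (step a≤x x<b (go x a≤x (ℕ.<⇒≤ x<b)))

  for-descending : ∀ (I : ℕ → S → Set) {a b} → a ℕ.≤ b →
    (∀ {x s} → a ℕ.≤ x → x ℕ.< b → I (suc x) s → I x (f x s)) →
    ∀ {s} → I b s → I a (for (descending a b) f s)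
  for-descending I {a} {b} a≤b step {s} Ibs with ℕ.m≤n⇒m<n∨m≡n a≤b
  ... | inj₂ refl = subst (I a) (sym (descending-empty a s)) Ibs
  for-descending I {a} {suc b} _ step {s} Ibs | inj₁ (ℕ.s≤s a≤b) =
    subst (I a) (sym (descending-cons a≤b s))
      (for-descending I a≤b (λ a≤x x<b → step a≤x (ℕ.m<n⇒m<1+n x<b)) (step a≤b ℕ.≤-refl Ibs))

module _ (a : Array) (x : ℤ) where

  update-same : ∀ i → (a [ i ]≔ x) i ≡ x
  update-same i with i ≡ᵇ i in eq
  ... | true  = refl
  ... | false = ⊥-elim (subst T eq (ℕ.≡⇒≡ᵇ i i refl))

  update-other : ∀ {i i′} → i′ ≢ i → (a [ i ]≔ x) i′ ≡ a i′
  update-other {i} {i′} i′≢i with i ≡ᵇ i′ in eq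
  ... | false = refl
  ... | true  = contradiction (sym (ℕ.≡ᵇ⇒≡ i i′ (subst T (sym eq) _))) i′≢i

module _ (A : Array₂) (i j : ℕ) (x : ℤ) where

  update₂-same : (A [ i ][ j ]≔ x) i j ≡ x
  update₂-same with i ≡ᵇ i in eq | j ≡ᵇ j in eq′
  ... | true  | true  = refl
  ... | false | _     = ⊥-elim (subst T eq (ℕ.≡⇒≡ᵇ i i refl))
  ... | true  | false = ⊥-elim (subst T eq′ (ℕ.≡⇒≡ᵇ j j refl))

  update₂-other : ∀ {i′ j′} → i′ ≢ i ⊎ j′ ≢ j → (A [ i ][ j ]≔ x) i′ j′ ≡ A i′ j′
  update₂-other {i′} {j′} other with i ≡ᵇ i′ in eq | j ≡ᵇ j′ in eq′ | other
  ... | false | _     | _          = refl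
  ... | true  | false | _          = refl
  ... | true  | true  | inj₁ i′≢i = contradiction (sym (ℕ.≡ᵇ⇒≡ i i′ (subst T (sym eq) _))) i′≢i
  ... | true  | true  | inj₂ j′≢j = contradiction (sym (ℕ.≡ᵇ⇒≡ j j′ (subst T (sym eq′) _))) j′≢j

module _ (A : Array₂) (p q j : ℕ) (x y : ℤ) where

  update-pair-first : p ≢ q → (A [ p ][ j ]≔ x [ q ][ j ]≔ y) p j ≡ x
  update-pair-first p≢q =
    trans (update₂-other (A [ p ][ j ]≔ x) q j y (inj₁ p≢q)) (update₂-same A p j x)

  update-pair-second : (A [ p ][ j ]≔ x [ q ][ j ]≔ y) q j ≡ y
  update-pair-second = update₂-same (A [ p ][ j ]≔ x) q j y

  update-pair-other : ∀ {i′ j′} → (i′ ≢ p × i′ ≢ q) ⊎ j′ ≢ j →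
    (A [ p ][ j ]≔ x [ q ][ j ]≔ y) i′ j′ ≡ A i′ j′
  update-pair-other (inj₁ (i′≢p , i′≢q)) =
    trans (update₂-other (A [ p ][ j ]≔ x) q j y (inj₁ i′≢q)) (update₂-other A p j x (inj₁ i′≢p))
  update-pair-other (inj₂ j′≢j) =
    trans (update₂-other (A [ p ][ j ]≔ x) q j y (inj₂ j′≢j)) (update₂-other A p j x (inj₂ j′≢j))

-- Prefix sums and bits

∑ : Array → ℕ → ℤ
∑ f zero    = 0ℤ
∑ f (suc k) = ∑ f k + f k

Bit : ℤ → Set
Bit x = x ≡ 0ℤ ⊎ x ≡ 1ℤ

0≤Bit : ∀ {x} → Bit x → 0ℤ ≤ x
0≤Bit (inj₁ refl) = ≤-refl
0≤Bit (inj₂ refl) = ℤ.+≤+ ℕ.z≤n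

Bit≤1 : ∀ {x} → Bit x → x ≤ 1ℤ
Bit≤1 (inj₁ refl) = ℤ.+≤+ ℕ.z≤n
Bit≤1 (inj₂ refl) = ≤-refl

∑-cong : ∀ {f g} k → (∀ {j} → j ℕ.< k → f j ≡ g j) → ∑ f k ≡ ∑ g k
∑-cong zero    f≗g = refl
∑-cong (suc k) f≗g = cong₂ _+_ (∑-cong k (f≗g ∘ ℕ.m<n⇒m<1+n)) (f≗g ℕ.≤-refl)

∑-mono : ∀ {f g} k → (∀ {j} → j ℕ.< k → f j ≤ g j) → ∑ f k ≤ ∑ g k
∑-mono zero    f≤g = ≤-refl
∑-mono (suc k) f≤g = ∑-mono k (f≤g ∘ ℕ.m<n⇒m<1+n) ⊞ f≤g ℕ.≤-refl

∑-zero : ∀ {f} k → (∀ {j} → j ℕ.< k → f j ≡ 0ℤ) → ∑ f k ≡ 0ℤ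
∑-zero zero    f≗0 = refl
∑-zero (suc k) f≗0 = cong₂ _+_ (∑-zero k (f≗0 ∘ ℕ.m<n⇒m<1+n)) (f≗0 ℕ.≤-refl)

∑-ones : ∀ k → ∑ (λ _ → 1ℤ) k ≡ + k
∑-ones zero    = refl
∑-ones (suc k) = trans (cong (_+ 1ℤ) (∑-ones k)) (ℤ.+-comm (+ k) 1ℤ)

-- Untangling and cliffifying two adjacent rows

-- Columns < k of rows i and i + 1 are c, a before untangle(i,k) and c′, a′
-- after it; the index d is the number of swaps.  Read from left to right this
-- is untangle, from right to left it is cliffify.
data Untangling (c a c′ a′ : Array) : ℕ → ℤ → Set where
  done : Untangling c a c′ a′ 0 0ℤ
  keep : ∀ {j d} → Untangling c a c′ a′ j d → ∑ a (suc j) ≤ ∑ c (suc j) + d →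
         c′ j ≡ c j → a′ j ≡ a j → Untangling c a c′ a′ (suc j) d
  swap : ∀ {j d} → Untangling c a c′ a′ j d → ∑ a j ≡ ∑ c j + d →
         c j ≡ 0ℤ → a j ≡ 1ℤ → c′ j ≡ 1ℤ → a′ j ≡ 0ℤ → Untangling c a c′ a′ (suc j) (d + 1ℤ)

Untangling-cong : ∀ {c a c′ a′ e b e′ b′ k d} →
  (∀ {j} → j ℕ.< k → e j ≡ c j) → (∀ {j} → j ℕ.< k → b j ≡ a j) →
  (∀ {j} → j ℕ.< k → e′ j ≡ c′ j) → (∀ {j} → j ℕ.< k → b′ j ≡ a′ j) →
  Untangling c a c′ a′ k d → Untangling e b e′ b′ k d
Untangling-cong ec ba ec′ ba′ done = done
Untangling-cong {k = suc k} ec ba ec′ ba′ (keep u le c′≡ a′≡) =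
  keep (Untangling-cong (ec ∘ ℕ.m<n⇒m<1+n) (ba ∘ ℕ.m<n⇒m<1+n) (ec′ ∘ ℕ.m<n⇒m<1+n) (ba′ ∘ ℕ.m<n⇒m<1+n) u)
    (subst₂ (λ x y → x ≤ y + _) (sym (∑-cong (suc k) ba)) (sym (∑-cong (suc k) ec)) le)
    (trans (ec′ ℕ.≤-refl) (trans c′≡ (sym (ec ℕ.≤-refl))))
    (trans (ba′ ℕ.≤-refl) (trans a′≡ (sym (ba ℕ.≤-refl))))
Untangling-cong {k = suc k} ec ba ec′ ba′ (swap u eq c≡ a≡ c′≡ a′≡) =
  swap (Untangling-cong (ec ∘ ℕ.m<n⇒m<1+n) (ba ∘ ℕ.m<n⇒m<1+n) (ec′ ∘ ℕ.m<n⇒m<1+n) (ba′ ∘ ℕ.m<n⇒m<1+n) u)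
    (subst₂ (λ x y → x ≡ y + _) (sym (∑-cong k (ba ∘ ℕ.m<n⇒m<1+n))) (sym (∑-cong k (ec ∘ ℕ.m<n⇒m<1+n))) eq)
    (trans (ec ℕ.≤-refl) c≡) (trans (ba ℕ.≤-refl) a≡)
    (trans (ec′ ℕ.≤-refl) c′≡) (trans (ba′ ℕ.≤-refl) a′≡)

module _ {c a c′ a′ : Array} where

  swaps≥0 : ∀ {k d} → Untangling c a c′ a′ k d → 0ℤ ≤ d
  swaps≥0 done             = ≤-refl
  swaps≥0 (keep u _ _ _)   = swaps≥0 u
  swaps≥0 (swap u _ _ _ _ _) = swaps≥0 u ⊞ ℤ.+≤+ ℕ.z≤n

  ∑-first : ∀ {k d} → Untangling c a c′ a′ k d → ∑ c′ k ≡ ∑ c k + d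
  ∑-first done = refl
  ∑-first {suc k} {d} (keep u _ c′≡ _) = shift (∑ c′ k) (∑ c k) d (c′ k) (c k) (∑-first u) c′≡
    where
    shift : ∀ p q d x y → p ≡ q + d → x ≡ y → p + x ≡ q + y + d
    shift p q d x y h g = linear≡ (h ⊞≡ g) (solve (p ∷ q ∷ d ∷ x ∷ y ∷ []))
  ∑-first {suc k} {d} (swap {d = d₀} u _ c≡ _ c′≡ _) = shift (∑ c′ k) (∑ c k) d₀ (c′ k) (c k) (∑-first u) c′≡ c≡
    where
    shift : ∀ p q d x y → p ≡ q + d → x ≡ 1ℤ → y ≡ 0ℤ → p + x ≡ q + y + (d + 1ℤ)
    shift p q d x y h g₁ g₀ = linear≡ (h ⊞≡ g₁ ⊞≡ sym g₀) (solve (p ∷ q ∷ d ∷ x ∷ y ∷ []))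

  ∑-second : ∀ {k d} → Untangling c a c′ a′ k d → ∑ a′ k + d ≡ ∑ a k
  ∑-second done = refl
  ∑-second {suc k} {d} (keep u _ _ a′≡) = shift (∑ a′ k) (∑ a k) d (a′ k) (a k) (∑-second u) a′≡
    where
    shift : ∀ p q d x y → p + d ≡ q → x ≡ y → p + x + d ≡ q + y
    shift p q d x y h g = linear≡ (h ⊞≡ g) (solve (p ∷ q ∷ d ∷ x ∷ y ∷ []))
  ∑-second {suc k} {d} (swap {d = d₀} u _ _ a≡ _ a′≡) = shift (∑ a′ k) (∑ a k) d₀ (a′ k) (a k) (∑-second u) a′≡ a≡
    where
    shift : ∀ p q d x y → p + d ≡ q → x ≡ 0ℤ → y ≡ 1ℤ → p + x + (d + 1ℤ) ≡ q + y
    shift p q d x y h g₀ g₁ = linear≡ (h ⊞≡ g₀ ⊞≡ sym g₁) (solve (p ∷ q ∷ d ∷ x ∷ y ∷ []))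

  -- `d` is the running maximum of the gaps `∑ a - ∑ c`, started at 0: `keep` states the bound and
  -- `swap` attains it.
  ∑-gap : ∀ {k d} → Untangling c a c′ a′ k d → ∑ a k ≤ ∑ c k + d
  ∑-gap done = ≤-refl
  ∑-gap (keep _ le _ _) = le
  ∑-gap {suc k} (swap {d = d} u eq c≡ a≡ _ _) = shift (∑ a k) (∑ c k) d (a k) (c k) eq a≡ c≡
    where
    shift : ∀ p q d x y → p ≡ q + d → x ≡ 1ℤ → y ≡ 0ℤ → p + x ≤ q + y + (d + 1ℤ)
    shift p q d x y h g₁ g₀ = ≤-reflexive (linear≡ (h ⊞≡ g₁ ⊞≡ sym g₀) (solve (p ∷ q ∷ d ∷ x ∷ y ∷ [])))

  truncate : ∀ {k d j} → Untangling c a c′ a′ k d → j ℕ.≤ k → ∃ (Untangling c a c′ a′ j)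
  truncate {k} u j≤k with ℕ.m≤n⇒m<n∨m≡n j≤k
  ... | inj₂ refl = _ , u
  truncate {suc k} (keep u _ _ _)     j≤k | inj₁ (ℕ.s≤s j≤) = truncate u j≤
  truncate {suc k} (swap u _ _ _ _ _) j≤k | inj₁ (ℕ.s≤s j≤) = truncate u j≤

  first-≤ : ∀ {k d j} → Untangling c a c′ a′ k d → j ℕ.< k → c j ≤ c′ j
  first-≤ u j<k with truncate u j<k
  ... | _ , keep _ _ c′≡ _        = ≤-reflexive (sym c′≡)
  ... | _ , swap _ _ c≡ _ c′≡ _ rewrite c≡ | c′≡ = ℤ.+≤+ ℕ.z≤n

  second-≤ : ∀ {k d j} → Untangling c a c′ a′ k d → j ℕ.< k → a′ j ≤ a j
  second-≤ u j<k with truncate u j<k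
  ... | _ , keep _ _ _ a′≡        = ≤-reflexive a′≡
  ... | _ , swap _ _ _ a≡ _ a′≡ rewrite a≡ | a′≡ = ℤ.+≤+ ℕ.z≤n

  -- The gap bound, combined with the `d` diagonals gained by the first row. This is what pushes
  -- path `i` below the former course of path `i + 1`.
  second⊑first : ∀ {k d j} → Untangling c a c′ a′ k d → j ℕ.≤ k → ∑ a j ≤ ∑ c′ j
  second⊑first u j≤k with truncate u j≤k
  ... | _ , v = ≤-trans (∑-gap v) (≤-reflexive (sym (∑-first v)))

  first-bit : ∀ {k d j} → Untangling c a c′ a′ k d → j ℕ.< k → Bit (c j) → Bit (c′ j)
  first-bit u j<k b with truncate u j<k
  ... | _ , keep _ _ c′≡ _     = subst Bit (sym c′≡) b
  ... | _ , swap _ _ _ _ c′≡ _ = inj₂ c′≡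

  second-bit : ∀ {k d j} → Untangling c a c′ a′ k d → j ℕ.< k → Bit (a j) → Bit (a′ j)
  second-bit u j<k b with truncate u j<k
  ... | _ , keep _ _ _ a′≡     = subst Bit (sym a′≡) b
  ... | _ , swap _ _ _ _ _ a′≡ = inj₁ a′≡

  first-bit⁻ : ∀ {k d j} → Untangling c a c′ a′ k d → j ℕ.< k → Bit (c′ j) → Bit (c j)
  first-bit⁻ u j<k b with truncate u j<k
  ... | _ , keep _ _ c′≡ _     = subst Bit c′≡ b
  ... | _ , swap _ _ c≡ _ _ _ = inj₁ c≡

  second-bit⁻ : ∀ {k d j} → Untangling c a c′ a′ k d → j ℕ.< k → Bit (a′ j) → Bit (a j)
  second-bit⁻ u j<k b with truncate u j<k
  ... | _ , keep _ _ _ a′≡     = subst Bit a′≡ b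
  ... | _ , swap _ _ _ a≡ _ _ = inj₂ a≡

  -- An upper bound w for both rows also bounds the new first row, provided
  -- w dominates c entrywise: the first row is the smallest such bound.
  first-⊑ : ∀ {w : Array} {k d} → Untangling c a c′ a′ k d →
    (∀ {j} → j ℕ.< k → c j ≤ w j) → (∀ {j} → j ℕ.≤ k → ∑ a j ≤ ∑ w j) → ∑ c′ k ≤ ∑ w k
  first-⊑ done _ _ = ≤-refl
  first-⊑ (keep u _ c′≡ _) c≤w a⊑w =
    first-⊑ u (c≤w ∘ ℕ.m<n⇒m<1+n) (a⊑w ∘ ℕ.m≤n⇒m≤1+n) ⊞ ≤-trans (≤-reflexive c′≡) (c≤w ℕ.≤-refl)
  -- At a swap the first row catches up with the second: through this column `∑ c′` equals `∑ a`, so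
  -- the bound on `a` applies.
  first-⊑ {w} {suc k} (swap {d = d} u eq c≡ a≡ c′≡ _) c≤w a⊑w =
    shift (∑ a k) (∑ c k) (∑ c′ k) d (a k) (c′ k) (∑ w (suc k)) (∑-first u) eq a≡ c′≡ (a⊑w ℕ.≤-refl)
    where
    shift : ∀ p q r d x y z → r ≡ q + d → p ≡ q + d → x ≡ 1ℤ → y ≡ 1ℤ → p + x ≤ z → r + y ≤ z
    shift p q r d x y z e₁ e₂ g h le =
      linear (≤-reflexive e₁ ⊞ ≤-reflexive (sym e₂) ⊞ ≤-reflexive (sym g) ⊞ ≤-reflexive h ⊞ le)
        (solve (p ∷ q ∷ r ∷ d ∷ x ∷ y ∷ z ∷ []))

  -- Dually, the old second row is the largest row w that dominates a′ entrywise,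
  -- stays below the new first row and ends no higher than a.
  second-⊒ : ∀ {w : Array} {k d} → Untangling c a c′ a′ k d →
    (∀ {j} → j ℕ.< k → a′ j ≤ w j) → (∀ {j} → j ℕ.≤ k → ∑ w j ≤ ∑ c′ j) → ∑ w k ≤ ∑ a k →
    ∀ {j} → j ℕ.≤ k → ∑ w j ≤ ∑ a j
  second-⊒ {k = k} u a′≤w w⊑c′ w≤a j≤k with ℕ.m≤n⇒m<n∨m≡n j≤k
  ... | inj₂ refl = w≤a
  second-⊒ {w} {suc k} (keep u _ _ a′≡) a′≤w w⊑c′ w≤a j≤k | inj₁ (ℕ.s≤s j≤) =
    second-⊒ u (a′≤w ∘ ℕ.m<n⇒m<1+n) (w⊑c′ ∘ ℕ.m≤n⇒m≤1+n)
      (shift (∑ w k) (w k) (∑ a k) (a k) (a′ k) w≤a a′≡ (a′≤w ℕ.≤-refl)) j≤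
    where
    shift : ∀ p x q y z → p + x ≤ q + y → z ≡ y → z ≤ x → p ≤ q
    shift p x q y z le eq z≤x = linear (le ⊞ ≤-reflexive (sym eq) ⊞ z≤x) (solve (p ∷ x ∷ q ∷ y ∷ z ∷ []))
  -- At a swap `∑ a k` equals `∑ c′ k`, so `w⊑c′` supplies the end bound for the shorter prefix.
  second-⊒ {w} {suc k} (swap u eq _ _ _ _) a′≤w w⊑c′ w≤a j≤k | inj₁ (ℕ.s≤s j≤) =
    second-⊒ u (a′≤w ∘ ℕ.m<n⇒m<1+n) (w⊑c′ ∘ ℕ.m≤n⇒m≤1+n)
      (≤-trans (w⊑c′ (ℕ.n≤1+n k)) (≤-reflexive (trans (∑-first u) (sym eq)))) j≤

-- The choice in each column is forced: `keep` says that the gap after the column is at most `d`,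
-- whereas `swap` starts from the gap `d` and raises it by one.
Untangling-forward : ∀ {c a c₁ a₁ c₂ a₂ k d₁ d₂} →
  Untangling c a c₁ a₁ k d₁ → Untangling c a c₂ a₂ k d₂ →
  d₁ ≡ d₂ × (∀ {j} → j ℕ.< k → c₁ j ≡ c₂ j × a₁ j ≡ a₂ j)
Untangling-forward {c} {a} = go
  where
  keep≢swap : ∀ {k d} → ∑ a (suc k) ≤ ∑ c (suc k) + d → ∑ a k ≡ ∑ c k + d → c k ≡ 0ℤ → a k ≡ 1ℤ → ⊥
  keep≢swap {k} {d} le eq c≡ a≡ = 1≰0 (absurd (∑ a k) (a k) (∑ c k) (c k) d le eq a≡ c≡)
    where
    absurd : ∀ p x q y d → p + x ≤ q + y + d → p ≡ q + d → x ≡ 1ℤ → y ≡ 0ℤ → 1ℤ ≤ 0ℤ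
    absurd p x q y d le eq x≡ y≡ =
      linear (le ⊞ ≤-reflexive (sym eq) ⊞ ≤-reflexive (sym x≡) ⊞ ≤-reflexive y≡)
        (solve (p ∷ x ∷ q ∷ y ∷ d ∷ []))

  extend : ∀ {c₁ a₁ c₂ a₂ k} → (∀ {j} → j ℕ.< k → c₁ j ≡ c₂ j × a₁ j ≡ a₂ j) →
    c₁ k ≡ c₂ k → a₁ k ≡ a₂ k → ∀ {j} → j ℕ.< suc k → c₁ j ≡ c₂ j × a₁ j ≡ a₂ j
  extend same c≡ a≡ j<sk with ℕ.m<1+n⇒m<n∨m≡n j<sk
  ... | inj₁ j<k  = same j<k
  ... | inj₂ refl = c≡ , a≡

  go : ∀ {c₁ a₁ c₂ a₂ k d₁ d₂} → Untangling c a c₁ a₁ k d₁ → Untangling c a c₂ a₂ k d₂ →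
    d₁ ≡ d₂ × (∀ {j} → j ℕ.< k → c₁ j ≡ c₂ j × a₁ j ≡ a₂ j)
  go done done = refl , λ ()
  go {c₁} {a₁} {c₂} {a₂} (keep u _ c₁≡ a₁≡) (keep v _ c₂≡ a₂≡) with go u v
  ... | refl , same = refl , extend {c₁} {a₁} {c₂} {a₂} same (trans c₁≡ (sym c₂≡)) (trans a₁≡ (sym a₂≡))
  go {c₁} {a₁} {c₂} {a₂} (swap u _ _ _ c₁≡ a₁≡) (swap v _ _ _ c₂≡ a₂≡) with go u v
  ... | refl , same = refl , extend {c₁} {a₁} {c₂} {a₂} same (trans c₁≡ (sym c₂≡)) (trans a₁≡ (sym a₂≡))
  go (keep u le _ _) (swap v eq c≡ a≡ _ _) with go u v
  ... | refl , _ = ⊥-elim (keep≢swap le eq c≡ a≡)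
  go (swap u eq c≡ a≡ _ _) (keep v le _ _) with go u v
  ... | refl , _ = ⊥-elim (keep≢swap le eq c≡ a≡)

-- Read from the right, `d` and the finished rows force the choice. Over the columns before the
-- last, a `keep` gives `∑ a′ + d ≤ ∑ c′`, while a `swap` gives equality with `d - 1` in place of
-- `d`.
Untangling-backward : ∀ {c₁ a₁ c₂ a₂ c′ a′ k d₁ d₂} → d₁ ≡ d₂ →
  Untangling c₁ a₁ c′ a′ k d₁ → Untangling c₂ a₂ c′ a′ k d₂ →
  ∀ {j} → j ℕ.< k → c₁ j ≡ c₂ j × a₁ j ≡ a₂ j
Untangling-backward _ done done ()
Untangling-backward {k = suc k} d≡ (keep u _ c₁≡ a₁≡) (keep v _ c₂≡ a₂≡) j<k
  with ℕ.m<1+n⇒m<n∨m≡n j<k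
... | inj₁ j<k′ = Untangling-backward d≡ u v j<k′
... | inj₂ refl = trans (sym c₁≡) c₂≡ , trans (sym a₁≡) a₂≡
Untangling-backward {k = suc k} d≡ (swap {d = d} u _ c₁≡ a₁≡ _ _) (swap {d = e} v _ c₂≡ a₂≡ _ _) j<k
  with ℕ.m<1+n⇒m<n∨m≡n j<k
... | inj₁ j<k′ = Untangling-backward (cancel d e d≡) u v j<k′
  where
  cancel : ∀ d e → d + 1ℤ ≡ e + 1ℤ → d ≡ e
  cancel d e eq = linear≡ eq (solve (d ∷ e ∷ []))
... | inj₂ refl = trans c₁≡ (sym c₂≡) , trans a₁≡ (sym a₂≡)
Untangling-backward {k = suc k} d≡ (keep u _ _ _) (swap v eq _ _ _ _) = ⊥-elim (keep≢swap u v eq d≡)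
  where
  keep≢swap : ∀ {c₁ a₁ c₂ a₂ c′ a′ k d e} →
    Untangling c₁ a₁ c′ a′ k d → Untangling c₂ a₂ c′ a′ k e → ∑ a₂ k ≡ ∑ c₂ k + e → d ≢ e + 1ℤ
  keep≢swap {c₁} {a₁} {c₂} {a₂} {c′} {a′} {k} {d} {e} u v eq d≡ = 1≰0
    (absurd (∑ c′ k) (∑ a′ k) (∑ c₁ k) (∑ a₁ k) (∑ c₂ k) (∑ a₂ k) d e
      (∑-first u) (∑-second u) (∑-gap u) (∑-first v) (∑-second v) eq d≡)
    where
    absurd : ∀ C A c₁ a₁ c₂ a₂ d e → C ≡ c₁ + d → A + d ≡ a₁ → a₁ ≤ c₁ + d →
      C ≡ c₂ + e → A + e ≡ a₂ → a₂ ≡ c₂ + e → d ≡ e + 1ℤ → 1ℤ ≤ 0ℤ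
    absurd C A c₁ a₁ c₂ a₂ d e h₁ h₂ h₃ h₄ h₅ h₆ h₇ =
      linear (≤-reflexive (sym h₁) ⊞ ≤-reflexive h₂ ⊞ h₃ ⊞ ≤-reflexive h₄ ⊞ ≤-reflexive (sym h₅) ⊞ ≤-reflexive (sym h₆) ⊞ ≤-reflexive (sym h₇))
        (solve (C ∷ A ∷ c₁ ∷ a₁ ∷ c₂ ∷ a₂ ∷ d ∷ e ∷ []))
Untangling-backward {k = suc k} d≡ u@(swap _ _ _ _ _ _) v@(keep _ _ _ _) j<k
  with Untangling-backward (sym d≡) v u j<k
... | c≡ , a≡ = sym c≡ , sym a≡

-- The two operations on whole matrices

OffRows : ℕ → ℕ → Set
OffRows i x = x ≢ i × x ≢ suc i

AgreeOff : ℕ → ℕ → Array₂ → Array₂ → Set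
AgreeOff i k B B′ = ∀ {x y} → OffRows i x ⊎ k ℕ.≤ y → B′ x y ≡ B x y

-- Oriented from the tangled to the untangled state. The number of swaps has no parameter of its own
-- because `D′ (suc i) k` records it.
record Untangles (i k : ℕ) (B D B′ D′ : Array₂) : Set where
  field
    rows       : Untangling (B i) (B (suc i)) (B′ i) (B′ (suc i)) k (D′ (suc i) k)
    restB      : AgreeOff i k B B′
    above      : D (suc i) k ≡ 0ℤ
    below      : D′ i k ≡ D i k - D′ (suc i) k
    restD      : ∀ {x y} → OffRows i x ⊎ y ≢ k → D′ x y ≡ D x y

suc≢ : ∀ {i} → suc i ≢ i
suc≢ = ℕ.1+n≢n

AgreeOff-suc : ∀ {i k B B′} → AgreeOff i k B B′ → AgreeOff i (suc k) B B′
AgreeOff-suc agree (inj₁ off) = agree (inj₁ off)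
AgreeOff-suc agree (inj₂ k<y) = agree (inj₂ (ℕ.<⇒≤ k<y))

module _ (i : ℕ) (B : Array₂) where

  record UntangleState (k : ℕ) (s : Inner) : Set where
    constructor untangled
    field
      rows  : Untangling (B i) (B (suc i)) (proj₁ s i) (proj₁ s (suc i)) k (proj₂ (proj₂ s))
      gap   : proj₁ (proj₂ s) ≡ ∑ (B (suc i)) k - ∑ (B i) k
      restB : AgreeOff i k B (proj₁ s)

  untangleBody-spec : ∀ {j s} → Bit (B i j) → Bit (B (suc i) j) →
    UntangleState j s → UntangleState (suc j) (untangleBody i j s)
  untangleBody-spec {j} {B′ , cur , d} bc ba (untangled rows gap restB) = go (d ℤ.<? cur′)
    where
    c = B i j
    a = B (suc i) j
    C = ∑ (B i) j
    A = ∑ (B (suc i)) j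
    cur′ = cur + B′ (suc i) j - B′ i j
    ≡c : B′ i j ≡ c
    ≡c = restB (inj₂ ℕ.≤-refl)
    ≡a : B′ (suc i) j ≡ a
    ≡a = restB (inj₂ ℕ.≤-refl)

    gap′ : cur′ ≡ A + a - (C + c)
    gap′ = calc A a C c (B′ (suc i) j) (B′ i j) cur gap ≡a ≡c
      where
      calc : ∀ p x q y x′ y′ cur → cur ≡ p - q → x′ ≡ x → y′ ≡ y → cur + x′ - y′ ≡ p + x - (q + y)
      calc p x q y x′ y′ cur g x≡ y≡ =
        linear≡ (g ⊞≡ x≡ ⊞≡ sym y≡) (solve (p ∷ x ∷ q ∷ y ∷ x′ ∷ y′ ∷ cur ∷ []))

    bits : ∀ {c a} → Bit c → Bit a → 1ℤ + c ≤ a → c ≡ 0ℤ × a ≡ 1ℤ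
    bits (inj₁ refl) (inj₁ refl) (ℤ.+≤+ ())
    bits (inj₁ refl) (inj₂ refl) _ = refl , refl
    bits (inj₂ refl) (inj₁ refl) (ℤ.+≤+ ())
    bits (inj₂ refl) (inj₂ refl) (ℤ.+≤+ (ℕ.s≤s ()))

    -- Bits move the gap by at most one per column, and it was at most `d` before. So a new record
    -- is `d + 1`, starts from the gap `d` and needs the bits 0 and 1: exactly the premises of
    -- `swap`.
    record-high : d < cur′ → (c ≡ 0ℤ × a ≡ 1ℤ) × A ≡ C + d × cur′ ≡ d + 1ℤ
    record-high d<cur′ with bits bc ba (bound A C a c d cur′ gap′ (∑-gap rows) (<⇒1+≤ d<cur′))
      where
      bound : ∀ p q x y d e → e ≡ p + x - (q + y) → p ≤ q + d → 1ℤ + d ≤ e → 1ℤ + y ≤ x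
      bound p q x y d e g le lt = linear (≤-reflexive g ⊞ le ⊞ lt) (solve (p ∷ q ∷ x ∷ y ∷ d ∷ e ∷ []))
    ... | c≡ , a≡ = (c≡ , a≡) , tight , calc A C a c d cur′ gap′ tight a≡ c≡
      where
      lower : ∀ p q x y d e → e ≡ p + x - (q + y) → 1ℤ + d ≤ e → x ≡ 1ℤ → y ≡ 0ℤ → q + d ≤ p
      lower p q x y d e g lt x≡ y≡ =
        linear (≤-reflexive g ⊞ lt ⊞ ≤-reflexive x≡ ⊞ ≤-reflexive (sym y≡))
          (solve (p ∷ q ∷ x ∷ y ∷ d ∷ e ∷ []))
      calc : ∀ p q x y d e → e ≡ p + x - (q + y) → p ≡ q + d → x ≡ 1ℤ → y ≡ 0ℤ → e ≡ d + 1ℤ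
      calc p q x y d e g t x≡ y≡ =
        linear≡ (g ⊞≡ t ⊞≡ x≡ ⊞≡ sym y≡) (solve (p ∷ q ∷ x ∷ y ∷ d ∷ e ∷ []))
      tight : A ≡ C + d
      tight = ℤ.≤-antisym (∑-gap rows) (lower A C a c d cur′ gap′ (<⇒1+≤ d<cur′) a≡ c≡)

    B″ = B′ [ i ][ j ]≔ 1ℤ [ suc i ][ j ]≔ 0ℤ

    go : (high? : Dec (d < cur′)) →
         UntangleState (suc j) (if does high? then (B″ , cur′ , cur′) else (B′ , cur′ , d))
    go (no d≮cur′) = untangled (keep rows (bound A C a c d cur′ gap′ (ℤ.≮⇒≥ d≮cur′)) ≡c ≡a) gap′ (AgreeOff-suc {i} restB)
      where
      bound : ∀ p q x y d e → e ≡ p + x - (q + y) → e ≤ d → p + x ≤ q + y + d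
      bound p q x y d e g le = linear (≤-reflexive (sym g) ⊞ le) (solve (p ∷ q ∷ x ∷ y ∷ d ∷ e ∷ []))
    go (yes d<cur′) = untangled (rows′ (record-high d<cur′)) gap′ restB′
      where
      unchanged : ∀ {x y} → OffRows i x ⊎ y ≢ j → B″ x y ≡ B′ x y
      unchanged = update-pair-other B′ i (suc i) j 1ℤ 0ℤ
      rows′ : (c ≡ 0ℤ × a ≡ 1ℤ) × A ≡ C + d × cur′ ≡ d + 1ℤ →
        Untangling (B i) (B (suc i)) (B″ i) (B″ (suc i)) (suc j) cur′
      rows′ ((c≡ , a≡) , tight , cur′≡) = subst (Untangling _ _ _ _ (suc j)) (sym cur′≡)
        (swap (Untangling-cong (λ _ → refl) (λ _ → refl)
                 (unchanged ∘ inj₂ ∘ ℕ.<⇒≢) (unchanged ∘ inj₂ ∘ ℕ.<⇒≢) rows)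
          tight c≡ a≡
          (update-pair-first B′ i (suc i) j 1ℤ 0ℤ (suc≢ ∘ sym))
          (update-pair-second B′ i (suc i) j 1ℤ 0ℤ))
      restB′ : AgreeOff i (suc j) B B″
      restB′ (inj₁ off) = trans (unchanged (inj₁ off)) (restB (inj₁ off))
      restB′ (inj₂ j<y) = trans (unchanged (inj₂ (ℕ.>⇒≢ j<y))) (restB (inj₂ (ℕ.<⇒≤ j<y)))

  untangle-spec : ∀ {D k} → (∀ {j} → j ℕ.< k → Bit (B i j)) → (∀ {j} → j ℕ.< k → Bit (B (suc i) j)) →
    D (suc i) k ≡ 0ℤ →
    Untangles i k B D (proj₁ (untangle i k (B , D))) (proj₂ (untangle i k (B , D)))
  untangle-spec {D} {k} bc ba D0 = record
    { rows  = subst (Untangling _ _ _ _ k) (sym up) rows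
    ; restB = restB
    ; above = D0
    ; below = trans (update-pair-first D i (suc i) k _ δ (suc≢ ∘ sym)) (cong (D i k -_) (sym up))
    ; restD = update-pair-other D i (suc i) k _ δ
    }
    where
    open UntangleState (for-ascending (untangleBody i) UntangleState {0} {k} ℕ.z≤n
            (λ {x} {s} _ x<k → untangleBody-spec {x} {s} (bc x<k) (ba x<k))
            {B , 0ℤ , 0ℤ} (untangled done refl (λ _ → refl)))
    δ = proj₂ (proj₂ (for (ascending 0 k) (untangleBody i) (B , 0ℤ , 0ℤ)))
    up : (D [ i ][ k ]≔ D i k - δ [ suc i ][ k ]≔ δ) (suc i) k ≡ δ
    up = update-pair-second D i (suc i) k _ δ

module _ (i : ℕ) (B : Array₂) where

  -- The rows in columns ≥ j are final, so whatever untangles to the remaining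
  -- columns extends to a preimage of the original rows.
  record CliffifyState (k : ℕ) (δ : ℤ) (j : ℕ) (s : Inner) : Set where
    constructor cliffified
    field
      rows   : ∀ {c a} → Untangling c a (B i) (B (suc i)) j (proj₂ (proj₂ s)) →
               (∀ {y} → j ℕ.≤ y → c y ≡ proj₁ s i y) → (∀ {y} → j ℕ.≤ y → a y ≡ proj₁ s (suc i) y) →
               Untangling c a (B i) (B (suc i)) k δ
      gap    : proj₁ (proj₂ s) ≡ ∑ (B i) j - ∑ (B (suc i)) j
      low    : 0ℤ ≤ proj₂ (proj₂ s)
      high   : proj₂ (proj₂ s) ≤ proj₁ (proj₂ s)
      before : ∀ {x y} → y ℕ.< j → proj₁ s x y ≡ B x y
      restB  : ∀ {x y} → OffRows i x ⊎ k ℕ.≤ y → proj₁ s x y ≡ B x y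

  -- Here `cur` is the gap `∑ c′ - ∑ a′` of the columns still to be visited and `d` its running
  -- minimum, started at `δ`. A new minimum is smaller by exactly one, occurs at the bits 1 and 0,
  -- and stays nonnegative because the rows are nested.
  cliffifyBody-spec : ∀ {k δ j s} → Bit (B i j) → Bit (B (suc i) j) → ∑ (B (suc i)) j ≤ ∑ (B i) j → j ℕ.< k →
    CliffifyState k δ (suc j) s → CliffifyState k δ j (cliffifyBody i j s)
  cliffifyBody-spec {k} {δ} {j} {B′ , cur , d} bc ba nested j<k (cliffified rows gap low high before restB) = go (cur′ ℤ.<? d)
    where
    c = B i j
    a = B (suc i) j
    C = ∑ (B i) j
    A = ∑ (B (suc i)) j
    cur′ = cur + B′ (suc i) j - B′ i j
    ≡c : B′ i j ≡ c
    ≡c = before ℕ.≤-refl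
    ≡a : B′ (suc i) j ≡ a
    ≡a = before ℕ.≤-refl

    gap′ : cur′ ≡ C - A
    gap′ = calc A a C c (B′ (suc i) j) (B′ i j) cur gap ≡a ≡c
      where
      calc : ∀ p x q y x′ y′ cur → cur ≡ q + y - (p + x) → x′ ≡ x → y′ ≡ y → cur + x′ - y′ ≡ q - p
      calc p x q y x′ y′ cur g x≡ y≡ =
        linear≡ (g ⊞≡ x≡ ⊞≡ sym y≡) (solve (p ∷ x ∷ q ∷ y ∷ x′ ∷ y′ ∷ cur ∷ []))

    bits : ∀ {c a} → Bit c → Bit a → 1ℤ + a ≤ c → c ≡ 1ℤ × a ≡ 0ℤ
    bits (inj₁ refl) (inj₁ refl) (ℤ.+≤+ ())
    bits (inj₂ refl) (inj₁ refl) _ = refl , refl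
    bits (inj₁ refl) (inj₂ refl) (ℤ.+≤+ ())
    bits (inj₂ refl) (inj₂ refl) (ℤ.+≤+ (ℕ.s≤s ()))

    record-low : cur′ < d → (c ≡ 1ℤ × a ≡ 0ℤ) × d ≡ cur′ + 1ℤ
    record-low cur′<d with bits bc ba (bound A C a c d cur cur′ gap gap′ high (<⇒1+≤ cur′<d))
      where
      bound : ∀ p q x y d e e′ → e ≡ q + y - (p + x) → e′ ≡ q - p → d ≤ e → 1ℤ + e′ ≤ d → 1ℤ + x ≤ y
      bound p q x y d e e′ g g′ le lt =
        linear (≤-reflexive g ⊞ ≤-reflexive (sym g′) ⊞ le ⊞ lt) (solve (p ∷ q ∷ x ∷ y ∷ d ∷ e ∷ e′ ∷ []))
    ... | c≡ , a≡ = (c≡ , a≡) , ℤ.≤-antisym (upper A C a c d cur cur′ gap gap′ high c≡ a≡)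
                                  (≤-trans (≤-reflexive (ℤ.+-comm cur′ 1ℤ)) (<⇒1+≤ cur′<d))
      where
      upper : ∀ p q x y d e e′ → e ≡ q + y - (p + x) → e′ ≡ q - p → d ≤ e → y ≡ 1ℤ → x ≡ 0ℤ → d ≤ e′ + 1ℤ
      upper p q x y d e e′ g g′ le y≡ x≡ =
        linear (≤-reflexive g ⊞ ≤-reflexive (sym g′) ⊞ le ⊞ ≤-reflexive y≡ ⊞ ≤-reflexive (sym x≡))
          (solve (p ∷ q ∷ x ∷ y ∷ d ∷ e ∷ e′ ∷ []))

    B″ = B′ [ i ][ j ]≔ 0ℤ [ suc i ][ j ]≔ 1ℤ

    go : (low? : Dec (cur′ < d)) →
         CliffifyState k δ j (if does low? then (B″ , cur′ , cur′) else (B′ , cur′ , d))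
    go (no cur′≮d) = cliffified rows′ gap′ low (ℤ.≮⇒≥ cur′≮d) (before ∘ ℕ.m<n⇒m<1+n) restB
      where
      bound : ∀ C′ A′ C A c a x y d e → C′ ≡ C + d → A′ + d ≡ A → c ≡ y → a ≡ x →
              e ≡ C′ + y - (A′ + x) → d ≤ e → A + a ≤ C + c + d
      bound C′ A′ C A c a x y d e f₁ f₂ c≡ a≡ g le =
        linear (≤-reflexive f₁ ⊞ ≤-reflexive (sym f₂) ⊞ ≤-reflexive (sym c≡) ⊞ ≤-reflexive a≡ ⊞ ≤-reflexive g ⊞ le)
          (solve (C′ ∷ A′ ∷ C ∷ A ∷ c ∷ a ∷ x ∷ y ∷ d ∷ e ∷ []))
      rows′ : ∀ {f g} → Untangling f g (B i) (B (suc i)) j d →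
        (∀ {y} → j ℕ.≤ y → f y ≡ B′ i y) → (∀ {y} → j ℕ.≤ y → g y ≡ B′ (suc i) y) →
        Untangling f g (B i) (B (suc i)) k δ
      rows′ {f} {g} u f≡ g≡ =
        rows (keep u (bound C A (∑ f j) (∑ g j) (f j) (g j) a c d cur (∑-first u) (∑-second u)
                        (trans (f≡ ℕ.≤-refl) ≡c) (trans (g≡ ℕ.≤-refl) ≡a) gap high)
                (trans (sym ≡c) (sym (f≡ ℕ.≤-refl))) (trans (sym ≡a) (sym (g≡ ℕ.≤-refl))))
          (f≡ ∘ ℕ.<⇒≤) (g≡ ∘ ℕ.<⇒≤)
    go (yes cur′<d) = cliffified (rows′ (record-low cur′<d)) gap′ (nonneg A C cur′ gap′ nested) ≤-refl before′ restB′
      where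
      unchanged : ∀ {x y} → OffRows i x ⊎ y ≢ j → B″ x y ≡ B′ x y
      unchanged = update-pair-other B′ i (suc i) j 0ℤ 1ℤ
      nonneg : ∀ p q e → e ≡ q - p → p ≤ q → 0ℤ ≤ e
      nonneg p q e g le = linear (≤-reflexive (sym g) ⊞ le) (solve (p ∷ q ∷ e ∷ []))
      balance : ∀ C′ A′ C A e → C′ ≡ C + e → A′ + e ≡ A → e ≡ C′ - A′ → A ≡ C + e
      balance C′ A′ C A e f₁ f₂ g =
        linear≡ (f₁ ⊞≡ sym f₂ ⊞≡ g) (solve (C′ ∷ A′ ∷ C ∷ A ∷ e ∷ []))
      rows′ : (c ≡ 1ℤ × a ≡ 0ℤ) × d ≡ cur′ + 1ℤ →
        ∀ {f g} → Untangling f g (B i) (B (suc i)) j cur′ →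
        (∀ {y} → j ℕ.≤ y → f y ≡ B″ i y) → (∀ {y} → j ℕ.≤ y → g y ≡ B″ (suc i) y) →
        Untangling f g (B i) (B (suc i)) k δ
      rows′ ((c≡ , a≡) , d≡) {f} {g} u f≡ g≡ =
        rows (subst (Untangling _ _ _ _ (suc j)) (sym d≡)
               (swap u (balance C A (∑ f j) (∑ g j) cur′ (∑-first u) (∑-second u) gap′)
                 (trans (f≡ ℕ.≤-refl) (update-pair-first B′ i (suc i) j 0ℤ 1ℤ (suc≢ ∘ sym)))
                 (trans (g≡ ℕ.≤-refl) (update-pair-second B′ i (suc i) j 0ℤ 1ℤ))
                 c≡ a≡))
          (λ j<y → trans (f≡ (ℕ.<⇒≤ j<y)) (unchanged (inj₂ (ℕ.>⇒≢ j<y))))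
          (λ j<y → trans (g≡ (ℕ.<⇒≤ j<y)) (unchanged (inj₂ (ℕ.>⇒≢ j<y))))
      before′ : ∀ {x y} → y ℕ.< j → B″ x y ≡ B x y
      before′ y<j = trans (unchanged (inj₂ (ℕ.<⇒≢ y<j))) (before (ℕ.m<n⇒m<1+n y<j))
      restB′ : ∀ {x y} → OffRows i x ⊎ k ℕ.≤ y → B″ x y ≡ B x y
      restB′ (inj₁ off) = trans (unchanged (inj₁ off)) (restB (inj₁ off))
      restB′ (inj₂ k≤y) = trans (unchanged (inj₂ (ℕ.>⇒≢ (ℕ.<-≤-trans j<k k≤y)))) (restB (inj₂ k≤y))

  -- The last hypothesis starts the loop with `d ≤ cur`, and nestedness brings the running minimum
  -- to 0 at column 0; so all verticals of row `i + 1` in column `k` become diagonals, and the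
  -- output untangles to the input.
  cliffify-spec : ∀ {D h k} → (∀ {j} → j ℕ.< k → Bit (B i j)) → (∀ {j} → j ℕ.< k → Bit (B (suc i) j)) →
    (∀ {j} → j ℕ.≤ k → ∑ (B (suc i)) j ≤ ∑ (B i) j) →
    h i ≡ + i - ∑ (B i) k → h (suc i) ≡ + suc i - ∑ (B (suc i)) k →
    0ℤ ≤ D (suc i) k → ∑ (B (suc i)) k + D (suc i) k ≤ ∑ (B i) k →
    let (B₀ , D₀ , h₀) = cliffify i k (B , D , h) in
    Untangles i k B₀ D₀ B D ×
    h₀ i ≡ h i + D (suc i) k × h₀ (suc i) ≡ h (suc i) - D (suc i) k × (∀ {x} → OffRows i x → h₀ x ≡ h x)
  cliffify-spec {D} {h} {k} bc ba nested hi hsi 0≤δ room =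
    record
      { rows  = rows (subst (Untangling _ _ _ _ 0) (sym δ≡0) done) (λ _ → refl) (λ _ → refl)
      ; restB = λ off → sym (restB off)
      ; above = update-pair-first D (suc i) i k 0ℤ _ suc≢
      ; below = sym (trans (cong (_- δ) (update-pair-second D (suc i) i k 0ℤ _)) (cancel (D i k) δ))
      ; restD = λ where
          (inj₁ (x≢i , x≢si)) → sym (update-pair-other D (suc i) i k 0ℤ _ (inj₁ (x≢si , x≢i)))
          (inj₂ y≢k)          → sym (update-pair-other D (suc i) i k 0ℤ _ (inj₂ y≢k))
      } ,
    update-same h₁ _ i ,
    trans (update-other h₁ _ {i} suc≢) (update-same h _ (suc i)) ,
    λ (x≢i , x≢si) → trans (update-other h₁ _ {i} x≢i) (update-other h _ {suc i} x≢si)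
    where
    δ = D (suc i) k
    h₁ = h [ suc i ]≔ h (suc i) - δ
    cur = h (suc i) - h i - 1ℤ
    -- Paths `i` and `i + 1` start one unit apart, hence the `- 1ℤ` in the initial `cur`.
    cur≡ : cur ≡ ∑ (B i) k - ∑ (B (suc i)) k
    cur≡ = calc (h (suc i)) (h i) (+ i) (∑ (B i) k) (∑ (B (suc i)) k) hi hsi
      where
      calc : ∀ x y i p q → y ≡ i - p → x ≡ 1ℤ + i - q → x - y - 1ℤ ≡ p - q
      calc x y i p q y≡ x≡ = linear≡ (x≡ ⊞≡ sym y≡) (solve (x ∷ y ∷ i ∷ p ∷ q ∷ []))
    cancel : ∀ x y → x + y - y ≡ x
    cancel x y = solve (x ∷ y ∷ [])
    enough : ∀ p q e δ → e ≡ p - q → q + δ ≤ p → δ ≤ e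
    enough p q e δ g le = linear (≤-reflexive (sym g) ⊞ le) (solve (p ∷ q ∷ e ∷ δ ∷ []))
    open CliffifyState (for-descending (cliffifyBody i) (CliffifyState k δ) {0} {k} ℕ.z≤n
            (λ {x} {s} _ x<k → cliffifyBody-spec {s = s} (bc x<k) (ba x<k) (nested (ℕ.<⇒≤ x<k)) x<k)
            {B , cur , δ}
            (cliffified (λ u _ _ → u) cur≡ 0≤δ (enough (∑ (B i) k) (∑ (B (suc i)) k) cur δ cur≡ room)
              (λ _ → refl) (λ _ → refl)))
    -- At column 0 the gap is a difference of empty sums, so `0 ≤ d ≤ cur` leaves only 0.
    δ≡0 : proj₂ (proj₂ (for (descending 0 k) (cliffifyBody i) (B , cur , δ))) ≡ 0ℤ
    δ≡0 = ℤ.≤-antisym (≤-trans high (≤-reflexive gap)) low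

-- Rounds of the two algorithms

State : Set
State = Array₂ × Array₂

UntanglesState : ℕ → ℕ → State → State → Set
UntanglesState i k (B , D) (B′ , D′) = Untangles i k B D B′ D′

-- Columns below `k` of `D` are left out because the two runs differ there: uncombing leaves the
-- diagonal entries `D[j,j]` in place, while combing has not assigned them yet.
Match : ℕ → ℕ → State → State → Set
Match n k (B , D) (B′ , D′) =
  (∀ {x} y → x ℕ.< n → B x y ≡ B′ x y) × (∀ {x y} → x ℕ.< n → k ℕ.≤ y → D x y ≡ D′ x y)

data Place (i k x y : ℕ) : Set where
  first  : x ≡ i → y ℕ.< k → Place i k x y
  second : x ≡ suc i → y ℕ.< k → Place i k x y
  off    : OffRows i x ⊎ k ℕ.≤ y → Place i k x y

place : ∀ i k x y → Place i k x y
place i k x y with k ℕ.≤? y | x ℕ.≟ i | x ℕ.≟ suc i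
... | yes k≤y | _       | _        = off (inj₂ k≤y)
... | no  k≰y | yes x≡i | _        = first x≡i (ℕ.≰⇒> k≰y)
... | no  k≰y | no  x≢i | yes x≡si = second x≡si (ℕ.≰⇒> k≰y)
... | no  k≰y | no  x≢i | no  x≢si = off (inj₁ (x≢i , x≢si))

data PlaceD (i k x y : ℕ) : Set where
  first  : x ≡ i → y ≡ k → PlaceD i k x y
  second : x ≡ suc i → y ≡ k → PlaceD i k x y
  off    : OffRows i x ⊎ y ≢ k → PlaceD i k x y

placeD : ∀ i k x y → PlaceD i k x y
placeD i k x y with y ℕ.≟ k | x ℕ.≟ i | x ℕ.≟ suc i
... | no  y≢k | _       | _        = off (inj₂ y≢k)
... | yes y≡k | yes x≡i | _        = first x≡i y≡k
... | yes y≡k | no  x≢i | yes x≡si = second x≡si y≡k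
... | yes y≡k | no  x≢i | no  x≢si = off (inj₁ (x≢i , x≢si))

Untangles-forward : ∀ {n i k} {s s′ t t′ : State} → suc i ℕ.< n →
  UntanglesState i k s s′ → UntanglesState i k t t′ → Match n k s t → Match n k s′ t′
Untangles-forward {n} {i} {k} {B , D} {B′ , D′} {C , E} {C′ , E′} si<n u v (B≡ , D≡) = B′≡ , D′≡
  where
  module u = Untangles u
  module v = Untangles v
  det = Untangling-forward u.rows
          (Untangling-cong (λ {y} _ → B≡ y (ℕ.<⇒≤ si<n)) (λ {y} _ → B≡ y si<n) (λ _ → refl) (λ _ → refl) v.rows)
  B′≡ : ∀ {x} y → x ℕ.< n → B′ x y ≡ C′ x y
  B′≡ {x} y x<n with place i k x y
  ... | first refl y<k  = proj₁ (proj₂ det y<k)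
  ... | second refl y<k = proj₂ (proj₂ det y<k)
  ... | off o           = trans (u.restB o) (trans (B≡ y x<n) (sym (v.restB o)))
  D′≡ : ∀ {x y} → x ℕ.< n → k ℕ.≤ y → D′ x y ≡ E′ x y
  D′≡ {x} {y} x<n k≤y with placeD i k x y
  ... | first refl refl  = trans u.below (trans (cong₂ _-_ (D≡ x<n k≤y) (proj₁ det)) (sym v.below))
  ... | second refl refl = proj₁ det
  ... | off o            = trans (u.restD o) (trans (D≡ x<n k≤y) (sym (v.restD o)))

-- Backward determinism starts from the number of swaps, which the matching entries `D′ (suc i) k`
-- and `E′ (suc i) k` provide.
Untangles-backward : ∀ {n i k} {s s′ t t′ : State} → suc i ℕ.< n →
  UntanglesState i k s s′ → UntanglesState i k t t′ → Match n k s′ t′ → Match n k s t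
Untangles-backward {n} {i} {k} {B , D} {B′ , D′} {C , E} {C′ , E′} si<n u v (B≡ , D≡) = B′≡ , D′≡
  where
  module u = Untangles u
  module v = Untangles v
  det : ∀ {j} → j ℕ.< k → B i j ≡ C i j × B (suc i) j ≡ C (suc i) j
  det = Untangling-backward (D≡ si<n ℕ.≤-refl) u.rows
          (Untangling-cong (λ _ → refl) (λ _ → refl) (λ {y} _ → B≡ y (ℕ.<⇒≤ si<n)) (λ {y} _ → B≡ y si<n) v.rows)
  B′≡ : ∀ {x} y → x ℕ.< n → B x y ≡ C x y
  B′≡ {x} y x<n with place i k x y
  ... | first refl y<k  = proj₁ (det y<k)
  ... | second refl y<k = proj₂ (det y<k)
  ... | off o           = trans (sym (u.restB o)) (trans (B≡ y x<n) (v.restB o))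
  D′≡ : ∀ {x y} → x ℕ.< n → k ℕ.≤ y → D x y ≡ E x y
  D′≡ {x} {y} x<n k≤y with placeD i k x y
  ... | first refl refl  = solve-below (D i k) (E i k) (D′ i k) (E′ i k) (D′ (suc i) k) (E′ (suc i) k)
                             u.below v.below (D≡ x<n k≤y) (D≡ si<n k≤y)
    where
    solve-below : ∀ d e d′ e′ δ η → d′ ≡ d - δ → e′ ≡ e - η → d′ ≡ e′ → δ ≡ η → d ≡ e
    solve-below d e d′ e′ δ η p q r w = linear≡ (sym p ⊞≡ q ⊞≡ r ⊞≡ w) (solve (d ∷ e ∷ d′ ∷ e′ ∷ δ ∷ η ∷ []))
  ... | second refl refl = trans u.above (sym v.above)
  ... | off o            = trans (sym (u.restD o)) (trans (D≡ x<n k≤y) (v.restD o))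

-- What a round `k` leaves alone. Diagonals before column `k` and verticals in column `k` are
-- exchanged with their total conserved, so no height beyond moves; this carries disjointness over
-- in the columns greater than `k`.
record Frame (k : ℕ) (s t : State) : Set where
  private
    B  = proj₁ s
    D  = proj₂ s
    B′ = proj₁ t
    D′ = proj₂ t
  field
    restB     : ∀ {x y} → x ℕ.< k ⊎ k ℕ.≤ y → B′ x y ≡ B x y
    restD     : ∀ {x y} → x ℕ.< k ⊎ y ≢ k → D′ x y ≡ D x y
    conserved : ∀ x → ∑ (B′ x) k + D′ x k ≡ ∑ (B x) k + D x k

  entries : ∀ {x j} → k ℕ.< j → ∑ (B′ x) j + ∑ (D′ x) j ≡ ∑ (B x) j + ∑ (D x) j
  entries {x} {suc j} (ℕ.s≤s k≤j) with ℕ.m≤n⇒m<n∨m≡n k≤j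
  ... | inj₁ k<j  = add (∑ (B′ x) j) (∑ (D′ x) j) (∑ (B x) j) (∑ (D x) j) (B′ x j) (B x j) (D′ x j) (D x j)
                      (entries k<j) (restB (inj₂ k≤j)) (restD (inj₂ (ℕ.>⇒≢ k<j)))
    where
    add : ∀ p′ q′ p q x′ x y′ y → p′ + q′ ≡ p + q → x′ ≡ x → y′ ≡ y → p′ + x′ + (q′ + y′) ≡ p + x + (q + y)
    add p′ q′ p q x′ x y′ y e f g = linear≡ (e ⊞≡ f ⊞≡ g) (solve (p′ ∷ q′ ∷ p ∷ q ∷ x′ ∷ x ∷ y′ ∷ y ∷ []))
  ... | inj₂ refl = add (∑ (B′ x) k) (∑ (D′ x) k) (∑ (B x) k) (∑ (D x) k) (B′ x k) (B x k) (D′ x k) (D x k)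
                      (conserved x) (restB (inj₂ ℕ.≤-refl)) (∑-cong k (λ y<k → restD (inj₂ (ℕ.<⇒≢ y<k))))
    where
    add : ∀ p′ q′ p q x′ x y′ y → p′ + y′ ≡ p + y → x′ ≡ x → q′ ≡ q → p′ + x′ + (q′ + y′) ≡ p + x + (q + y)
    add p′ q′ p q x′ x y′ y e f g = linear≡ (e ⊞≡ f ⊞≡ g) (solve (p′ ∷ q′ ∷ p ∷ q ∷ x′ ∷ x ∷ y′ ∷ y ∷ []))

  exits : ∀ {x j} → k ℕ.< j → ∑ (B′ x) j + ∑ (D′ x) (suc j) ≡ ∑ (B x) j + ∑ (D x) (suc j)
  exits {x} {j} k<j = begin
    ∑ (B′ x) j + (∑ (D′ x) j + D′ x j)  ≡⟨ ℤ.+-assoc (∑ (B′ x) j) _ _ ⟨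
    ∑ (B′ x) j + ∑ (D′ x) j + D′ x j    ≡⟨ cong₂ _+_ (entries k<j) (restD (inj₂ (ℕ.>⇒≢ k<j))) ⟩
    ∑ (B x) j + ∑ (D x) j + D x j       ≡⟨ ℤ.+-assoc (∑ (B x) j) _ _ ⟩
    ∑ (B x) j + (∑ (D x) j + D x j)     ∎
    where open ≡-Reasoning

Frame-refl : ∀ {k s} → Frame k s s
Frame-refl = record { restB = λ _ → refl ; restD = λ _ → refl ; conserved = λ _ → refl }

Frame-trans : ∀ {k s t u} → Frame k s t → Frame k t u → Frame k s u
Frame-trans f g = record
  { restB     = λ o → trans (g.restB o) (f.restB o)
  ; restD     = λ o → trans (g.restD o) (f.restD o)
  ; conserved = λ x → trans (g.conserved x) (f.conserved x)
  }
  where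
  module f = Frame f
  module g = Frame g

Frame-sym : ∀ {k s t} → Frame k s t → Frame k t s
Frame-sym f = record
  { restB     = sym ∘ restB
  ; restD     = sym ∘ restD
  ; conserved = sym ∘ conserved
  }
  where open Frame f

offRows : ∀ {i k x} → k ℕ.≤ i → x ℕ.< k → OffRows i x
offRows k≤i x<k = ℕ.<⇒≢ (ℕ.<-≤-trans x<k k≤i) , ℕ.<⇒≢ (ℕ.m<n⇒m<1+n (ℕ.<-≤-trans x<k k≤i))

Untangles⇒Frame : ∀ {i k s t} → k ℕ.≤ i → UntanglesState i k s t → Frame k s t
Untangles⇒Frame {i} {k} {B , D} {B′ , D′} k≤i u = record
  { restB     = λ where
      (inj₁ x<k) → restB (inj₁ (offRows k≤i x<k))
      (inj₂ k≤y) → restB (inj₂ k≤y)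
  ; restD     = λ where
      (inj₁ x<k) → restD (inj₁ (offRows k≤i x<k))
      (inj₂ y≢k) → restD (inj₂ y≢k)
  ; conserved = conserved
  }
  where
  open Untangles u
  conserved : ∀ x → ∑ (B′ x) k + D′ x k ≡ ∑ (B x) k + D x k
  conserved x with placeD i k x k
  ... | first refl _  = calc (∑ (B′ i) k) (∑ (B i) k) (D′ i k) (D i k) (D′ (suc i) k) (∑-first rows) below
    where
    calc : ∀ p′ p d′ d δ → p′ ≡ p + δ → d′ ≡ d - δ → p′ + d′ ≡ p + d
    calc p′ p d′ d δ e f = linear≡ (e ⊞≡ f) (solve (p′ ∷ p ∷ d′ ∷ d ∷ δ ∷ []))
  ... | second refl _ = trans (∑-second rows) (trans (sym (ℤ.+-identityʳ _)) (cong (_+_ (∑ (B (suc i)) k)) (sym above)))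
  ... | off (inj₁ o)  = cong₂ _+_ (∑-cong k (λ _ → restB (inj₁ o))) (restD (inj₁ o))
  ... | off (inj₂ k≢k) = contradiction refl k≢k

-- The state when the columns ≥ k are combed and those < k still cliff-shaped.
-- Row x of B and D sums up to column j to x minus the height at which path x
-- enters column j, and disjointness says that path i + 1 leaves each column
-- above the point at which path i enters it.
record Combed (n k : ℕ) (s : State) : Set where
  private
    B = proj₁ s
    D = proj₂ s
  field
    bits     : ∀ x y → Bit (B x y)
    lower    : ∀ {x y} → x ℕ.≤ y → B x y ≡ 0ℤ
    lowerD   : ∀ {x y} → x ℕ.< y → D x y ≡ 0ℤ
    cliff    : ∀ {x y} → k ℕ.≤ x → x ℕ.< n → y ℕ.< k → D x y ≡ 0ℤ
    nonneg   : ∀ {x y} → k ℕ.≤ x → x ℕ.< n → 0ℤ ≤ D x y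
    nested   : ∀ {i j} → k ℕ.≤ i → suc i ℕ.< n → j ℕ.≤ k → ∑ (B (suc i)) j ≤ ∑ (B i) j
    disjoint : ∀ {i j} → k ℕ.≤ j → j ℕ.≤ i → suc i ℕ.< n →
               ∑ (B (suc i)) j + ∑ (D (suc i)) (suc j) ≤ ∑ (B i) j + ∑ (D i) j
    rowsum   : ∀ {x} → k ℕ.≤ x → x ℕ.< n → ∑ (B x) x + ∑ (D x) (suc x) ≡ + x

drop-zeros : ∀ {f} k x → (∀ {y} → y ℕ.< k → f y ≡ 0ℤ) → x + ∑ f (suc k) ≡ x + f k
drop-zeros {f} k x f≡0 = cong (_+_ x) (trans (cong (_+ f k) (∑-zero k f≡0)) (ℤ.+-identityˡ (f k)))

sum-∑ : ∀ f k → sum (map f (upTo k)) ≡ ∑ f k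
sum-∑ f zero    = refl
sum-∑ f (suc k) = begin
  sum (map f (upTo (suc k)))            ≡⟨ cong (sum ∘ map f) (List.upTo-∷ʳ k) ⟨
  sum (map f (upTo k ∷ʳ k))             ≡⟨ cong sum (List.map-++ f (upTo k) (k ∷ [])) ⟩
  sum (map f (upTo k) ∷ʳ f k)           ≡⟨ sum-∷ʳ (map f (upTo k)) (f k) ⟩
  sum (map f (upTo k)) + f k            ≡⟨ cong (_+ f k) (sum-∑ f k) ⟩
  ∑ f k + f k                           ∎
  where
  open ≡-Reasoning
  sum-∷ʳ : ∀ xs y → sum (xs ∷ʳ y) ≡ sum xs + y
  sum-∷ʳ []       y = ℤ.+-comm y 0ℤ
  sum-∷ʳ (x ∷ xs) y = trans (cong (_+_ x) (sum-∷ʳ xs y)) (sym (ℤ.+-assoc x (sum xs) y))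

-- One combing round

module CombRound {m k : ℕ} (k≤m : k ℕ.≤ m) {s : State} (combed : Combed (suc m) (suc k) s)
  (zeros : ∀ {x y} → y ℕ.< suc k → proj₂ s x y ≡ 0ℤ) where

  private
    n  = suc m
    B⁰ = proj₁ s
    D⁰ = proj₂ s
    module C = Combed combed

  D¹ : Array₂
  D¹ = D⁰ [ k ][ k ]≔ + k - sum (map (B⁰ k) (upTo k))

  D¹-self : D¹ k k ≡ + k - ∑ (B⁰ k) k
  D¹-self = trans (update₂-same D⁰ k k _) (cong (_-_ (+ k)) (sum-∑ (B⁰ k) k))

  D¹-other : ∀ {x y} → x ≢ k ⊎ y ≢ k → D¹ x y ≡ D⁰ x y
  D¹-other = update₂-other D⁰ k k _

  s¹ : State
  s¹ = B⁰ , D¹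

  -- Throughout the round path x stays weakly above its initial position, if
  -- path k is thought to have started with diagonal steps only.
  cap : Array₂
  cap x j = if does (x ℕ.≟ k) then 1ℤ else B⁰ x j

  cap-other : ∀ {x} → x ≢ k → ∀ j → cap x j ≡ B⁰ x j
  cap-other {x} x≢k j = cong (if_then 1ℤ else B⁰ x j) (dec-false (x ℕ.≟ k) x≢k)

  cap-self : ∀ j → cap k j ≡ 1ℤ
  cap-self j = cong (if_then 1ℤ else B⁰ k j) (dec-true (k ℕ.≟ k) refl)

  B⁰≤cap : ∀ x j → B⁰ x j ≤ cap x j
  B⁰≤cap x j with x ℕ.≟ k
  ... | yes refl = ≤-trans (Bit≤1 (C.bits k j)) (≤-reflexive (sym (cap-self j)))
  ... | no x≢k   = ≤-reflexive (sym (cap-other x≢k j))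

  cap-nested : ∀ {x j} → k ℕ.≤ x → suc x ℕ.< n → j ℕ.≤ k → ∑ (cap (suc x)) j ≤ ∑ (cap x) j
  cap-nested {x} {j} k≤x sx<n j≤k with ℕ.m≤n⇒m<n∨m≡n k≤x
  ... | inj₁ k<x = subst₂ _≤_ (sym (∑-cong j (λ _ → cap-other (ℕ.>⇒≢ (ℕ.m<n⇒m<1+n k<x)) _)))
                     (sym (∑-cong j (λ _ → cap-other (ℕ.>⇒≢ k<x) _))) (C.nested k<x sx<n (ℕ.m≤n⇒m≤1+n j≤k))
  ... | inj₂ refl = ∑-mono j λ {y} _ →
          subst₂ _≤_ (sym (cap-other suc≢ y)) (sym (cap-self y)) (Bit≤1 (C.bits (suc k) y))

  -- The initial `D[k,k]` makes up the difference to `k` diagonal steps, and for larger `x` nothing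
  -- falls in column `k` yet. With `conserved`, row `x` of `cap` therefore tells throughout the
  -- round where path `x` leaves column `k`.
  cap-sum : ∀ {x} → k ℕ.≤ x → ∑ (cap x) k ≡ ∑ (B⁰ x) k + D¹ x k
  cap-sum {x} k≤x with ℕ.m≤n⇒m<n∨m≡n k≤x
  ... | inj₁ k<x = begin
    ∑ (cap x) k               ≡⟨ ∑-cong k (λ _ → cap-other (ℕ.>⇒≢ k<x) _) ⟩
    ∑ (B⁰ x) k                ≡⟨ ℤ.+-identityʳ _ ⟨
    ∑ (B⁰ x) k + 0ℤ           ≡⟨ cong (_+_ (∑ (B⁰ x) k)) (trans (D¹-other (inj₁ (ℕ.>⇒≢ k<x))) (zeros ℕ.≤-refl)) ⟨
    ∑ (B⁰ x) k + D¹ x k       ∎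
    where open ≡-Reasoning
  ... | inj₂ refl = begin
    ∑ (cap k) k                       ≡⟨ ∑-cong k (λ _ → cap-self _) ⟩
    ∑ (λ _ → 1ℤ) k                    ≡⟨ ∑-ones k ⟩
    + k                               ≡⟨ add-back (∑ (B⁰ k) k) (+ k) ⟩
    ∑ (B⁰ k) k + (+ k - ∑ (B⁰ k) k)   ≡⟨ cong (_+_ (∑ (B⁰ k) k)) D¹-self ⟨
    ∑ (B⁰ k) k + D¹ k k               ∎
    where
    open ≡-Reasoning
    add-back : ∀ p q → q ≡ p + (q - p)
    add-back p q = solve (p ∷ q ∷ [])

  -- Rows from `k` to before `i` are finished, row `i` has been at most a second row, later rows are
  -- untouched. Of the two bounds by `cap`, `above` yields disjointness and `below` the sign of `D`.
  -- `capped` is the entrywise premise of `first-⊑`.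
  record Reached (i : ℕ) (t : State) : Set where
    private
      B = proj₁ t
      D = proj₂ t
    field
      frame    : Frame k s¹ t
      bits     : ∀ x y → Bit (B x y)
      pending  : ∀ {x y} → i ℕ.< x → B x y ≡ B⁰ x y
      pendingD : ∀ {x} → i ℕ.< x → D x k ≡ 0ℤ
      capped   : ∀ {j} → j ℕ.< k → B i j ≤ cap i j
      nonneg   : ∀ {x} → k ℕ.≤ x → 0ℤ ≤ D x k
      above    : ∀ {x j} → k ℕ.≤ x → x ℕ.< i → j ℕ.≤ k → ∑ (cap (suc x)) j ≤ ∑ (B x) j
      below    : ∀ {x j} → k ℕ.≤ x → j ℕ.≤ k → ∑ (B x) j ≤ ∑ (cap x) j
    open Frame frame public

  reached-start : Reached k s¹
  reached-start = record
    { frame    = Frame-refl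
    ; bits     = C.bits
    ; pending  = λ _ → refl
    ; pendingD = λ k<x → trans (D¹-other (inj₁ (ℕ.>⇒≢ k<x))) (zeros ℕ.≤-refl)
    ; capped   = λ _ → B⁰≤cap k _
    ; nonneg   = λ {x} k≤x → difference (∑ (cap x) k) (∑ (B⁰ x) k) (D¹ x k) (cap-sum k≤x) (∑-mono k (λ _ → B⁰≤cap x _))
    ; above    = λ k≤x x<k → contradiction x<k (ℕ.≤⇒≯ k≤x)
    ; below    = λ {x} {j} _ _ → ∑-mono j (λ _ → B⁰≤cap x _)
    }
    where
    difference : ∀ p q d → p ≡ q + d → q ≤ p → 0ℤ ≤ d
    difference p q d e le = linear (≤-reflexive e ⊞ le) (solve (p ∷ q ∷ d ∷ []))

  module _ {i t} (k≤i : k ℕ.≤ i) (i<m : i ℕ.< m) (r : Reached i t) where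
    private
      module R = Reached r
      t′ = untangle i k t
      B  = proj₁ t
      D  = proj₂ t
      B′ = proj₁ t′
      D′ = proj₂ t′

    step-untangles : UntanglesState i k t t′
    step-untangles = untangle-spec i B (λ _ → R.bits i _) (λ _ → R.bits (suc i) _) (R.pendingD ℕ.≤-refl)

    private
      module U = Untangles step-untangles

      frame′ : Frame k s¹ t′
      frame′ = Frame-trans R.frame (Untangles⇒Frame k≤i step-untangles)

      second≡cap : ∀ j → B (suc i) j ≡ cap (suc i) j
      second≡cap j = trans (R.pending ℕ.≤-refl) (sym (cap-other (ℕ.>⇒≢ (ℕ.s≤s k≤i)) j))

      second⊑cap : ∀ {j} → j ℕ.≤ k → ∑ (B (suc i)) j ≤ ∑ (cap i) j
      second⊑cap {j} j≤k = ≤-trans (≤-reflexive (∑-cong j (λ _ → second≡cap _))) (cap-nested k≤i (ℕ.s≤s i<m) j≤k)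

      first⊑cap : ∀ {j} → j ℕ.≤ k → ∑ (B′ i) j ≤ ∑ (cap i) j
      first⊑cap j≤k = first-⊑ (proj₂ (truncate U.rows j≤k)) (λ y<j → R.capped (ℕ.<-≤-trans y<j j≤k))
                        (λ y≤j → second⊑cap (ℕ.≤-trans y≤j j≤k))

      apart : ∀ {x} → i ℕ.< x → x ≢ suc i → OffRows i x
      apart i<x x≢si = ℕ.>⇒≢ i<x , x≢si

      before : ∀ {x} → x ℕ.< i → OffRows i x
      before x<i = ℕ.<⇒≢ x<i , ℕ.<⇒≢ (ℕ.m<n⇒m<1+n x<i)

      bits′ : ∀ x y → Bit (B′ x y)
      bits′ x y with place i k x y
      ... | first refl y<k  = first-bit U.rows y<k (R.bits i y)
      ... | second refl y<k = second-bit U.rows y<k (R.bits (suc i) y)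
      ... | off o           = subst Bit (sym (U.restB o)) (R.bits x y)

      nonneg′ : ∀ {x} → k ℕ.≤ x → 0ℤ ≤ D′ x k
      nonneg′ {x} k≤x with placeD i k x k
      -- The critical subtraction `D[i,k] - d`: path `i` leaves column `k` where `cap i` does, and
      -- it enters no lower, since `first-⊑` keeps the new row within `cap i`.
      ... | first refl _   = difference (∑ (B′ i) k) (D′ i k) (∑ (cap i) k)
                               (trans (Frame.conserved frame′ i) (sym (cap-sum k≤i))) (first⊑cap ℕ.≤-refl)
        where
        difference : ∀ p d q → p + d ≡ q → p ≤ q → 0ℤ ≤ d
        difference p d q e le = linear (≤-reflexive (sym e) ⊞ le) (solve (p ∷ d ∷ q ∷ []))
      ... | second refl _  = swaps≥0 U.rows
      ... | off o          = subst (0ℤ ≤_) (sym (U.restD o)) (R.nonneg k≤x)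

      above′ : ∀ {x j} → k ℕ.≤ x → x ℕ.< suc i → j ℕ.≤ k → ∑ (cap (suc x)) j ≤ ∑ (B′ x) j
      above′ {x} {j} k≤x x<si j≤k with ℕ.m<1+n⇒m<n∨m≡n x<si
      ... | inj₁ x<i  = ≤-trans (R.above k≤x x<i j≤k) (≤-reflexive (sym (∑-cong j (λ _ → U.restB (inj₁ (before x<i))))))
      ... | inj₂ refl = ≤-trans (≤-reflexive (sym (∑-cong j (λ _ → second≡cap _)))) (second⊑first U.rows j≤k)

      below′ : ∀ {x j} → k ℕ.≤ x → j ℕ.≤ k → ∑ (B′ x) j ≤ ∑ (cap x) j
      below′ {x} {j} k≤x j≤k with x ℕ.≟ i | x ℕ.≟ suc i
      ... | yes refl | _        = first⊑cap j≤k
      ... | no _     | yes refl = ∑-mono j λ y<j →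
              ≤-trans (second-≤ U.rows (ℕ.<-≤-trans y<j j≤k)) (≤-reflexive (second≡cap _))
      ... | no x≢i   | no x≢si  =
              ≤-trans (≤-reflexive (∑-cong j (λ _ → U.restB (inj₁ (x≢i , x≢si))))) (R.below k≤x j≤k)

    step-reached : Reached (suc i) t′
    step-reached = record
      { frame    = frame′
      ; bits     = bits′
      ; pending  = λ si<x → trans (U.restB (inj₁ (apart (ℕ.<⇒≤ si<x) (ℕ.>⇒≢ si<x)))) (R.pending (ℕ.<⇒≤ si<x))
      ; pendingD = λ si<x → trans (U.restD (inj₁ (apart (ℕ.<⇒≤ si<x) (ℕ.>⇒≢ si<x)))) (R.pendingD (ℕ.<⇒≤ si<x))
      ; capped   = λ j<k → ≤-trans (second-≤ U.rows j<k) (≤-reflexive (second≡cap _))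
      ; nonneg   = nonneg′
      ; above    = above′
      ; below    = below′
      }

  module _ {t} (r : Reached m t) where
    private
      module R = Reached r
      B = proj₁ t
      D = proj₂ t

      plus-∑ : ∀ {x} → k ℕ.< x → ∀ z j → z + ∑ (D¹ x) j ≡ z + ∑ (D⁰ x) j
      plus-∑ k<x z j = cong (_+_ z) (∑-cong j (λ {y} _ → D¹-other {y = y} (inj₁ (ℕ.>⇒≢ k<x))))

      untouched : ∀ {x y} → x ℕ.< k ⊎ y ≢ k → D x y ≡ D⁰ x y
      untouched (inj₁ x<k) = trans (R.restD (inj₁ x<k)) (D¹-other (inj₁ (ℕ.<⇒≢ x<k)))
      untouched (inj₂ y≢k) = trans (R.restD (inj₂ y≢k)) (D¹-other (inj₂ y≢k))

    reached-zeros : ∀ {x y} → y ℕ.< k → D x y ≡ 0ℤ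
    reached-zeros y<k = trans (untouched (inj₂ (ℕ.<⇒≢ y<k))) (zeros (ℕ.m<n⇒m<1+n y<k))

    private
      lower : ∀ {x y} → x ℕ.≤ y → B x y ≡ 0ℤ
      lower {x} {y} x≤y with y ℕ.<? k
      ... | yes y<k = trans (R.restB (inj₁ (ℕ.≤-<-trans x≤y y<k))) (C.lower x≤y)
      ... | no y≮k  = trans (R.restB (inj₂ (ℕ.≮⇒≥ y≮k))) (C.lower x≤y)

      lowerD : ∀ {x y} → x ℕ.< y → D x y ≡ 0ℤ
      lowerD {x} {y} x<y with y ℕ.≟ k
      ... | yes refl = trans (untouched (inj₁ x<y)) (C.lowerD x<y)
      ... | no y≢k   = trans (untouched (inj₂ y≢k)) (C.lowerD x<y)

      nonneg : ∀ {x y} → k ℕ.≤ x → x ℕ.< n → 0ℤ ≤ D x y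
      nonneg {x} {y} k≤x x<n with ℕ.<-cmp y k | ℕ.m≤n⇒m<n∨m≡n k≤x
      ... | tri≈ _ refl _ | _         = R.nonneg k≤x
      ... | tri< y<k _ _  | _         = ≤-reflexive (sym (reached-zeros y<k))
      ... | tri> _ y≢k _  | inj₁ k<x  = subst (0ℤ ≤_) (sym (untouched (inj₂ y≢k))) (C.nonneg k<x x<n)
      ... | tri> _ _ k<y  | inj₂ refl = ≤-reflexive (sym (lowerD k<y))

      exit : ∀ {x} → k ℕ.≤ x → ∑ (B x) k + ∑ (D x) (suc k) ≡ ∑ (cap x) k
      exit {x} k≤x = begin
        ∑ (B x) k + ∑ (D x) (suc k)  ≡⟨ drop-zeros {D x} k (∑ (B x) k) reached-zeros ⟩
        ∑ (B x) k + D x k            ≡⟨ R.conserved x ⟩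
        ∑ (B⁰ x) k + D¹ x k          ≡⟨ cap-sum k≤x ⟨
        ∑ (cap x) k                  ∎
        where open ≡-Reasoning

      disjoint : ∀ {i j} → k ℕ.≤ j → j ℕ.≤ i → suc i ℕ.< n →
        ∑ (B (suc i)) j + ∑ (D (suc i)) (suc j) ≤ ∑ (B i) j + ∑ (D i) j
      disjoint {i} {j} k≤j j≤i si<n with ℕ.m≤n⇒m<n∨m≡n k≤j
      ... | inj₁ k<j = subst₂ _≤_
              (sym (trans (R.exits k<j) (plus-∑ (ℕ.m<n⇒m<1+n k<i) (∑ (B⁰ (suc i)) j) (suc j))))
              (sym (trans (R.entries k<j) (plus-∑ k<i (∑ (B⁰ i) j) j)))
              (C.disjoint k<j j≤i si<n)
        where k<i = ℕ.<-≤-trans k<j j≤i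
      -- Column `k` becomes combed now: path `i + 1` leaves it where `cap (suc i)` does, and `above`
      -- places this over the entry of path `i`.
      ... | inj₂ refl = ≤-trans (≤-reflexive (exit (ℕ.m≤n⇒m≤1+n j≤i)))
              (≤-trans (R.above j≤i (ℕ.s≤s⁻¹ si<n) ℕ.≤-refl)
                (≤-reflexive (sym (trans (cong (_+_ (∑ (B i) k)) (∑-zero k reached-zeros)) (ℤ.+-identityʳ _)))))

      rowsum : ∀ {x} → k ℕ.≤ x → x ℕ.< n → ∑ (B x) x + ∑ (D x) (suc x) ≡ + x
      rowsum {x} k≤x x<n with ℕ.m≤n⇒m<n∨m≡n k≤x
      ... | inj₁ k<x  = trans (R.exits k<x) (trans (plus-∑ k<x (∑ (B⁰ x) x) (suc x)) (C.rowsum k<x x<n))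
      ... | inj₂ refl = trans (exit k≤x) (trans (∑-cong k (λ {y} _ → cap-self y)) (∑-ones k))

    reached-combed : Combed n k t
    reached-combed = record
      { bits     = R.bits
      ; lower    = lower
      ; lowerD   = lowerD
      ; cliff    = λ _ _ → reached-zeros
      ; nonneg   = nonneg
      ; nested   = λ k≤i si<n j≤k →
                     ≤-trans (R.below (ℕ.m≤n⇒m≤1+n k≤i) j≤k) (R.above k≤i (ℕ.s≤s⁻¹ si<n) j≤k)
      ; disjoint = disjoint
      ; rowsum   = rowsum
      }

-- Heights during uncombing

StateWithHeights : Set
StateWithHeights = Array₂ × Array₂ × Array

matrices : StateWithHeights → State
matrices (B , D , h) = B , D

-- `h` lags one column behind: round `k` finds heights at column `k - 1`, and `updateHeight` moves
-- them on to column `k`. Round 0 sets every height itself, so nothing is required before it.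
Stale : ℕ → StateWithHeights → ℕ → Set
Stale zero    (B , D , h) x = ⊤
Stale (suc k) (B , D , h) x = h x ≡ + x - ∑ (B x) k

Fresh : ℕ → StateWithHeights → ℕ → Set
Fresh k = Stale (suc k)

Stale-cong : ∀ k {x} t t′ → (∀ y → proj₁ t′ x y ≡ proj₁ t x y) → proj₂ (proj₂ t′) x ≡ proj₂ (proj₂ t) x →
  Stale k t x → Stale k t′ x
Stale-cong zero    _ _ B≡ h≡ st = tt
Stale-cong (suc k) {x} _ _ B≡ h≡ st = trans h≡ (trans st (cong (_-_ (+ x)) (sym (∑-cong k (λ {y} _ → B≡ y)))))

Heights : ℕ → ℕ → ℕ → StateWithHeights → Set
Heights n k i t =
  (∀ {x} → i ℕ.≤ x → x ℕ.< n → Fresh k t x) × (∀ {x} → k ℕ.≤ x → x ℕ.< i → Stale k t x)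

updateHeight-fresh : ∀ k {B D h x} → Stale k (B , D , h) x → Fresh k (B , D , updateHeight x k B h) x
updateHeight-fresh zero    {h = h} {x} _ = trans (update-same h (+ x) x) (sym (ℤ.+-identityʳ (+ x)))
updateHeight-fresh (suc k) {B} {D} {h} {x} st =
  trans (update-same h (h x - B x k) x) (calc (h x) (+ x) (∑ (B x) k) (B x k) st)
  where
  calc : ∀ h x p b → h ≡ x - p → h - b ≡ x - (p + b)
  calc h x p b e = linear≡ e (solve (h ∷ x ∷ p ∷ b ∷ []))

updateHeight-other : ∀ k {B h x r} → r ≢ x → updateHeight x k B h r ≡ h r
updateHeight-other zero    {B} {h} {x} r≢x = update-other h (+ x) r≢x
updateHeight-other (suc k) {B} {h} {x} r≢x = update-other h (h x - B x k) r≢x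

module _ {m k : ℕ} {i : ℕ} where

  uncombBody-inner : ∀ {B D h} → i ℕ.< m →
    uncombBody (suc m) k i (B , D , h) ≡ cliffify i k (B , D , updateHeight i k B h)
  uncombBody-inner {B} {D} {h} i<m =
    cong (if_then cliffify i k (B , D , updateHeight i k B h) else (B , D , updateHeight i k B h)) (dec-true (i ℕ.<? m) i<m)

  uncombBody-spec : ∀ {B D h} → let t = (B , D , h) in k ℕ.≤ i → i ℕ.< m → Heights (suc m) k (suc i) t →
    (∀ {j} → j ℕ.< k → Bit (B i j)) → (∀ {j} → j ℕ.< k → Bit (B (suc i) j)) →
    (∀ {j} → j ℕ.≤ k → ∑ (B (suc i)) j ≤ ∑ (B i) j) →
    0ℤ ≤ D (suc i) k → ∑ (B (suc i)) k + D (suc i) k ≤ ∑ (B i) k →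
    UntanglesState i k (matrices (uncombBody (suc m) k i t)) (matrices t) ×
    Heights (suc m) k i (uncombBody (suc m) k i t)
  uncombBody-spec {B} {D} {h} k≤i i<m (fresh , stale) bc ba nested 0≤δ room
    rewrite uncombBody-inner {B} {D} {h} i<m = u , fresh₀ , stale₀
    where
    t = B , D , h
    h′ = updateHeight i k B h
    spec = cliffify-spec i B {D} {h′} {k} bc ba nested
      (updateHeight-fresh k {D = D} (stale k≤i ℕ.≤-refl))
      (trans (updateHeight-other k {B} {h} suc≢) (fresh ℕ.≤-refl (ℕ.s≤s i<m)))
      0≤δ room
    u = proj₁ spec
    t₀ = cliffify i k (B , D , h′)
    B₀ = proj₁ t₀
    h₀ = proj₂ (proj₂ t₀)
    module U = Untangles u
    h-other : ∀ {x} → OffRows i x → h₀ x ≡ h x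
    h-other o = trans (proj₂ (proj₂ (proj₂ spec)) o) (updateHeight-other k {B} {h} (proj₁ o))
    fresh₀ : ∀ {x} → i ℕ.≤ x → x ℕ.< suc m → Fresh k t₀ x
    fresh₀ {x} i≤x x<n with x ℕ.≟ i | x ℕ.≟ suc i
    ... | yes refl | _ = calc (h₀ i) (h′ i) (D (suc i) k) (+ i) (∑ (B i) k) (∑ (B₀ i) k)
            (proj₁ (proj₂ spec)) (updateHeight-fresh k {D = D} (stale k≤i ℕ.≤-refl)) (∑-first U.rows)
      where
      calc : ∀ h₀ h′ δ i p q → h₀ ≡ h′ + δ → h′ ≡ i - p → p ≡ q + δ → h₀ ≡ i - q
      calc h₀ h′ δ i p q e f g = linear≡ (e ⊞≡ f ⊞≡ sym g) (solve (h₀ ∷ h′ ∷ δ ∷ i ∷ p ∷ q ∷ []))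
    ... | no _ | yes refl = calc (h₀ (suc i)) (h′ (suc i)) (h (suc i)) (D (suc i) k) (+ suc i) (∑ (B (suc i)) k) (∑ (B₀ (suc i)) k)
            (proj₁ (proj₂ (proj₂ spec))) (updateHeight-other k {B} {h} suc≢) (fresh ℕ.≤-refl x<n) (∑-second U.rows)
      where
      calc : ∀ h₀ h′ h δ i p q → h₀ ≡ h′ - δ → h′ ≡ h → h ≡ i - p → p + δ ≡ q → h₀ ≡ i - q
      calc h₀ h′ h δ i p q e e′ f g = linear≡ (e ⊞≡ e′ ⊞≡ f ⊞≡ sym g) (solve (h₀ ∷ h′ ∷ h ∷ δ ∷ i ∷ p ∷ q ∷ []))
    ... | no x≢i | no x≢si = Stale-cong (suc k) t t₀ (λ _ → sym (U.restB (inj₁ (x≢i , x≢si)))) (h-other (x≢i , x≢si))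
            (fresh (ℕ.≤∧≢⇒< i≤x (x≢i ∘ sym)) x<n)
    stale₀ : ∀ {x} → k ℕ.≤ x → x ℕ.< i → Stale k t₀ x
    stale₀ k≤x x<i = Stale-cong k t t₀ (λ _ → sym (U.restB (inj₁ o))) (h-other o) (stale k≤x (ℕ.m<n⇒m<1+n x<i))
      where o = ℕ.<⇒≢ x<i , ℕ.<⇒≢ (ℕ.m<n⇒m<1+n x<i)

module _ {m k : ℕ} where

  uncombBody-outer : ∀ t → matrices (uncombBody (suc m) k m t) ≡ matrices t
  uncombBody-outer (B , D , h) = cong matrices
    (cong (if_then cliffify m k (B , D , updateHeight m k B h) else (B , D , updateHeight m k B h)) (dec-false (m ℕ.<? m) (ℕ.<-irrefl refl)))

  uncombBody-heights : ∀ {t} → k ℕ.≤ m → (∀ {x} → k ℕ.≤ x → x ℕ.< suc m → Stale k t x) →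
    Heights (suc m) k m (uncombBody (suc m) k m t)
  uncombBody-heights {B , D , h} k≤m stale = subst (Heights (suc m) k m) (sym body≡) (fresh₀ , stale₀)
    where
    t′ = B , D , updateHeight m k B h
    body≡ : uncombBody (suc m) k m (B , D , h) ≡ t′
    body≡ = cong (if_then cliffify m k t′ else t′) (dec-false (m ℕ.<? m) (ℕ.<-irrefl refl))
    fresh₀ : ∀ {x} → m ℕ.≤ x → x ℕ.< suc m → Fresh k t′ x
    fresh₀ m≤x x<n with ℕ.≤-antisym m≤x (ℕ.s≤s⁻¹ x<n)
    ... | refl = updateHeight-fresh k {D = D} (stale k≤m ℕ.≤-refl)
    stale₀ : ∀ {x} → k ℕ.≤ x → x ℕ.< m → Stale k t′ x
    stale₀ k≤x x<m = Stale-cong k (B , D , h) t′ (λ _ → refl) (updateHeight-other k {B} {h} (ℕ.<⇒≢ x<m)) (stale k≤x (ℕ.m<n⇒m<1+n x<m))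

-- One uncombing round

∑-nonneg : ∀ {f} k → (∀ y → 0ℤ ≤ f y) → 0ℤ ≤ ∑ f k
∑-nonneg zero    f≥0 = ≤-refl
∑-nonneg (suc k) f≥0 = ∑-nonneg k f≥0 ⊞ f≥0 k

module UncombRound {m k : ℕ} (k≤m : k ℕ.≤ m) {s : State} (combed : Combed (suc m) k s) where

  private
    n  = suc m
    B¹ = proj₁ s
    D¹ = proj₂ s
    module C = Combed combed

    k<n : k ℕ.< n
    k<n = ℕ.s≤s k≤m

    exit : ∀ {x} → k ℕ.≤ x → x ℕ.< n → ∑ (B¹ x) k + ∑ (D¹ x) (suc k) ≡ ∑ (B¹ x) k + D¹ x k
    exit {x} k≤x x<n = drop-zeros {D¹ x} k (∑ (B¹ x) k) (C.cliff k≤x x<n)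

    -- Disjointness in column `k`, stripped of the earlier columns of `D`, which vanish: the
    -- verticals to be absorbed fit into the gap between the rows.
    room : ∀ {i} → k ℕ.≤ i → suc i ℕ.< n → ∑ (B¹ (suc i)) k + D¹ (suc i) k ≤ ∑ (B¹ i) k
    room {i} k≤i si<n = subst₂ _≤_ (exit (ℕ.m≤n⇒m≤1+n k≤i) si<n)
      (trans (cong (_+_ (∑ (B¹ i) k)) (∑-zero k (C.cliff k≤i (ℕ.<⇒≤ si<n)))) (ℤ.+-identityʳ _))
      (C.disjoint ℕ.≤-refl k≤i si<n)

  -- Mirror image of the combing invariant: by prefix sums a finished row `x` lies between the old
  -- rows `x` (`raised`) and `x - 1` (`bounded`). `current` is the entrywise premise of `second-⊒`
  -- for the operation in which row `i` comes second.
  record Reached (i : ℕ) (t : StateWithHeights) : Set where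
    private
      B = proj₁ (matrices t)
      D = proj₂ (matrices t)
    field
      frame    : Frame k s (matrices t)
      bits     : ∀ x y → Bit (B x y)
      pending  : ∀ {x y} → x ℕ.< i → B x y ≡ B¹ x y
      current  : ∀ {j} → j ℕ.< k → B i j ≤ B¹ i j
      nonneg   : ∀ {x} → k ℕ.≤ x → x ℕ.< n → 0ℤ ≤ D x k
      cleared  : ∀ {x} → i ℕ.< x → x ℕ.< n → D x k ≡ 0ℤ
      raised   : ∀ {x j} → i ℕ.< x → x ℕ.< n → j ℕ.≤ k → ∑ (B¹ x) j ≤ ∑ (B x) j
      bounded  : ∀ {x j} → i ℕ.≤ x → suc x ℕ.< n → j ℕ.≤ k → ∑ (B (suc x)) j ≤ ∑ (B¹ x) j
      heights  : Heights n k i t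
    open Frame frame public

  reached-start : ∀ {t} → matrices t ≡ s → Heights n k m t → Reached m t
  reached-start {B , D , h} refl heights = record
    { frame   = Frame-refl
    ; bits    = C.bits
    ; pending = λ _ → refl
    ; current = λ _ → ≤-refl
    ; nonneg  = C.nonneg
    ; cleared = λ m<x x<n → contradiction m<x (ℕ.≤⇒≯ (ℕ.s≤s⁻¹ x<n))
    ; raised  = λ _ _ _ → ≤-refl
    ; bounded = λ m≤x sx<n → contradiction (ℕ.s≤s⁻¹ sx<n) (ℕ.≤⇒≯ m≤x)
    ; heights = heights
    }

  module _ {i t} (k≤i : k ℕ.≤ i) (i<m : i ℕ.< m) (r : Reached (suc i) t) where
    private
      module R = Reached r
      t₀ = uncombBody n k i t
      B  = proj₁ (matrices t)
      D  = proj₂ (matrices t)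
      B₀ = proj₁ (matrices t₀)
      D₀ = proj₂ (matrices t₀)

      k≤si = ℕ.m≤n⇒m≤1+n k≤i
      si<n = ℕ.s≤s i<m

      first≡ : ∀ j → ∑ (B i) j ≡ ∑ (B¹ i) j
      first≡ j = ∑-cong j (λ _ → R.pending ℕ.≤-refl)

      step = uncombBody-spec {m} {k} {i} {B} {D} {proj₂ (proj₂ t)} k≤i i<m R.heights
        (λ _ → R.bits i _) (λ _ → R.bits (suc i) _)
        (λ {j} j≤k → ≤-trans (∑-mono j (λ y<j → R.current (ℕ.<-≤-trans y<j j≤k)))
           (≤-trans (C.nested k≤i si<n j≤k) (≤-reflexive (sym (first≡ j)))))
        (R.nonneg k≤si si<n)
        (≤-trans (≤-reflexive (R.conserved (suc i))) (≤-trans (room k≤i si<n) (≤-reflexive (sym (first≡ k)))))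

    step-untangles : UntanglesState i k (matrices t₀) (matrices t)
    step-untangles = proj₁ step

    private
      module U = Untangles step-untangles

      B≡ : ∀ {x y} → OffRows i x → B₀ x y ≡ B x y
      B≡ o = sym (U.restB (inj₁ o))

      beyond : ∀ {x} → suc i ℕ.< x → OffRows i x
      beyond si<x = ℕ.>⇒≢ (ℕ.<⇒≤ si<x) , ℕ.>⇒≢ si<x

      before : ∀ {x} → x ℕ.< i → OffRows i x
      before x<i = ℕ.<⇒≢ x<i , ℕ.<⇒≢ (ℕ.m<n⇒m<1+n x<i)

      bits′ : ∀ x y → Bit (B₀ x y)
      bits′ x y with place i k x y
      ... | first refl y<k  = first-bit⁻ U.rows y<k (R.bits i y)
      ... | second refl y<k = second-bit⁻ U.rows y<k (R.bits (suc i) y)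
      ... | off o           = subst Bit (U.restB o) (R.bits x y)

      nonneg′ : ∀ {x} → k ℕ.≤ x → x ℕ.< n → 0ℤ ≤ D₀ x k
      nonneg′ {x} k≤x x<n with placeD i k x k
      ... | first refl _   = add (D₀ i k) (D i k) (D (suc i) k) U.below (R.nonneg k≤x x<n) (R.nonneg k≤si si<n)
        where
        add : ∀ d₀ d δ → d ≡ d₀ - δ → 0ℤ ≤ d → 0ℤ ≤ δ → 0ℤ ≤ d₀
        add d₀ d δ e p q = linear (≤-reflexive e ⊞ p ⊞ q) (solve (d₀ ∷ d ∷ δ ∷ []))
      ... | second refl _  = ≤-reflexive (sym U.above)
      ... | off o          = subst (0ℤ ≤_) (U.restD o) (R.nonneg k≤x x<n)

      cleared′ : ∀ {x} → i ℕ.< x → x ℕ.< n → D₀ x k ≡ 0ℤ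
      cleared′ i<x x<n with ℕ.m≤n⇒m<n∨m≡n i<x
      ... | inj₁ si<x = trans (sym (U.restD (inj₁ (beyond si<x)))) (R.cleared si<x x<n)
      ... | inj₂ refl = U.above

      raised′ : ∀ {x j} → i ℕ.< x → x ℕ.< n → j ℕ.≤ k → ∑ (B¹ x) j ≤ ∑ (B₀ x) j
      raised′ {x} {j} i<x x<n j≤k with ℕ.m≤n⇒m<n∨m≡n i<x
      ... | inj₁ si<x = ≤-trans (R.raised si<x x<n j≤k) (≤-reflexive (sym (∑-cong j (λ _ → B≡ (beyond si<x)))))
      -- The old row `i + 1` is the competitor `w`. Its sum is no larger than that of the new row,
      -- in which the verticals of column `k` have become diagonals.
      ... | inj₂ refl = second-⊒ U.rows R.current
              (λ {y} y≤k → ≤-trans (C.nested k≤i si<n y≤k) (≤-reflexive (sym (first≡ y))))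
              (grow (∑ (B¹ (suc i)) k) (D¹ (suc i) k) (∑ (B (suc i)) k) (D (suc i) k) (∑ (B₀ (suc i)) k)
                (R.conserved (suc i)) (∑-second U.rows) (C.nonneg k≤si si<n))
              j≤k
        where
        grow : ∀ p d q e r → q + e ≡ p + d → q + e ≡ r → 0ℤ ≤ d → p ≤ r
        grow p d q e r f g le = linear (≤-reflexive (sym f) ⊞ ≤-reflexive g ⊞ le) (solve (p ∷ d ∷ q ∷ e ∷ r ∷ []))

      bounded′ : ∀ {x j} → i ℕ.≤ x → suc x ℕ.< n → j ℕ.≤ k → ∑ (B₀ (suc x)) j ≤ ∑ (B¹ x) j
      bounded′ {x} {j} i≤x sx<n j≤k with ℕ.m≤n⇒m<n∨m≡n i≤x
      ... | inj₁ i<x  = ≤-trans (≤-reflexive (∑-cong j (λ _ → B≡ (beyond (ℕ.s≤s i<x))))) (R.bounded i<x sx<n j≤k)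
      ... | inj₂ refl = ≤-trans (second⊑first U.rows j≤k) (≤-reflexive (first≡ j))

    step-reached : Reached i t₀
    step-reached = record
      { frame   = Frame-trans R.frame (Frame-sym (Untangles⇒Frame k≤i step-untangles))
      ; bits    = bits′
      ; pending = λ x<i → trans (B≡ (before x<i)) (R.pending (ℕ.m<n⇒m<1+n x<i))
      ; current = λ j<k → ≤-trans (first-≤ U.rows j<k) (≤-reflexive (R.pending ℕ.≤-refl))
      ; nonneg  = nonneg′
      ; cleared = cleared′
      ; raised  = raised′
      ; bounded = bounded′
      ; heights = proj₂ step
      }

  module _ {t} (r : Reached k t) where
    private
      module R = Reached r
      B = proj₁ (matrices t)
      D = proj₂ (matrices t)

      lower : ∀ {x y} → x ℕ.≤ y → B x y ≡ 0ℤ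
      lower {x} {y} x≤y with y ℕ.<? k
      ... | yes y<k = trans (R.restB (inj₁ (ℕ.≤-<-trans x≤y y<k))) (C.lower x≤y)
      ... | no y≮k  = trans (R.restB (inj₂ (ℕ.≮⇒≥ y≮k))) (C.lower x≤y)

      lowerD : ∀ {x y} → x ℕ.< y → D x y ≡ 0ℤ
      lowerD {x} {y} x<y with y ℕ.≟ k
      ... | yes refl = trans (R.restD (inj₁ x<y)) (C.lowerD x<y)
      ... | no y≢k   = trans (R.restD (inj₂ y≢k)) (C.lowerD x<y)

      cliff : ∀ {x y} → k ℕ.< x → x ℕ.< n → y ℕ.< suc k → D x y ≡ 0ℤ
      cliff k<x x<n y<sk with ℕ.m<1+n⇒m<n∨m≡n y<sk
      ... | inj₁ y<k  = trans (R.restD (inj₂ (ℕ.<⇒≢ y<k))) (C.cliff (ℕ.<⇒≤ k<x) x<n y<k)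
      ... | inj₂ refl = R.cleared k<x x<n

      nonneg : ∀ {x y} → k ℕ.< x → x ℕ.< n → 0ℤ ≤ D x y
      nonneg {x} {y} k<x x<n with y ℕ.≟ k
      ... | yes refl = R.nonneg (ℕ.<⇒≤ k<x) x<n
      ... | no y≢k   = subst (0ℤ ≤_) (sym (R.restD (inj₂ y≢k))) (C.nonneg (ℕ.<⇒≤ k<x) x<n)

      disjoint : ∀ {i j} → k ℕ.< j → j ℕ.≤ i → suc i ℕ.< n →
        ∑ (B (suc i)) j + ∑ (D (suc i)) (suc j) ≤ ∑ (B i) j + ∑ (D i) j
      disjoint k<j j≤i si<n =
        subst₂ _≤_ (sym (R.exits k<j)) (sym (R.entries k<j)) (C.disjoint (ℕ.<⇒≤ k<j) j≤i si<n)

      nested : ∀ {i j} → k ℕ.< i → suc i ℕ.< n → j ℕ.≤ suc k → ∑ (B (suc i)) j ≤ ∑ (B i) j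
      nested {i} {j} k<i si<n j≤sk with ℕ.m≤n⇒m<n∨m≡n j≤sk
      ... | inj₁ (ℕ.s≤s j≤k) = ≤-trans (R.bounded (ℕ.<⇒≤ k<i) si<n j≤k) (R.raised k<i (ℕ.<⇒≤ si<n) j≤k)
      -- The prefix of length `suc k` is new; it comes from disjointness in column `suc k`, before
      -- which row `i` has no verticals left.
      ... | inj₂ refl = discard (∑ (B (suc i)) (suc k)) (∑ (D (suc i)) (suc (suc k))) (∑ (B i) (suc k)) (∑ (D i) (suc k))
              (disjoint ℕ.≤-refl k<i si<n)
              (∑-nonneg (suc (suc k)) (λ y → nonneg (ℕ.m<n⇒m<1+n k<i) si<n))
              (∑-zero (suc k) (cliff k<i (ℕ.<⇒≤ si<n)))
        where
        discard : ∀ p x q y → p + x ≤ q + y → 0ℤ ≤ x → y ≡ 0ℤ → p ≤ q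
        discard p x q y le x≥0 y≡0 = linear (le ⊞ x≥0 ⊞ ≤-reflexive y≡0) (solve (p ∷ x ∷ q ∷ y ∷ []))

    reached-combed : Combed n (suc k) (matrices t)
    reached-combed = record
      { bits     = R.bits
      ; lower    = lower
      ; lowerD   = lowerD
      ; cliff    = cliff
      ; nonneg   = nonneg
      ; nested   = nested
      ; disjoint = disjoint
      ; rowsum   = λ k<x x<n → trans (R.exits k<x) (C.rowsum (ℕ.<⇒≤ k<x) x<n)
      }

    -- Row `k` keeps its verticals in column `k`, and the row sum fixes their number: it is the
    -- value that combing assigns at the start of its round.
    reached-diagonal : D k k ≡ + k - ∑ (B k) k
    reached-diagonal = calc (D k k) (∑ (B k) k) (∑ (B¹ k) k) (D¹ k k) (+ k)
      (R.conserved k) (trans (sym (exit ℕ.≤-refl k<n)) (C.rowsum ℕ.≤-refl k<n))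
      where
      calc : ∀ d p q e k → p + d ≡ q + e → q + e ≡ k → d ≡ k - p
      calc d p q e k f g = linear≡ (f ⊞≡ g) (solve (d ∷ p ∷ q ∷ e ∷ k ∷ []))

-- Combing and uncombing undo each other

uncombRound : ℕ → ℕ → StateWithHeights → StateWithHeights
uncombRound n k = for (descending k n) (uncombBody n k)

-- Separate from `Combed` because it belongs to combing only; uncombing leaves the diagonal entries
-- of `D` behind.
Zeros : ℕ → State → Set
Zeros k (B , D) = ∀ {x y} → y ℕ.< k → D x y ≡ 0ℤ

module CombTrace {m k : ℕ} (k≤m : k ℕ.≤ m) {s : State} (combed : Combed (suc m) (suc k) s)
  (zeros : Zeros (suc k) s) where

  open CombRound k≤m combed zeros

  at : ℕ → State
  at x = for (ascending k x) (λ i → untangle i k) s¹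

  at-reached : ∀ {x} → k ℕ.≤ x → x ℕ.≤ m → Reached x (at x)
  at-reached k≤x x≤m =
    for-ascending (λ i → untangle i k) Reached k≤x (λ k≤y y<x → step-reached k≤y (ℕ.<-≤-trans y<x x≤m)) reached-start

  at-untangles : ∀ {x} → k ℕ.≤ x → x ℕ.< m → UntanglesState x k (at x) (at (suc x))
  at-untangles {x} k≤x x<m = subst (UntanglesState x k (at x)) (sym (ascending-snoc (λ i → untangle i k) k≤x s¹))
    (step-untangles k≤x x<m (at-reached k≤x (ℕ.<⇒≤ x<m)))

  round-combed : Combed (suc m) k (combRound (suc m) k s)
  round-combed = reached-combed (at-reached k≤m ℕ.≤-refl)

  round-zeros : Zeros k (combRound (suc m) k s)
  round-zeros = reached-zeros (at-reached k≤m ℕ.≤-refl)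

  UndoneTo : ℕ → StateWithHeights → Set
  UndoneTo x v = Match (suc m) k (at x) (matrices v) × Heights (suc m) k x v

  -- `cliffify` runs on `v`, but its range conditions are read off the recorded operation
  -- `at-untangles` and transported along the match; backward determinism does the rest.
  undo-untangle : ∀ {x v} → k ℕ.≤ x → x ℕ.< m → UndoneTo (suc x) v → UndoneTo x (uncombBody (suc m) k x v)
  undo-untangle {x} {v} k≤x x<m (match@(B≡ , D≡) , heights) =
    Untangles-backward (ℕ.s≤s x<m) (at-untangles k≤x x<m) (proj₁ spec) match , proj₂ spec
    where
    module U = Untangles (at-untangles k≤x x<m)
    module R = Reached (at-reached (ℕ.m≤n⇒m≤1+n k≤x) x<m)
    B  = proj₁ (at (suc x))
    D  = proj₂ (at (suc x))
    x<n  = ℕ.m<n⇒m<1+n x<m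
    sx<n = ℕ.s≤s x<m
    ∑≡ : ∀ {y} j → y ℕ.< suc m → ∑ (B y) j ≡ ∑ (proj₁ v y) j
    ∑≡ j y<n = ∑-cong j (λ {z} _ → B≡ z y<n)
    δ≡ : D (suc x) k ≡ proj₁ (proj₂ v) (suc x) k
    δ≡ = D≡ (ℕ.s≤s x<m) ℕ.≤-refl
    spec = uncombBody-spec {m} {k} {x} k≤x x<m heights
      (λ {j} _ → subst Bit (B≡ j x<n) (R.bits x j)) (λ {j} _ → subst Bit (B≡ j sx<n) (R.bits (suc x) j))
      (λ {j} j≤k → subst₂ _≤_ (∑≡ j sx<n) (∑≡ j x<n)
        (≤-trans (∑-mono j (λ y<j → second-≤ U.rows (ℕ.<-≤-trans y<j j≤k))) (second⊑first U.rows j≤k)))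
      (subst (0ℤ ≤_) δ≡ (swaps≥0 U.rows))
      (subst₂ _≤_ (cong₂ _+_ (∑≡ k sx<n) δ≡) (∑≡ k x<n)
        (≤-trans (≤-reflexive (∑-second U.rows)) (second⊑first U.rows ℕ.≤-refl)))

  undo-round : ∀ {t} → Match (suc m) k (combRound (suc m) k s) (matrices t) →
    (∀ {x} → k ℕ.≤ x → x ℕ.< suc m → Stale k t x) →
    Match (suc m) (suc k) s (matrices (uncombRound (suc m) k t)) ×
    (∀ {x} → k ℕ.≤ x → x ℕ.< suc m → Fresh k (uncombRound (suc m) k t) x)
  undo-round {t} match stale
    rewrite descending-cons (uncombBody (suc m) k) k≤m t = restart (proj₁ undone) , proj₁ (proj₂ undone)
    where
    v = for (descending k m) (uncombBody (suc m) k) (uncombBody (suc m) k m t)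
    undone : UndoneTo k v
    undone = for-descending (uncombBody (suc m) k) UndoneTo k≤m undo-untangle
      (subst (Match (suc m) k (at m)) (sym (uncombBody-outer {m} {k} t)) match , uncombBody-heights {m} {k} {t} k≤m stale)
    -- Column `k` of `D`, containing the entry assigned at the start of the combing round, drops out
    -- of the comparison.
    restart : Match (suc m) k (at k) (matrices v) → Match (suc m) (suc k) s (matrices v)
    restart rewrite ascending-empty (λ i → untangle i k) k s¹ = λ (B≡ , D≡) →
      B≡ , λ x<n k<y → trans (sym (D¹-other (inj₂ (ℕ.>⇒≢ k<y)))) (D≡ x<n (ℕ.<⇒≤ k<y))

module UncombTrace {m k : ℕ} (k≤m : k ℕ.≤ m) {t : StateWithHeights} (combed : Combed (suc m) k (matrices t))
  (stale : ∀ {x} → k ℕ.≤ x → x ℕ.< suc m → Stale k t x) where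

  open UncombRound k≤m combed

  private
    body = uncombBody (suc m) k

  at : ℕ → StateWithHeights
  at x = for (descending x m) body (body m t)

  at-reached : ∀ {x} → k ℕ.≤ x → x ℕ.≤ m → Reached x (at x)
  at-reached k≤x x≤m =
    for-descending body Reached x≤m (λ x≤y y<m → step-reached (ℕ.≤-trans k≤x x≤y) y<m)
      (reached-start (uncombBody-outer {m} {k} t) (uncombBody-heights {m} {k} {t} k≤m stale))

  at-untangles : ∀ {x} → k ℕ.≤ x → x ℕ.< m → UntanglesState x k (matrices (at x)) (matrices (at (suc x)))
  at-untangles {x} k≤x x<m =
    subst (λ v → UntanglesState x k (matrices v) (matrices (at (suc x)))) (sym (descending-snoc body x<m (body m t)))
      (step-untangles k≤x x<m (at-reached (ℕ.m≤n⇒m≤1+n k≤x) x<m))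

  round≡ : uncombRound (suc m) k t ≡ at k
  round≡ = descending-cons body k≤m t

  round-combed : Combed (suc m) (suc k) (matrices (uncombRound (suc m) k t))
  round-combed = subst (Combed (suc m) (suc k) ∘ matrices) (sym round≡) (reached-combed (at-reached ℕ.≤-refl k≤m))

  round-fresh : ∀ {x} → k ℕ.≤ x → x ℕ.< suc m → Fresh k (uncombRound (suc m) k t) x
  round-fresh {x} k≤x x<n = subst (λ v → Fresh k v x) (sym round≡)
    (proj₁ (UncombRound.Reached.heights (at-reached ℕ.≤-refl k≤m)) k≤x x<n)

  RedoneTo : ℕ → State → Set
  RedoneTo x u = Match (suc m) k u (matrices (at x)) × Zeros k u

  -- `untangle` is in range as soon as both rows consist of bits and `D[x+1,k]` is 0, which the
  -- recorded states guarantee.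
  redo-untangle : ∀ {x u} → k ℕ.≤ x → x ℕ.< m → RedoneTo x u → RedoneTo (suc x) (untangle x k u)
  redo-untangle {x} {u} k≤x x<m (match@(B≡ , D≡) , zeros) =
    Untangles-forward (ℕ.s≤s x<m) spec (at-untangles k≤x x<m) match ,
    λ {y} {z} z<k → trans (Untangles.restD spec {y} {z} (inj₂ (ℕ.<⇒≢ z<k))) (zeros z<k)
    where
    module R = Reached (at-reached k≤x (ℕ.<⇒≤ x<m))
    bit : ∀ {y} j → y ℕ.< suc m → Bit (proj₁ u y j)
    bit {y} j y<n = subst Bit (sym (B≡ j y<n)) (R.bits y j)
    spec = untangle-spec x (proj₁ u) {proj₂ u} (λ {j} _ → bit j (ℕ.m<n⇒m<1+n x<m)) (λ {j} _ → bit j (ℕ.s≤s x<m))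
      (trans (D≡ (ℕ.s≤s x<m) ℕ.≤-refl) (Untangles.above (at-untangles k≤x x<m)))

  redo-round : ∀ {s} → Match (suc m) (suc k) s (matrices (uncombRound (suc m) k t)) → Zeros (suc k) s →
    Match (suc m) k (combRound (suc m) k s) (matrices t) × Zeros k (combRound (suc m) k s)
  redo-round {B , D} match zeros =
    subst (Match (suc m) k _) (trans (cong matrices (descending-empty body m (body m t))) (uncombBody-outer {m} {k} t)) (proj₁ redone) ,
    proj₂ redone
    where
    D′ = D [ k ][ k ]≔ + k - sum (map (B k) (upTo k))
    match′ : Match (suc m) (suc k) (B , D) (matrices (at k))
    match′ = subst (Match (suc m) (suc k) (B , D) ∘ matrices) round≡ match
    B≡ = proj₁ match′
    module C = Combed (reached-combed (at-reached ℕ.≤-refl k≤m))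
    -- Column `k` when combing resumes: zero for `x < k` by triangularity, the assigned value at
    -- `x ≡ k` by `reached-diagonal`, and zero for `x > k` because uncombing has cleared it.
    column : ∀ {x} → x ℕ.< suc m → D′ x k ≡ proj₂ (matrices (at k)) x k
    column {x} x<n with ℕ.<-cmp x k
    ... | tri≈ _ refl _ = begin
      D′ k k                                 ≡⟨ update₂-same D k k _ ⟩
      + k - sum (map (B k) (upTo k))         ≡⟨ cong (_-_ (+ k)) (sum-∑ (B k) k) ⟩
      + k - ∑ (B k) k                        ≡⟨ cong (_-_ (+ k)) (∑-cong k (λ {y} _ → B≡ y (ℕ.s≤s k≤m))) ⟩
      + k - ∑ (proj₁ (matrices (at k)) k) k  ≡⟨ reached-diagonal (at-reached ℕ.≤-refl k≤m) ⟨
      proj₂ (matrices (at k)) k k            ∎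
      where open ≡-Reasoning
    ... | tri< x<k x≢k _ = trans (update₂-other D k k _ (inj₁ x≢k)) (trans (zeros ℕ.≤-refl) (sym (C.lowerD x<k)))
    ... | tri> _ x≢k k<x = trans (update₂-other D k k _ (inj₁ x≢k)) (trans (zeros ℕ.≤-refl) (sym (C.cliff k<x x<n ℕ.≤-refl)))
    D≡ : ∀ {x y} → x ℕ.< suc m → k ℕ.≤ y → D′ x y ≡ proj₂ (matrices (at k)) x y
    D≡ x<n k≤y with ℕ.m≤n⇒m<n∨m≡n k≤y
    ... | inj₁ k<y  = trans (update₂-other D k k _ (inj₂ (ℕ.>⇒≢ k<y))) (proj₂ match′ x<n k<y)
    ... | inj₂ refl = column x<n
    redone : RedoneTo m (combRound (suc m) k (B , D))
    redone = for-ascending (λ i → untangle i k) RedoneTo k≤m redo-untangle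
      ((B≡ , D≡) , λ y<k → trans (update₂-other D k k _ (inj₂ (ℕ.<⇒≢ y<k))) (zeros (ℕ.m<n⇒m<1+n y<k)))

-- The complete algorithms

combArrays : ℕ → Array₂ → State
combArrays n B = for (descending 0 n) (combRound n) (B , λ _ _ → 0ℤ)

uncombArrays : ℕ → State → Array₂
uncombArrays n (B , D) = proj₁ (for (ascending 0 n) (uncombRound n) (B , D , λ _ → 0ℤ))

module _ {m : ℕ} {B : Array₂} (bits : ∀ x y → Bit (B x y)) (lower : ∀ {x y} → x ℕ.≤ y → B x y ≡ 0ℤ) where

  private
    n = suc m

    at : ℕ → State
    at k = for (descending k n) (combRound n) (B , λ _ _ → 0ℤ)

    CombedTo : ℕ → State → Set
    CombedTo k s = Combed n k s × Zeros k s

    start : CombedTo n (B , λ _ _ → 0ℤ)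
    start = record
      { bits     = bits
      ; lower    = lower
      ; lowerD   = λ _ → refl
      ; cliff    = λ _ _ _ → refl
      ; nonneg   = λ _ _ → ≤-refl
      ; nested   = λ n≤i si<n _ → contradiction (ℕ.<⇒≤ si<n) (ℕ.≤⇒≯ n≤i)
      ; disjoint = λ n≤j j≤i si<n → contradiction (ℕ.<⇒≤ si<n) (ℕ.≤⇒≯ (ℕ.≤-trans n≤j j≤i))
      ; rowsum   = λ n≤x x<n → contradiction x<n (ℕ.≤⇒≯ n≤x)
      } , λ _ → refl

    at-combed : ∀ {k} → k ℕ.≤ n → CombedTo k (at k)
    at-combed k≤n = for-descending (combRound n) CombedTo k≤n
      (λ {x} {s} _ x<n (combed , zeros) →
        CombTrace.round-combed {k = x} (ℕ.s≤s⁻¹ x<n) combed zeros ,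
        λ {y} {z} → CombTrace.round-zeros {k = x} (ℕ.s≤s⁻¹ x<n) combed zeros {y} {z})
      start

  combArrays-combed : Combed n 0 (combArrays n B)
  combArrays-combed = proj₁ (at-combed ℕ.z≤n)

  -- Any `X` matching the combed arrays is allowed, since in the application `X` is loaded from the
  -- encoding of a family.
  uncomb-comb : ∀ {X} → Match n 0 (combArrays n B) X → ∀ {x} y → x ℕ.< n → uncombArrays n X x y ≡ B x y
  uncomb-comb {X} match {x} y x<n =
    sym (trans (cong (λ s → proj₁ s x y) (sym (descending-empty (combRound n) n _))) (proj₁ (proj₁ undone) y x<n))
    where
    Undone : ℕ → StateWithHeights → Set
    Undone k t = Match n k (at k) (matrices t) × (∀ {x} → k ℕ.≤ x → x ℕ.< n → Stale k t x)
    step : ∀ {k t} → 0 ℕ.≤ k → k ℕ.< n → Undone k t → Undone (suc k) (uncombRound n k t)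
    step {k} {t} _ k<n (match , stale)
      with CombTrace.undo-round (ℕ.s≤s⁻¹ k<n) (proj₁ (at-combed k<n)) (proj₂ (at-combed k<n)) {t}
             (subst (λ s → Match n k s (matrices t)) (descending-snoc (combRound n) k<n _) match) stale
    ... | match′ , fresh = match′ , λ k<x → fresh (ℕ.<⇒≤ k<x)
    undone = for-ascending (uncombRound n) Undone ℕ.z≤n step {proj₁ X , proj₂ X , λ _ → 0ℤ} (match , λ _ _ → tt)

module _ {m : ℕ} {X : State} (combed : Combed (suc m) 0 X) where

  private
    n = suc m

    at : ℕ → StateWithHeights
    at k = for (ascending 0 k) (uncombRound n) (proj₁ X , proj₂ X , λ _ → 0ℤ)

    UncombedTo : ℕ → StateWithHeights → Set
    UncombedTo k t = Combed n k (matrices t) × (∀ {x} → k ℕ.≤ x → x ℕ.< n → Stale k t x)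

    at-uncombed : ∀ {k} → k ℕ.≤ n → UncombedTo k (at k)
    at-uncombed k≤n = for-ascending (uncombRound n) UncombedTo ℕ.z≤n
      (λ {k} {t} _ k<x (combed , stale) → let k≤m = ℕ.s≤s⁻¹ (ℕ.<-≤-trans k<x k≤n) in
        UncombTrace.round-combed k≤m {t} combed stale ,
        λ k<y → UncombTrace.round-fresh k≤m {t} combed stale (ℕ.<⇒≤ k<y))
      (combed , λ _ _ → tt)

  uncombArrays-bits : ∀ x y → Bit (uncombArrays n X x y)
  uncombArrays-bits = Combed.bits (proj₁ (at-uncombed ℕ.≤-refl))

  uncombArrays-lower : ∀ {x y} → x ℕ.≤ y → uncombArrays n X x y ≡ 0ℤ
  uncombArrays-lower = Combed.lower (proj₁ (at-uncombed ℕ.≤-refl))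

  comb-uncomb : ∀ {B} → (∀ {x} y → x ℕ.< n → B x y ≡ uncombArrays n X x y) → Match n 0 (combArrays n B) X
  comb-uncomb {B} B≡ = proj₁ redone
    where
    Redone : ℕ → State → Set
    Redone k s = Match n k s (matrices (at k)) × Zeros k s
    step : ∀ {k s} → 0 ℕ.≤ k → k ℕ.< n → Redone (suc k) s → Redone k (combRound n k s)
    step {k} {s} _ k<n (match , zeros) =
      UncombTrace.redo-round (ℕ.s≤s⁻¹ k<n) {at k} (proj₁ (at-uncombed (ℕ.<⇒≤ k<n))) (proj₂ (at-uncombed (ℕ.<⇒≤ k<n)))
        (subst (λ t → Match n (suc k) s (matrices t)) (ascending-snoc (uncombRound n) {0} {k} ℕ.z≤n (proj₁ X , proj₂ X , λ _ → 0ℤ)) match) zeros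
    redone = for-descending (combRound n) Redone {0} {n} ℕ.z≤n step {B , λ _ _ → 0ℤ}
      -- In the rows of index less than `n`, columns from `n` on are zero in `D`, so the zero matrix
      -- with which combing starts matches there.
      ((B≡ , λ x<n n≤y → sym (Combed.lowerD (proj₁ (at-uncombed ℕ.≤-refl)) (ℕ.<-≤-trans x<n n≤y))) , λ _ → refl)

-- Paths as words, and their encodings

Spot : Set
Spot = ℤ × ℕ

toPoint : Spot → Point
toPoint (h , l) = h , + l

-- `h - 0ℤ` instead of `h` agrees by computation with adding the displacement, and gives both
-- crossings the form `h - x`.
next : Direction → Spot → Spot
next horizontal (h , l) = h - 0ℤ , suc l
next diagonal   (h , l) = h - 1ℤ , suc l
next vertical   (h , l) = h - 1ℤ , l

toPoint-next : ∀ s q → toPoint (next s q) ≡ toPoint q ⊕ displacement s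
toPoint-next horizontal (h , l) = cong (h - 0ℤ ,_) (cong +_ (ℕ.+-comm 1 l))
toPoint-next diagonal   (h , l) = cong (h - 1ℤ ,_) (cong +_ (ℕ.+-comm 1 l))
toPoint-next vertical   (h , l) = cong (h - 1ℤ ,_) (sym (ℤ.+-identityʳ (+ l)))

trail : Spot → List Direction → List Point
trail q []      = toPoint q ∷ []
trail q (s ∷ w) = toPoint q ∷ trail (next s q) w

marks : Spot → List Direction → List (Direction × ℤ)
marks q       []      = []
marks (h , l) (s ∷ w) = (s , + l) ∷ marks (next s (h , l)) w

finish : Spot → List Direction → Spot
finish q []      = q
finish q (s ∷ w) = finish (next s q) w

-- Forgetting the endpoints allows paths to be compared by equality of words; points and steps are
-- recovered from the word and the starting spot.
directions : ∀ {p p′} → Path p p′ → List Direction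
directions ε             = []
directions ((s , _) ◅ P) = s ∷ directions P

points-trail : ∀ {p p′} (P : Path p p′) q → toPoint q ≡ p → points P ≡ trail q (directions P)
points-trail ε                q refl = refl
points-trail ((s , refl) ◅ P) q refl = cong (_ ∷_) (points-trail P (next s q) (toPoint-next s q))

steps-marks : ∀ {p p′} (P : Path p p′) q → toPoint q ≡ p → steps P ≡ marks q (directions P)
steps-marks ε                q refl = refl
steps-marks ((s , refl) ◅ P) q refl = cong (_ ∷_) (steps-marks P (next s q) (toPoint-next s q))

finish-end : ∀ {p p′} (P : Path p p′) q → toPoint q ≡ p → toPoint (finish q (directions P)) ≡ p′
finish-end ε                q refl = refl
finish-end ((s , refl) ◅ P) q refl = finish-end P (next s q) (toPoint-next s q)

walk : ∀ q w → Path (toPoint q) (toPoint (finish q w))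
walk q []      = ε
walk q (s ∷ w) = (s , toPoint-next s q) ◅ walk (next s q) w

directions-walk : ∀ q w → directions (walk q w) ≡ w
directions-walk q []      = refl
directions-walk q (s ∷ w) = cong (s ∷_) (directions-walk (next s q) w)

directions-subst : ∀ {p p′ p″} (P : Path p p′) (eq : p′ ≡ p″) →
  directions (subst (Path p) eq P) ≡ directions P
directions-subst P refl = refl

-- Steps recorded in a given column

diagonalAt verticalsAt : List (Direction × ℤ) → Array
diagonalAt  xs j = if does (_∈?_ _≟ˢ_ (diagonal , + j) xs) then 1ℤ else 0ℤ
verticalsAt xs j = + length (filter ((vertical , + j) ≟ˢ_) xs)

diagonalAt-bit : ∀ xs j → Bit (diagonalAt xs j)
diagonalAt-bit xs j with does (_∈?_ _≟ˢ_ (diagonal , + j) xs)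
... | true  = inj₂ refl
... | false = inj₁ refl

diagonalAt-∉ : ∀ xs {j} → (diagonal , + j) ∉ xs → diagonalAt xs j ≡ 0ℤ
diagonalAt-∉ xs {j} ∉xs = cong (if_then 1ℤ else 0ℤ) (dec-false (_∈?_ _≟ˢ_ (diagonal , + j) xs) ∉xs)

diagonalAt-∈ : ∀ xs {j} → (diagonal , + j) ∈ xs → diagonalAt xs j ≡ 1ℤ
diagonalAt-∈ xs {j} ∈xs = cong (if_then 1ℤ else 0ℤ) (dec-true (_∈?_ _≟ˢ_ (diagonal , + j) xs) ∈xs)

diagonalAt-there : ∀ y xs {j} → (diagonal , + j) ≢ y → diagonalAt (y ∷ xs) j ≡ diagonalAt xs j
diagonalAt-there y xs {j} ≢y =
  cong (λ β → if β ∨ does (_∈?_ _≟ˢ_ (diagonal , + j) xs) then 1ℤ else 0ℤ) (dec-false ((diagonal , + j) ≟ˢ y) ≢y)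

verticalsAt-∉ : ∀ xs {j} → (vertical , + j) ∉ xs → verticalsAt xs j ≡ 0ℤ
verticalsAt-∉ xs {j} ∉xs = cong (+_ ∘ length) (List.filter-none ((vertical , + j) ≟ˢ_) (All.¬Any⇒All¬ xs ∉xs))

verticalsAt-here : ∀ xs {j} → verticalsAt ((vertical , + j) ∷ xs) j ≡ 1ℤ + verticalsAt xs j
verticalsAt-here xs {j} = cong (+_ ∘ length) (List.filter-accept ((vertical , + j) ≟ˢ_) {xs = xs} refl)

verticalsAt-there : ∀ y xs {j} → (vertical , + j) ≢ y → verticalsAt (y ∷ xs) j ≡ verticalsAt xs j
verticalsAt-there y xs {j} ≢y = cong (+_ ∘ length) (List.filter-reject ((vertical , + j) ≟ˢ_) {xs = xs} ≢y)

-- The index is the height lost in the crossing, which is also its entry in `B`; horizontal and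
-- diagonal steps thus become one case.
data Flat : Direction → ℤ → Set where
  horizontal : Flat horizontal 0ℤ
  diagonal   : Flat diagonal   1ℤ

crossing : ℤ → Direction
crossing (+ 0) = horizontal
crossing _     = diagonal

crossing-flat : ∀ {x} → Bit x → Flat (crossing x) x
crossing-flat (inj₁ refl) = horizontal
crossing-flat (inj₂ refl) = diagonal

next-flat : ∀ {s x h l} → Flat s x → next s (h , l) ≡ (h - x , suc l)
next-flat horizontal = refl
next-flat diagonal   = refl

Flat⇒≢vertical : ∀ {s x} → Flat s x → s ≢ vertical
Flat⇒≢vertical horizontal ()
Flat⇒≢vertical diagonal   ()

-- The word w is the part of a path encoded by the rows b, e that starts in
-- column l with c more vertical steps there and has m more columns to cross.
data Reads (b e : Array) : ℕ → ℕ → ℕ → List Direction → Set where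
  end  : ∀ {l} → Reads b e l 0 0 []
  vert : ∀ {l m c w} → Reads b e l m c w → Reads b e l m (suc c) (vertical ∷ w)
  flat : ∀ {l m c s x w} → Flat s x → b l ≡ x → e (suc l) ≡ + c →
         Reads b e (suc l) m c w → Reads b e l (suc m) 0 (s ∷ w)

column-≤-next : ∀ s h l → l ℕ.≤ proj₂ (next s (h , l))
column-≤-next horizontal h l = ℕ.n≤1+n l
column-≤-next diagonal   h l = ℕ.n≤1+n l
column-≤-next vertical   h l = ℕ.≤-refl

column-≤-finish : ∀ h l w → l ℕ.≤ proj₂ (finish (h , l) w)
column-≤-finish h l []      = ℕ.≤-refl
column-≤-finish h l (s ∷ w) = ℕ.≤-trans (column-≤-next s h l) (column-≤-finish _ _ w)

column-≤-marks : ∀ {s j} h l w → (s , + j) ∈ marks (h , l) w → l ℕ.≤ j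
column-≤-marks h l (s ∷ w) (here refl) = ℕ.≤-refl
column-≤-marks h l (s ∷ w) (there ∈w)  = ℕ.≤-trans (column-≤-next s h l) (column-≤-marks _ _ w ∈w)

passed : ∀ {s j} h l w → j ℕ.< l → (s , + j) ∉ marks (h , l) w
passed h l w j<l ∈w = ℕ.<⇒≱ j<l (column-≤-marks h l w ∈w)

mark-≢ : ∀ {s s′ : Direction} {j l} → l ℕ.< j → (s , + j) ≢ (s′ , + l)
mark-≢ l<j refl = ℕ.<-irrefl refl l<j

module _ (h : ℤ) (l : ℕ) (w : List Direction) where

  vertical-diagonalAt : ∀ {j} → diagonalAt (marks (h , l) (vertical ∷ w)) j ≡ diagonalAt (marks (h - 1ℤ , l) w) j
  vertical-diagonalAt = diagonalAt-there (vertical , + l) (marks (h - 1ℤ , l) w) λ ()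

  vertical-verticalsAt : ∀ {j} → l ℕ.< j →
    verticalsAt (marks (h , l) (vertical ∷ w)) j ≡ verticalsAt (marks (h - 1ℤ , l) w) j
  vertical-verticalsAt l<j = verticalsAt-there (vertical , + l) (marks (h - 1ℤ , l) w) (mark-≢ l<j)

  vertical-verticalsAt-here :
    verticalsAt (marks (h , l) (vertical ∷ w)) l ≡ 1ℤ + verticalsAt (marks (h - 1ℤ , l) w) l
  vertical-verticalsAt-here = verticalsAt-here (marks (h - 1ℤ , l) w)

  module _ {s x} (f : Flat s x) where

    private
      marks-flat : marks (h , l) (s ∷ w) ≡ (s , + l) ∷ marks (h - x , suc l) w
      marks-flat = cong (λ q → (s , + l) ∷ marks q w) (next-flat f)

    flat-diagonalAt : ∀ {j} → l ℕ.< j →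
      diagonalAt (marks (h , l) (s ∷ w)) j ≡ diagonalAt (marks (h - x , suc l) w) j
    flat-diagonalAt {j} l<j = trans (cong (λ xs → diagonalAt xs j) marks-flat)
      (diagonalAt-there (s , + l) (marks (h - x , suc l) w) (mark-≢ l<j))

    flat-verticalsAt : ∀ {j} → l ℕ.< j →
      verticalsAt (marks (h , l) (s ∷ w)) j ≡ verticalsAt (marks (h - x , suc l) w) j
    flat-verticalsAt {j} l<j = trans (cong (λ xs → verticalsAt xs j) marks-flat)
      (verticalsAt-there (s , + l) (marks (h - x , suc l) w) (mark-≢ l<j))

    flat-verticalsAt-here : verticalsAt (marks (h , l) (s ∷ w)) l ≡ 0ℤ
    flat-verticalsAt-here = trans (cong (λ xs → verticalsAt xs l) marks-flat)
      (verticalsAt-∉ ((s , + l) ∷ marks (h - x , suc l) w) λ where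
        (here refl) → Flat⇒≢vertical f refl
        (there ∈w)  → passed (h - x) (suc l) w ℕ.≤-refl ∈w)

  flat-diagonalAt-here : ∀ {s x} → Flat s x → diagonalAt (marks (h , l) (s ∷ w)) l ≡ x
  flat-diagonalAt-here horizontal = diagonalAt-∉ (marks (h , l) (horizontal ∷ w)) λ where
    (there ∈w) → passed (h - 0ℤ) (suc l) w ℕ.≤-refl ∈w
  flat-diagonalAt-here diagonal   = diagonalAt-∈ (marks (h , l) (diagonal ∷ w)) (here refl)

reads : ∀ {b e} w {h l m c} → proj₂ (finish (h , l) w) ≡ l ℕ.+ m →
  (∀ {j} → l ℕ.≤ j → b j ≡ diagonalAt (marks (h , l) w) j) →
  (∀ {j} → l ℕ.< j → e j ≡ verticalsAt (marks (h , l) w) j) →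
  + c ≡ verticalsAt (marks (h , l) w) l →
  Reads b e l m c w

reads-flat : ∀ {b e s x} → Flat s x → ∀ w {h l m c} → proj₂ (finish (h , l) (s ∷ w)) ≡ l ℕ.+ m →
  (∀ {j} → l ℕ.≤ j → b j ≡ diagonalAt (marks (h , l) (s ∷ w)) j) →
  (∀ {j} → l ℕ.< j → e j ≡ verticalsAt (marks (h , l) (s ∷ w)) j) →
  + c ≡ verticalsAt (marks (h , l) (s ∷ w)) l →
  Reads b e l m c (s ∷ w)

reads [] {l = l} {m} fin b≡ e≡ c≡ with ℕ.+-cancelˡ-≡ l 0 m (trans (ℕ.+-identityʳ l) fin) | c≡
... | refl | refl = end
reads (vertical ∷ w) {h} {l} {c = zero} fin b≡ e≡ c≡ with trans c≡ (vertical-verticalsAt-here h l w)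
... | ()
reads (vertical ∷ w) {h} {l} {c = suc c} fin b≡ e≡ c≡ = vert (reads w {h - 1ℤ} fin
  (λ l≤j → trans (b≡ l≤j) (vertical-diagonalAt h l w))
  (λ l<j → trans (e≡ l<j) (vertical-verticalsAt h l w l<j))
  (cong ℤ.pred (trans c≡ (vertical-verticalsAt-here h l w))))
reads (horizontal ∷ w) {h} fin b≡ e≡ c≡ = reads-flat horizontal w {h} fin b≡ e≡ c≡
reads (diagonal ∷ w) {h} fin b≡ e≡ c≡ = reads-flat diagonal w {h} fin b≡ e≡ c≡

-- With no column left to cross, a flat step would end beyond column `l`, since columns never
-- decrease.
reads-flat {s = s} {x} f w {h} {l} {zero} fin _ _ _ =
  contradiction (ℕ.≤-trans (column-≤-finish (h - x) (suc l) w) (ℕ.≤-reflexive (trans fin′ (ℕ.+-identityʳ l)))) ℕ.1+n≰n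
  where
  fin′ : proj₂ (finish (h - x , suc l) w) ≡ l ℕ.+ 0
  fin′ = trans (cong (λ q → proj₂ (finish q w)) (sym (next-flat f))) fin
reads-flat f w {h} {l} {suc m} {suc _} fin b≡ e≡ c≡ with trans c≡ (flat-verticalsAt-here h l w f)
... | ()
reads-flat {s = s} {x} f w {h} {l} {suc m} {zero} fin b≡ e≡ c≡ =
  flat f (trans (b≡ ℕ.≤-refl) (flat-diagonalAt-here h l w f))
    (trans (e≡ ℕ.≤-refl) (flat-verticalsAt h l w f ℕ.≤-refl))
    (reads w {h - x} (trans (cong (λ q → proj₂ (finish q w)) (sym (next-flat f))) (trans fin (ℕ.+-suc l m)))
      (λ l<j → trans (b≡ (ℕ.<⇒≤ l<j)) (flat-diagonalAt h l w f l<j))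
      (λ sl<j → trans (e≡ (ℕ.<⇒≤ sl<j)) (flat-verticalsAt h l w f (ℕ.<⇒≤ sl<j)))
      refl)

module _ {b e : Array} where

  Reads-diagonals : ∀ {l m c w} h → Reads b e l m c w → (∀ {j} → l ℕ.+ m ℕ.≤ j → b j ≡ 0ℤ) →
    ∀ {j} → l ℕ.≤ j → diagonalAt (marks (h , l) w) j ≡ b j
  Reads-diagonals {l} h end b0 l≤j = sym (b0 (ℕ.≤-trans (ℕ.≤-reflexive (ℕ.+-identityʳ l)) l≤j))
  Reads-diagonals {l} {w = _ ∷ w} h (vert r) b0 l≤j =
    trans (vertical-diagonalAt h l w) (Reads-diagonals (h - 1ℤ) r b0 l≤j)
  Reads-diagonals {l} {suc m} {w = s ∷ w} h (flat {x = x} f bl _ r) b0 l≤j with ℕ.m≤n⇒m<n∨m≡n l≤j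
  ... | inj₁ l<j = trans (flat-diagonalAt h l w f l<j)
          (Reads-diagonals (h - x) r (λ {j} le → b0 (ℕ.≤-trans (ℕ.≤-reflexive (ℕ.+-suc l m)) le)) l<j)
  ... | inj₂ refl = trans (flat-diagonalAt-here h l w f) (sym bl)

  Reads-verticals : ∀ {l m c w} h → Reads b e l m c w → (∀ {j} → l ℕ.+ m ℕ.< j → e j ≡ 0ℤ) →
    verticalsAt (marks (h , l) w) l ≡ + c × (∀ {j} → l ℕ.< j → verticalsAt (marks (h , l) w) j ≡ e j)
  Reads-verticals {l} h end e0 = refl , λ l<j → sym (e0 (ℕ.≤-<-trans (ℕ.≤-reflexive (ℕ.+-identityʳ l)) l<j))
  Reads-verticals {l} {w = _ ∷ w} h (vert r) e0 with Reads-verticals (h - 1ℤ) r e0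
  ... | now , later = trans (vertical-verticalsAt-here h l w) (cong (_+_ 1ℤ) now) ,
                      λ l<j → trans (vertical-verticalsAt h l w l<j) (later l<j)
  Reads-verticals {l} {suc m} {w = s ∷ w} h (flat {x = x} f _ el r) e0
    with Reads-verticals (h - x) r (λ lt → e0 (ℕ.≤-<-trans (ℕ.≤-reflexive (ℕ.+-suc l m)) lt))
  ... | now , later =
    flat-verticalsAt-here h l w f ,
    λ l<j → trans (flat-verticalsAt h l w f l<j) (onwards (ℕ.m≤n⇒m<n∨m≡n l<j))
    where
    onwards : ∀ {j} → suc l ℕ.< j ⊎ suc l ≡ j → verticalsAt (marks (h - x , suc l) w) j ≡ e j
    onwards (inj₁ sl<j) = later sl<j
    onwards (inj₂ refl) = trans now (sym el)

  -- Source of the triangular shape of the encodings: after the last crossing only vertical steps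
  -- remain.
  Reads-late : ∀ {l m c w s j} h → Reads b e l m c w → l ℕ.+ m ℕ.≤ j → (s , + j) ∈ marks (h , l) w →
    j ≡ l ℕ.+ m × s ≡ vertical
  Reads-late {l} {m} h (vert r) lm≤j (here refl) =
    ℕ.≤-antisym (ℕ.m≤m+n l m) lm≤j , refl
  Reads-late h (vert r) lm≤j (there ∈w) = Reads-late (h - 1ℤ) r lm≤j ∈w
  Reads-late {l} {suc m} h (flat f _ _ r) lm≤j (here refl) =
    contradiction lm≤j (ℕ.<⇒≱ (ℕ.m<m+n l (ℕ.s≤s ℕ.z≤n)))
  Reads-late {l} {suc m} h (flat {x = x} f _ _ r) lm≤j (there ∈w) rewrite next-flat {h = h} {l} f | ℕ.+-suc l m =
    Reads-late (h - x) r lm≤j ∈w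

  word : ℕ → ℕ → List Direction
  word l zero    = replicate ℤ.∣ e l ∣ vertical
  word l (suc m) = replicate ℤ.∣ e l ∣ vertical ++ crossing (b l) ∷ word (suc l) m

  Reads-word : (∀ j → Bit (b j)) → (∀ j → 0ℤ ≤ e j) → ∀ l m → Reads b e l m ℤ.∣ e l ∣ (word l m)
  Reads-word bits nonneg l zero    = verts ℤ.∣ e l ∣
    where
    verts : ∀ c → Reads b e l 0 c (replicate c vertical)
    verts zero    = end
    verts (suc c) = vert (verts c)
  Reads-word bits nonneg l (suc m) = verts ℤ.∣ e l ∣
    where
    verts : ∀ c → Reads b e l (suc m) c (replicate c vertical ++ crossing (b l) ∷ word (suc l) m)
    verts zero    = flat (crossing-flat (bits l)) refl (sym (ℤ.0≤i⇒+∣i∣≡i (nonneg (suc l))))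
                      (Reads-word bits nonneg (suc l) m)
    verts (suc c) = vert (verts c)

Reads-unique : ∀ {b e b′ e′ l m c w w′} → Reads b e l m c w → Reads b′ e′ l m c w′ →
  (∀ {j} → j ℕ.< l ℕ.+ m → b j ≡ b′ j) → (∀ {j} → j ℕ.≤ l ℕ.+ m → e j ≡ e′ j) → w ≡ w′
Reads-unique end end b≡ e≡ = refl
Reads-unique (vert r) (vert r′) b≡ e≡ = cong (vertical ∷_) (Reads-unique r r′ b≡ e≡)
Reads-unique {l = l} {suc m} (flat f bl el r) (flat f′ bl′ el′ r′) b≡ e≡
  with trans (sym el) (trans (e≡ (ℕ.m<m+n l (ℕ.s≤s ℕ.z≤n))) el′)
... | refl = cong₂ _∷_ (same f f′ (trans (sym bl) (trans (b≡ (ℕ.m<m+n l (ℕ.s≤s ℕ.z≤n))) bl′)))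
               (Reads-unique r r′ (λ lt → b≡ (ℕ.<-≤-trans lt (ℕ.≤-reflexive (sym (ℕ.+-suc l m)))))
                                  (λ le → e≡ (ℕ.≤-trans le (ℕ.≤-reflexive (sym (ℕ.+-suc l m))))))
  where
  same : ∀ {s s′ x x′} → Flat s x → Flat s′ x′ → x ≡ x′ → s ≡ s′
  same horizontal horizontal _ = refl
  same diagonal   diagonal   _ = refl
  same horizontal diagonal   ()
  same diagonal   horizontal ()

-- A word is determined by its points

trail-nonempty : ∀ {q w} → [] ≢ trail q w
trail-nonempty {w = []}    ()
trail-nonempty {w = _ ∷ _} ()

trail-head : ∀ {q q′ w w′} → trail q w ≡ trail q′ w′ → toPoint q ≡ toPoint q′
trail-head {w = []}    {[]}    refl = refl
trail-head {w = []}    {_ ∷ _} eq   = List.∷-injectiveˡ eq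
trail-head {w = _ ∷ _} {[]}    eq   = List.∷-injectiveˡ eq
trail-head {w = _ ∷ _} {_ ∷ _} eq   = List.∷-injectiveˡ eq

next-injective : ∀ s s′ q → toPoint (next s q) ≡ toPoint (next s′ q) → s ≡ s′
next-injective s s′ (h , l) eq = go s s′ eq
  where
  lowered : h - 0ℤ ≢ h - 1ℤ
  lowered e = 1≰0 (calc h (≤-reflexive e))
    where
    calc : ∀ h → h - 0ℤ ≤ h - 1ℤ → 1ℤ ≤ 0ℤ
    calc h p = linear p (solve (h ∷ []))
  stay : suc l ≢ l
  stay = ℕ.1+n≢n
  column : ∀ {p p′ : Point} → p ≡ p′ → proj₂ p ≡ proj₂ p′
  column = cong proj₂
  go : ∀ s s′ → toPoint (next s (h , l)) ≡ toPoint (next s′ (h , l)) → s ≡ s′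
  go horizontal horizontal e = refl
  go diagonal   diagonal   e = refl
  go vertical   vertical   e = refl
  go horizontal diagonal   e = contradiction (cong proj₁ e) lowered
  go diagonal   horizontal e = contradiction (sym (cong proj₁ e)) lowered
  go horizontal vertical   e = contradiction (ℤ.+-injective (column e)) stay
  go diagonal   vertical   e = contradiction (ℤ.+-injective (column e)) stay
  go vertical   horizontal e = contradiction (sym (ℤ.+-injective (column e))) stay
  go vertical   diagonal   e = contradiction (sym (ℤ.+-injective (column e))) stay

-- Families are compared by points but encoded by steps; this is the bridge. The three steps lead to
-- three different points, so the second point reveals the first step.
trail-injective : ∀ q w w′ → trail q w ≡ trail q w′ → w ≡ w′
trail-injective q []      []       eq = refl
trail-injective q []      (s ∷ w′) eq = contradiction (List.∷-injectiveʳ eq) trail-nonempty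
trail-injective q (s ∷ w) []       eq = contradiction (sym (List.∷-injectiveʳ eq)) trail-nonempty
trail-injective q (s ∷ w) (s′ ∷ w′) eq
  with next-injective s s′ q (trail-head {w = w} {w′} (List.∷-injectiveʳ eq))
... | refl = cong (s ∷_) (trail-injective (next s q) w w′ (List.∷-injectiveʳ eq))

-- The heights at which path i enters and leaves column j.
module Geometry (i : ℕ) (b e : Array) where

  entry exit : ℕ → ℤ
  entry j = + i - ∑ b j - ∑ e j
  exit  j = + i - ∑ b j - ∑ e (suc j)

  flat-height : ∀ {l x c h} → b l ≡ x → e (suc l) ≡ + c → h ≡ exit l + 0ℤ → h - x ≡ exit (suc l) + + c
  flat-height {l} {x} {c} {h} = calc (+ i) (∑ b l) (∑ e (suc l)) (b l) (e (suc l)) x (+ c) h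
    where
    calc : ∀ i B E b e x c h → b ≡ x → e ≡ c → h ≡ i - B - E + 0ℤ → h - x ≡ i - (B + b) - (E + e) + c
    calc i B E b e x c h p q r = linear≡ (p ⊞≡ q ⊞≡ r) (solve (i ∷ B ∷ E ∷ b ∷ e ∷ x ∷ c ∷ h ∷ []))

  vertical-height : ∀ {l c h} → h ≡ exit l + + suc c → h - 1ℤ ≡ exit l + + c
  vertical-height {l} {c} {h} = calc h (exit l) (+ c)
    where
    calc : ∀ h x c → h ≡ x + (1ℤ + c) → h - 1ℤ ≡ x + c
    calc h x c p = linear≡ p (solve (h ∷ x ∷ c ∷ []))

  exit≤ : ∀ {x c h} → h ≡ x + + c → x ≤ h
  exit≤ {x} {c} {h} h≡ = calc x (+ c) h h≡ (ℤ.+≤+ ℕ.z≤n)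
    where
    calc : ∀ x c h → h ≡ x + c → 0ℤ ≤ c → x ≤ h
    calc x c h p q = linear (≤-reflexive (sym p) ⊞ q) (solve (x ∷ c ∷ h ∷ []))

  entry-exit : ∀ {l c} → e l ≡ + c → entry l ≡ exit l + + c
  entry-exit {l} {c} = calc (+ i) (∑ b l) (∑ e l) (e l) (+ c)
    where
    calc : ∀ i B E x c → x ≡ c → i - B - E ≡ i - B - (E + x) + c
    calc i B E x c p = linear≡ p (solve (i ∷ B ∷ E ∷ x ∷ c ∷ []))

  -- The invariant of the inductions here: with `c` verticals to go in column `l`, the height is
  -- `exit l + c`.
  Reads-finish : ∀ {l m c w h} → Reads b e l m c w → h ≡ exit l + + c →
    finish (h , l) w ≡ (exit (l ℕ.+ m) , l ℕ.+ m)
  Reads-finish {l} end h≡ rewrite ℕ.+-identityʳ l = cong (_, l) (trans h≡ (ℤ.+-identityʳ _))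
  Reads-finish {l} {c = suc c} (vert r) h≡ = Reads-finish r (vertical-height {l} {c} h≡)
  Reads-finish {l} {suc m} {w = s ∷ w} {h} (flat {x = x} f bl el r) h≡
    rewrite ℕ.+-suc l m | next-flat {h = h} {l} f = Reads-finish r (flat-height {l} {x} {_} {h} bl el h≡)

  OnColumn : ℕ → ℤ → Point → Set
  OnColumn j top p = proj₂ p ≡ + j × exit j ≤ proj₁ p × proj₁ p ≤ top

  Later : ℕ → ℕ → Point → Set
  Later l k p = ∃ λ j → l ℕ.< j × j ℕ.≤ k × OnColumn j (entry j) p

  -- Each column holds an interval of points. In the current column its top is `h` and not
  -- `entry l`, because some verticals may already have been read.
  Reads-trail : ∀ {l m c w h p} → Reads b e l m c w → h ≡ exit l + + c → p ∈ trail (h , l) w →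
    OnColumn l h p ⊎ Later l (l ℕ.+ m) p
  Reads-trail end h≡ (here refl) = inj₁ (refl , exit≤ h≡ , ≤-refl)
  Reads-trail (vert r) h≡ (here refl) = inj₁ (refl , exit≤ h≡ , ≤-refl)
  Reads-trail (flat f bl el r) h≡ (here refl) = inj₁ (refl , exit≤ h≡ , ≤-refl)
  Reads-trail {l} {c = suc c} {h = h} (vert r) h≡ (there ∈w) with Reads-trail r (vertical-height {l} {c} h≡) ∈w
  ... | inj₁ (col , lo , hi) = inj₁ (col , lo , ≤-trans hi (ℤ.i-j≤i h 1ℤ))
  ... | inj₂ later = inj₂ later
  Reads-trail {l} {suc m} {w = s ∷ w} {h} (flat {c = c} {x = x} f bl el r) h≡ (there ∈w)
    rewrite next-flat {h = h} {l} f | ℕ.+-suc l m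
    with Reads-trail r (flat-height {l} {x} {_} {h} bl el h≡) ∈w
  ... | inj₁ (col , lo , hi) = inj₂ (suc l , ℕ.≤-refl , ℕ.m≤m+n (suc l) m , col , lo ,
          ≤-trans hi (≤-reflexive (trans (flat-height {l} {x} {c} {h} bl el h≡) (sym (entry-exit el)))))
  ... | inj₂ (j , sl<j , j≤ , on) = inj₂ (j , ℕ.<⇒≤ sl<j , j≤ , on)

  Reads-trail⁻ : ∀ {l m c w h} → Reads b e l m c w → h ≡ exit l + + c →
    (∀ {x} → exit l ≤ x → x ≤ h → (x , + l) ∈ trail (h , l) w) ×
    (∀ {j x} → l ℕ.< j → j ℕ.≤ l ℕ.+ m → exit j ≤ x → x ≤ entry j → (x , + j) ∈ trail (h , l) w)
  Reads-trail⁻ {l} end h≡ =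
    (λ lo hi → here (cong (_, + l) (ℤ.≤-antisym hi (≤-trans (≤-reflexive (trans h≡ (ℤ.+-identityʳ _))) lo)))) ,
    λ l<j j≤ → contradiction (ℕ.≤-trans j≤ (ℕ.≤-reflexive (ℕ.+-identityʳ l))) (ℕ.<⇒≱ l<j)
  Reads-trail⁻ {l} {c = suc c} {h = h} (vert r) h≡ with Reads-trail⁻ r (vertical-height {l} {c} h≡)
  ... | now , later = now′ , λ l<j j≤ lo hi → there (later l<j j≤ lo hi)
    where
    below : ∀ {x} → x < h → x ≤ h - 1ℤ
    below {x} x<h = calc x h (<⇒1+≤ x<h)
      where
      calc : ∀ x h → 1ℤ + x ≤ h → x ≤ h - 1ℤ
      calc x h p = linear p (solve (x ∷ h ∷ []))
    now′ : ∀ {x} → exit l ≤ x → x ≤ h → _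
    now′ {x} lo hi with x ℤ.≟ h
    ... | yes refl = here refl
    ... | no x≢h   = there (now lo (below (ℤ.≤∧≢⇒< hi x≢h)))
  Reads-trail⁻ {l} {suc m} {w = s ∷ w} {h} (flat {c = c} {x = x₀} f bl el r) h≡
    rewrite next-flat {h = h} {l} f | ℕ.+-suc l m
    with Reads-trail⁻ r (flat-height {l} {x₀} {_} {h} bl el h≡)
  ... | now , later =
    (λ lo hi → here (cong (_, + l) (ℤ.≤-antisym hi (≤-trans (≤-reflexive (trans h≡ (ℤ.+-identityʳ _))) lo)))) , later′
    where
    later′ : ∀ {j x} → l ℕ.< j → j ℕ.≤ suc l ℕ.+ m → exit j ≤ x → x ≤ entry j →
      (x , + j) ∈ ((h , + l) ∷ trail (h - x₀ , suc l) w)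
    later′ l<j j≤ lo hi with ℕ.m≤n⇒m<n∨m≡n l<j
    ... | inj₁ sl<j = there (later sl<j j≤ lo hi)
    ... | inj₂ refl = there (now lo (≤-trans hi (≤-reflexive (trans (entry-exit el) (sym (flat-height {l} {x₀} {c} {h} bl el h≡))))))

module _ {b e : Array} where

  -- Each flat step crosses one of the `m` remaining columns, so `m` of them in a row use up all
  -- crossings and leave no room for a vertical step before the last column.
  cliff-zeros : ∀ {l m c w h} → Reads b e l m c w → e l ≡ + c →
    All (λ (s , _) → s ≢ vertical) (take m (marks (h , l) w)) →
    ∀ {j} → l ℕ.≤ j → j ℕ.< l ℕ.+ m → e j ≡ 0ℤ
  cliff-zeros {l} {zero} r _ _ l≤j j< = contradiction l≤j (ℕ.<⇒≱ (ℕ.<-≤-trans j< (ℕ.≤-reflexive (ℕ.+-identityʳ l))))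
  cliff-zeros {m = suc m} (vert r) _ (s≢ All.∷ _) = contradiction refl s≢
  cliff-zeros {l} {suc m} {h = h} (flat {x = x} f _ el r) e0 (_ All.∷ alls) {j} l≤j j<
    with ℕ.m≤n⇒m<n∨m≡n l≤j
  ... | inj₂ refl = e0
  ... | inj₁ l<j  = cliff-zeros {h = h - x} r el (subst (λ q → All _ (take m (marks q _))) (next-flat f) alls) l<j
                      (ℕ.<-≤-trans j< (ℕ.≤-reflexive (ℕ.+-suc l m)))

  zeros-cliff : ∀ {l m c w h} → Reads b e l m c w → e l ≡ + c → (∀ {j} → l ℕ.≤ j → j ℕ.< l ℕ.+ m → e j ≡ 0ℤ) →
    All (λ (s , _) → s ≢ vertical) (take m (marks (h , l) w)) ×
    All (λ (s , _) → s ≡ vertical) (drop m (marks (h , l) w))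
  zeros-cliff end _ _ = All.[] , All.[]
  zeros-cliff {m = zero} (vert r) _ _ = All.[] , refl All.∷ verticals r
    where
    verticals : ∀ {l c w q} → Reads b e l 0 c w → All (λ (s , _) → s ≡ vertical) (marks q w)
    verticals end      = All.[]
    verticals (vert r) = refl All.∷ verticals r
  zeros-cliff {l} {suc m} (vert r) el e≡0
    with () ← trans (sym el) (e≡0 ℕ.≤-refl (ℕ.m<m+n l (ℕ.s≤s ℕ.z≤n)))
  zeros-cliff {l} {suc m} {h = h} (flat f _ el r) _ e≡0 rewrite next-flat {h = h} {l} f
    with zeros-cliff r el (λ l<j j< → e≡0 (ℕ.<⇒≤ l<j) (ℕ.<-≤-trans j< (ℕ.≤-reflexive (sym (ℕ.+-suc l m)))))
  ... | flats , rest = (Flat⇒≢vertical f All.∷ flats) , rest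

-- Paths encoded by a pair of rows

PathFrom : ℕ → Set
PathFrom i = Path (+ i , 0ℤ) (0ℤ , + i)

EncodedBy : ∀ {i} → Array → Array → PathFrom i → Set
EncodedBy {i} b e P = ∃ λ c → e 0 ≡ + c × Reads b e 0 i c (directions P)

module _ {i : ℕ} (P : PathFrom i) where

  points-directions : points P ≡ trail (+ i , 0) (directions P)
  points-directions = points-trail P (+ i , 0) refl

  steps-directions : steps P ≡ marks (+ i , 0) (directions P)
  steps-directions = steps-marks P (+ i , 0) refl

  encodedBy : ∀ {b e} → (∀ j → b j ≡ diagonalAt (steps P) j) → (∀ j → e j ≡ verticalsAt (steps P) j) →
    EncodedBy b e P
  encodedBy {b} {e} b≡ e≡ rewrite steps-directions =
    _ , e≡ 0 ,
    reads (directions P) {+ i} (ℤ.+-injective (cong proj₂ (finish-end P (+ i , 0) refl)))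
      (λ {j} _ → b≡ j) (λ {j} _ → e≡ j) refl

  private
    late : ∀ {s j} → i ℕ.≤ j → (s , + j) ∈ steps P → j ≡ i × s ≡ vertical
    late rewrite steps-directions =
      Reads-late (+ i) (proj₂ (proj₂ (encodedBy {diagonalAt (steps P)} {verticalsAt (steps P)} (λ _ → refl) (λ _ → refl))))

  diagonalAt-late : ∀ {j} → i ℕ.≤ j → diagonalAt (steps P) j ≡ 0ℤ
  diagonalAt-late i≤j = diagonalAt-∉ (steps P) (λ ∈steps → horizontal≢ (proj₂ (late i≤j ∈steps)))
    where
    horizontal≢ : diagonal ≢ vertical
    horizontal≢ ()

  verticalsAt-late : ∀ {j} → i ℕ.< j → verticalsAt (steps P) j ≡ 0ℤ
  verticalsAt-late i<j = verticalsAt-∉ (steps P) (λ ∈steps → ℕ.>⇒≢ i<j (proj₁ (late (ℕ.<⇒≤ i<j) ∈steps)))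

module _ {i : ℕ} {b e : Array} {P : PathFrom i} (enc : EncodedBy b e P) where

  open Geometry i b e

  private
    c  = proj₁ enc
    e0 = proj₁ (proj₂ enc)
    r  = proj₂ (proj₂ enc)
    top : ∀ {i : ℤ} → i ≡ i - 0ℤ - 0ℤ
    top {i} = solve (i ∷ [])
    start : + i ≡ exit 0 + + c
    start = trans top (entry-exit e0)

  encoded-points : ∀ {p} → p ∈ points P → ∃ λ j → j ℕ.≤ i × OnColumn j (entry j) p
  encoded-points p∈ rewrite points-directions P with Reads-trail r start p∈
  ... | inj₁ (col , lo , hi)        = 0 , ℕ.z≤n , col , lo , ≤-trans hi (≤-reflexive top)
  ... | inj₂ (j , _ , j≤i , on) = j , j≤i , on

  encoded-points⁻ : ∀ {j x} → j ℕ.≤ i → exit j ≤ x → x ≤ entry j → (x , + j) ∈ points P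
  encoded-points⁻ {zero}  j≤i lo hi rewrite points-directions P =
    proj₁ (Reads-trail⁻ r start) lo (≤-trans hi (≤-reflexive (sym top)))
  encoded-points⁻ {suc j} j≤i lo hi rewrite points-directions P =
    proj₂ (Reads-trail⁻ r start) (ℕ.s≤s ℕ.z≤n) j≤i lo hi

  encoded-end : exit i ≡ 0ℤ
  encoded-end = trans (sym (cong proj₁ (Reads-finish r start))) (cong proj₁ (finish-end P (+ i , 0) refl))

  encoded-diagonals : (∀ {j} → i ℕ.≤ j → b j ≡ 0ℤ) → ∀ j → diagonalAt (steps P) j ≡ b j
  encoded-diagonals b0 j rewrite steps-directions P = Reads-diagonals (+ i) r b0 ℕ.z≤n

  encoded-verticals : (∀ {j} → i ℕ.< j → e j ≡ 0ℤ) → ∀ j → verticalsAt (steps P) j ≡ e j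
  encoded-verticals ez zero    rewrite steps-directions P = trans (proj₁ (Reads-verticals (+ i) r ez)) (sym e0)
  encoded-verticals ez (suc j) rewrite steps-directions P = proj₂ (Reads-verticals (+ i) r ez) (ℕ.s≤s ℕ.z≤n)

  encoded-cliff : (∀ {j} → j ℕ.< i → e j ≡ 0ℤ) →
    All (λ (s , _) → s ≢ vertical) (take i (steps P)) × All (λ (s , _) → s ≡ vertical) (drop i (steps P))
  encoded-cliff ez rewrite steps-directions P = zeros-cliff r e0 (λ _ → ez)

  encoded-cliff⁻ : All (λ (s , _) → s ≢ vertical) (take i (steps P)) → ∀ {j} → j ℕ.< i → e j ≡ 0ℤ
  encoded-cliff⁻ all rewrite steps-directions P = cliff-zeros r e0 all ℕ.z≤n

encoded-unique : ∀ {i b e b′ e′} {P Q : PathFrom i} → EncodedBy b e P → EncodedBy b′ e′ Q →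
  (∀ {j} → j ℕ.< i → b j ≡ b′ j) → (∀ {j} → j ℕ.≤ i → e j ≡ e′ j) → directions P ≡ directions Q
encoded-unique (c , e0 , r) (c′ , e0′ , r′) b≡ e≡ with trans (sym e0) (trans (e≡ ℕ.z≤n) e0′)
... | refl = Reads-unique r r′ b≡ e≡

module _ {i : ℕ} {b e : Array} (bits : ∀ j → Bit (b j)) (nonneg : ∀ j → 0ℤ ≤ e j)
  (rowsum : ∑ b i + ∑ e (suc i) ≡ + i) where

  open Geometry i b e

  private
    r = Reads-word {b} {e} bits nonneg 0 i
    e0 : e 0 ≡ + ℤ.∣ e 0 ∣
    e0 = sym (ℤ.0≤i⇒+∣i∣≡i (nonneg 0))
    start : + i ≡ exit 0 + + ℤ.∣ e 0 ∣
    start = trans (top (+ i)) (entry-exit e0)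
      where
      top : ∀ i → i ≡ i - 0ℤ - 0ℤ
      top i = solve (i ∷ [])
    -- `rowsum` is the total descent of the path, equal to its starting height.
    exit-end : exit i ≡ 0ℤ
    exit-end = calc (+ i) (∑ b i) (∑ e (suc i)) rowsum
      where
      calc : ∀ i x y → x + y ≡ i → i - x - y ≡ 0ℤ
      calc i x y p = linear≡ (sym p) (solve (i ∷ x ∷ y ∷ []))
    end≡ : toPoint (finish (+ i , 0) (word 0 i)) ≡ (0ℤ , + i)
    end≡ = trans (cong toPoint (Reads-finish r start)) (cong (_, + i) exit-end)

  abstract
    -- Kept opaque: from here on, a constructed path is known only through the rows that encode it.
    pathFromRows : PathFrom i
    pathFromRows = subst (Path (+ i , 0ℤ)) end≡ (walk (+ i , 0) (word {b} {e} 0 i))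

    pathFromRows-encoded : EncodedBy b e pathFromRows
    pathFromRows-encoded = _ , e0 ,
      subst (Reads b e 0 i _) (sym (trans (directions-subst (walk (+ i , 0) (word 0 i)) end≡) (directions-walk (+ i , 0) _))) r

directions⇒points : ∀ {i} {P Q : PathFrom i} → directions P ≡ directions Q → points P ≡ points Q
directions⇒points {i} {P} {Q} eq =
  trans (points-directions P) (trans (cong (trail (+ i , 0)) eq) (sym (points-directions Q)))

points⇒directions : ∀ {i} {P Q : PathFrom i} → points P ≡ points Q → directions P ≡ directions Q
points⇒directions {i} {P} {Q} eq = trail-injective (+ i , 0) (directions P) (directions Q)
  (trans (sym (points-directions P)) (trans eq (points-directions Q)))

points⇒steps : ∀ {i} {P Q : PathFrom i} → points P ≡ points Q → steps P ≡ steps Q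
points⇒steps {i} {P} {Q} eq =
  trans (steps-directions P) (trans (cong (marks (+ i , 0)) (points⇒directions {P = P} {Q} eq)) (sym (steps-directions Q)))

-- Families and their arrays

index : ∀ {n x} → x ℕ.< n → ∃ λ (i : Fin n) → toℕ i ≡ x
index x<n = fromℕ< x<n , Fin.toℕ-fromℕ< x<n

load-toℕ : ∀ {n} (A : Matrix n) i j → load A (toℕ i) (toℕ j) ≡ A i j
load-toℕ {n} A i j with toℕ i ℕ.<? n | toℕ j ℕ.<? n
... | yes i<n | yes j<n = cong₂ A (Fin.fromℕ<-toℕ i i<n) (Fin.fromℕ<-toℕ j j<n)
... | yes _   | no j≮n  = contradiction (Fin.toℕ<n j) j≮n
... | no i≮n  | _       = contradiction (Fin.toℕ<n i) i≮n

load-outside : ∀ {n} (A : Matrix n) {x y} → n ℕ.≤ x ⊎ n ℕ.≤ y → load A x y ≡ 0ℤ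
load-outside {n} A {x} {y} out with x ℕ.<? n | y ℕ.<? n | out
... | yes x<n | yes _   | inj₁ n≤x = contradiction n≤x (ℕ.<⇒≱ x<n)
... | yes _   | yes y<n | inj₂ n≤y = contradiction n≤y (ℕ.<⇒≱ y<n)
... | yes _   | no _    | _        = refl
... | no _    | _       | _        = refl

load-elim : ∀ {n} (A : Matrix n) (Q : ℕ → ℕ → ℤ → Set) →
  (∀ i j → Q (toℕ i) (toℕ j) (A i j)) → (∀ {x y} → n ℕ.≤ x ⊎ n ℕ.≤ y → Q x y 0ℤ) → ∀ x y → Q x y (load A x y)
load-elim {n} A Q inside outside x y with x ℕ.<? n | y ℕ.<? n
... | yes x<n | yes y<n = subst₂ (λ u v → Q u v (A (fromℕ< x<n) (fromℕ< y<n))) (Fin.toℕ-fromℕ< x<n) (Fin.toℕ-fromℕ< y<n) (inside (fromℕ< x<n) (fromℕ< y<n))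
... | yes _   | no y≮n  = outside (inj₂ (ℕ.≮⇒≥ y≮n))
... | no x≮n  | _       = outside (inj₁ (ℕ.≮⇒≥ x≮n))

load≡ : ∀ {n} (A : Matrix n) {B : Array₂} → (∀ i j → A i j ≡ B (toℕ i) (toℕ j)) →
  (∀ {x y} → x ℕ.< n → n ℕ.≤ y → B x y ≡ 0ℤ) → ∀ {x} y → x ℕ.< n → load A x y ≡ B x y
load≡ {n} A {B} A≡ B0 {x} y x<n = load-elim A (λ x y z → x ℕ.< n → z ≡ B x y) (λ i j _ → A≡ i j)
  (λ where
    (inj₁ n≤x) x<n → contradiction n≤x (ℕ.<⇒≱ x<n)
    (inj₂ n≤y) x<n → sym (B0 x<n n≤y)) x y x<n

module _ {n : ℕ} (P : Family n) where

  arrayB arrayD : Array₂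
  arrayB = load (encodeB P)
  arrayD = load (encodeD P)

  arrayB-row : ∀ i j → arrayB (toℕ i) j ≡ diagonalAt (steps (P i)) j
  arrayB-row i j with ℕ.<-≤-connex j n
  ... | inj₂ n≤j = trans (load-outside (encodeB P) (inj₂ n≤j)) (sym (diagonalAt-late (P i) (ℕ.≤-trans (ℕ.<⇒≤ (Fin.toℕ<n i)) n≤j)))
  ... | inj₁ j<n with index j<n
  ...   | j′ , refl = load-toℕ (encodeB P) i j′

  arrayD-row : ∀ i j → arrayD (toℕ i) j ≡ verticalsAt (steps (P i)) j
  arrayD-row i j with ℕ.<-≤-connex j n
  ... | inj₂ n≤j = trans (load-outside (encodeD P) (inj₂ n≤j)) (sym (verticalsAt-late (P i) (ℕ.<-≤-trans (Fin.toℕ<n i) n≤j)))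
  ... | inj₁ j<n with index j<n
  ...   | j′ , refl = load-toℕ (encodeD P) i j′

  family-encoded : ∀ i → EncodedBy (arrayB (toℕ i)) (arrayD (toℕ i)) (P i)
  family-encoded i = encodedBy (P i) (arrayB-row i) (arrayD-row i)

  arrayB-bits : ∀ x y → Bit (arrayB x y)
  arrayB-bits = load-elim (encodeB P) (λ _ _ → Bit) (λ i j → diagonalAt-bit (steps (P i)) (toℕ j)) (λ _ → inj₁ refl)

  arrayB-lower : ∀ {x y} → x ℕ.≤ y → arrayB x y ≡ 0ℤ
  arrayB-lower {x} {y} = load-elim (encodeB P) (λ x y z → x ℕ.≤ y → z ≡ 0ℤ)
    (λ i j → diagonalAt-late (P i)) (λ _ _ → refl) x y

  arrayD-nonneg : ∀ x y → 0ℤ ≤ arrayD x y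
  arrayD-nonneg = load-elim (encodeD P) (λ _ _ z → 0ℤ ≤ z) (λ i j → ℤ.+≤+ ℕ.z≤n) (λ _ → ≤-refl)

  arrayD-lower : ∀ {x y} → x ℕ.< y → arrayD x y ≡ 0ℤ
  arrayD-lower {x} {y} = load-elim (encodeD P) (λ x y z → x ℕ.< y → z ≡ 0ℤ)
    (λ i j → verticalsAt-late (P i)) (λ _ _ → refl) x y

  family-rowsum : ∀ {x} → x ℕ.< n → ∑ (arrayB x) x + ∑ (arrayD x) (suc x) ≡ + x
  family-rowsum {x} x<n with index x<n
  ... | i , refl = calc (+ x) (∑ (arrayB x) x) (∑ (arrayD x) (suc x)) (encoded-end (family-encoded i))
    where
    calc : ∀ i p q → i - p - q ≡ 0ℤ → p + q ≡ i
    calc i p q e = linear≡ (sym e) (solve (i ∷ p ∷ q ∷ []))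

encode-injective : ∀ {n} (P Q : Family n) → encode P ≐₂ encode Q → ∀ i → points (P i) ≡ points (Q i)
encode-injective {n} P Q (B≡ , D≡) i = directions⇒points {P = P i} {Q i}
  (encoded-unique {P = P i} {Q i} (family-encoded P i) (family-encoded Q i)
    (λ {j} _ → load≡ (encodeB P) {arrayB Q} (λ i j → trans (B≡ i j) (sym (load-toℕ (encodeB Q) i j)))
                 (λ {x} _ n≤y → load-outside (encodeB Q) {x} (inj₂ n≤y)) j (Fin.toℕ<n i))
    (λ {j} _ → load≡ (encodeD P) {arrayD Q} (λ i j → trans (D≡ i j) (sym (load-toℕ (encodeD Q) i j)))
                 (λ {x} _ n≤y → load-outside (encodeD Q) {x} (inj₂ n≤y)) j (Fin.toℕ<n i)))

encode-cong : ∀ {n} (P Q : Family n) → (∀ i → points (P i) ≡ points (Q i)) → encode P ≐₂ encode Q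
encode-cong P Q P≈Q =
  (λ i j → cong (λ xs → diagonalAt xs (toℕ j)) (points⇒steps {P = P i} {Q i} (P≈Q i))) ,
  (λ i j → cong (λ xs → verticalsAt xs (toℕ j)) (points⇒steps {P = P i} {Q i} (P≈Q i)))

-- Disjointness of families

module _ {i : ℕ} {b e : Array} where

  open Geometry i b e

  entry-suc : ∀ j → entry (suc j) ≡ exit j - b j
  entry-suc j = calc (+ i) (∑ b j) (b j) (∑ e (suc j))
    where
    calc : ∀ i p x q → i - (p + x) - q ≡ i - p - q - x
    calc i p x q = solve (i ∷ p ∷ x ∷ q ∷ [])

  exit≤entry : ∀ {j} → 0ℤ ≤ e j → exit j ≤ entry j
  exit≤entry {j} = calc (+ i) (∑ b j) (∑ e j) (e j)
    where
    calc : ∀ i p q x → 0ℤ ≤ x → i - p - (q + x) ≤ i - p - q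
    calc i p q x x≥0 = linear x≥0 (solve (i ∷ p ∷ q ∷ x ∷ []))

-- In each column, path i stays strictly below path i + 1: this holds in column
-- 0, and two adjacent paths cannot cross without meeting.
module _ {i : ℕ} {b e b′ e′ : Array} {P : PathFrom i} {Q : PathFrom (suc i)}
  (encP : EncodedBy b e P) (encQ : EncodedBy b′ e′ Q) (disjoint : Disjoint (points P) (points Q))
  (b≥0 : ∀ j → 0ℤ ≤ b j) (e≥0 : ∀ j → 0ℤ ≤ e j) (b′≤1 : ∀ j → b′ j ≤ 1ℤ) (e′≥0 : ∀ j → 0ℤ ≤ e′ j) where

  private
    module G  = Geometry i b e
    module G′ = Geometry (suc i) b′ e′

    meet : ∀ {j x} → j ℕ.≤ i → G.exit j ≤ x → x ≤ G.entry j → G′.exit j ≤ x → x ≤ G′.entry j → ⊥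
    meet j≤i lo hi lo′ hi′ =
      disjoint (encoded-points⁻ encP j≤i lo hi , encoded-points⁻ encQ (ℕ.m≤n⇒m≤1+n j≤i) lo′ hi′)

    -- Otherwise the point where path `i` enters column `j` would lie on the stretch of path `i + 1`
    -- in that column.
    leave-above : ∀ {j} → j ℕ.≤ i → G.entry j < G′.entry j → G.entry j < G′.exit j
    leave-above {j} j≤i entered with G.entry j ℤ.<? G′.exit j
    ... | yes above = above
    ... | no ¬above = ⊥-elim (meet j≤i (exit≤entry {i} {b} {e} (e≥0 j)) ≤-refl (ℤ.≮⇒≥ ¬above) (ℤ.<⇒≤ entered))

    -- A crossing costs path `i + 1` at most one unit of height, and it was ahead by at least one.
    -- If it is not ahead afterwards, the two entry points coincide.
    enter-above : ∀ {j} → suc j ℕ.≤ i → G.entry j < G′.exit j → G.entry (suc j) < G′.entry (suc j)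
    enter-above {j} j<i above with G.entry (suc j) ℤ.<? G′.entry (suc j)
    ... | yes above′ = above′
    ... | no ¬above  = ⊥-elim (meet j<i (exit≤entry {i} {b} {e} (e≥0 (suc j))) ≤-refl
            (≤-trans (exit≤entry {suc i} {b′} {e′} (e′≥0 (suc j))) (ℤ.≮⇒≥ ¬above))
            (calc (G.entry (suc j)) (G.exit j) (b j) (G.entry j) (G′.entry (suc j)) (G′.exit j) (b′ j)
              (entry-suc {i} {b} {e} j) (entry-suc {suc i} {b′} {e′} j)
              (exit≤entry {i} {b} {e} (e≥0 j)) (<⇒1+≤ above) (b≥0 j) (b′≤1 j)))
      where
      calc : ∀ n x b y n′ x′ b′ → n ≡ x - b → n′ ≡ x′ - b′ → x ≤ y → 1ℤ + y ≤ x′ → 0ℤ ≤ b → b′ ≤ 1ℤ → n ≤ n′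
      calc n x b y n′ x′ b′ p q h₁ h₂ h₃ h₄ =
        linear (≤-reflexive p ⊞ ≤-reflexive (sym q) ⊞ h₁ ⊞ h₂ ⊞ h₃ ⊞ h₄)
          (solve (n ∷ x ∷ b ∷ y ∷ n′ ∷ x′ ∷ b′ ∷ []))

    entered-above : ∀ j → j ℕ.≤ i → G.entry j < G′.entry j
    entered-above zero    _   = ℤ.suc[i]≤j⇒i<j (calc (+ i))
      where
      calc : ∀ x → 1ℤ + (x - 0ℤ - 0ℤ) ≤ 1ℤ + x - 0ℤ - 0ℤ
      calc x = linear (≤-refl {0ℤ}) (solve (x ∷ []))
    entered-above (suc j) j<i = enter-above j<i (leave-above (ℕ.<⇒≤ j<i) (entered-above j (ℕ.<⇒≤ j<i)))

  disjoint-rows : ∀ {j} → j ℕ.≤ i → ∑ b′ j + ∑ e′ (suc j) ≤ ∑ b j + ∑ e j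
  disjoint-rows {j} j≤i = calc (+ i) (∑ b j) (∑ e j) (∑ b′ j) (∑ e′ (suc j)) (<⇒1+≤ (leave-above j≤i (entered-above j j≤i)))
    where
    calc : ∀ i p q p′ q′ → 1ℤ + (i - p - q) ≤ 1ℤ + i - p′ - q′ → p′ + q′ ≤ p + q
    calc i p q p′ q′ h = linear h (solve (i ∷ p ∷ q ∷ p′ ∷ q′ ∷ []))

family-combed : ∀ {n} (P : Family n) → IsDisjoint P → Combed n 0 (arrayB P , arrayD P)
family-combed {n} P dis = record
  { bits     = arrayB-bits P
  ; lower    = arrayB-lower P
  ; lowerD   = arrayD-lower P
  ; cliff    = λ _ _ ()
  ; nonneg   = λ {x} {y} _ _ → arrayD-nonneg P x y
  ; nested   = λ { _ _ ℕ.z≤n → ≤-refl }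
  ; disjoint = λ _ j≤i si<n → rows (ℕ.<⇒≤ si<n) si<n j≤i
  ; rowsum   = λ _ → family-rowsum P
  }
  where
  rows : ∀ {x j} → x ℕ.< n → suc x ℕ.< n → j ℕ.≤ x →
    ∑ (arrayB P (suc x)) j + ∑ (arrayD P (suc x)) (suc j) ≤ ∑ (arrayB P x) j + ∑ (arrayD P x) j
  rows {x} {j} x<n sx<n j≤x = subst₂ (λ u v → j ℕ.≤ u → v ≡ suc u → 
      ∑ (arrayB P v) j + ∑ (arrayD P v) (suc j) ≤ ∑ (arrayB P u) j + ∑ (arrayD P u) j)
      (proj₂ (index x<n)) (proj₂ (index sx<n)) (go (proj₁ (index x<n)) (proj₁ (index sx<n))) j≤x refl
    where
    go : ∀ i i′ → j ℕ.≤ toℕ i → toℕ i′ ≡ suc (toℕ i) →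
      ∑ (arrayB P (toℕ i′)) j + ∑ (arrayD P (toℕ i′)) (suc j) ≤ ∑ (arrayB P (toℕ i)) j + ∑ (arrayD P (toℕ i)) j
    go i i′ j≤i i′≡ = pair (toℕ i′) i′≡ (P i′) (family-encoded P i′) (dis i i′ λ { refl → ℕ.1+n≢n (sym i′≡) })
      where
      -- The index of the second path is only propositionally a successor; generalising it to `x′`
      -- lets `refl` turn `Q` into a path of the type that `disjoint-rows` expects.
      pair : ∀ x′ → x′ ≡ suc (toℕ i) → (Q : PathFrom x′) → EncodedBy (arrayB P x′) (arrayD P x′) Q →
        Disjoint (points (P i)) (points Q) →
        ∑ (arrayB P x′) j + ∑ (arrayD P x′) (suc j) ≤ ∑ (arrayB P (toℕ i)) j + ∑ (arrayD P (toℕ i)) j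
      pair _ refl Q encQ disQ = disjoint-rows (family-encoded P i) encQ disQ
        (λ j → 0≤Bit (arrayB-bits P (toℕ i) j)) (arrayD-nonneg P (toℕ i))
        (λ j → Bit≤1 (arrayB-bits P (suc (toℕ i)) j)) (arrayD-nonneg P (suc (toℕ i))) j≤i

-- Families built from arrays

module FromRows {n : ℕ} {B D : Array₂} (bits : ∀ x y → Bit (B x y)) (lower : ∀ {x y} → x ℕ.≤ y → B x y ≡ 0ℤ)
  (nonneg : ∀ {x} → x ℕ.< n → ∀ y → 0ℤ ≤ D x y) (lowerD : ∀ {x y} → x ℕ.< y → D x y ≡ 0ℤ)
  (rowsum : ∀ {x} → x ℕ.< n → ∑ (B x) x + ∑ (D x) (suc x) ≡ + x) where

  family : Family n
  family i = pathFromRows (bits (toℕ i)) (nonneg (Fin.toℕ<n i)) (rowsum (Fin.toℕ<n i))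

  encoded : ∀ i → EncodedBy (B (toℕ i)) (D (toℕ i)) (family i)
  encoded i = pathFromRows-encoded (bits (toℕ i)) (nonneg (Fin.toℕ<n i)) (rowsum (Fin.toℕ<n i))

  encode-family : encode family ≐₂ (store B , store D)
  encode-family = (λ i j → encoded-diagonals (encoded i) lower (toℕ j)) , (λ i j → encoded-verticals (encoded i) lowerD (toℕ j))

module _ {n : ℕ} {B D : Array₂} (combed : Combed n 0 (B , D)) where

  private
    module C = Combed combed
    module G (x : ℕ) = Geometry x (B x) (D x)

    nonneg : ∀ {x} → x ℕ.< n → ∀ y → 0ℤ ≤ D x y
    nonneg x<n y = C.nonneg ℕ.z≤n x<n

  open FromRows C.bits C.lower nonneg C.lowerD (C.rowsum ℕ.z≤n) public
    renaming (family to combedFamily; encode-family to encode-combedFamily)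

  private
    adjacent : ∀ {x j} → suc x ℕ.< n → j ℕ.≤ x → 1ℤ + G.entry x j ≤ G.exit (suc x) j
    adjacent {x} {j} sx<n j≤x = calc (+ x) (∑ (B x) j) (∑ (D x) j) (∑ (B (suc x)) j) (∑ (D (suc x)) (suc j))
        (C.disjoint ℕ.z≤n j≤x sx<n)
      where
      calc : ∀ x p q p′ q′ → p′ + q′ ≤ p + q → 1ℤ + (x - p - q) ≤ 1ℤ + x - p′ - q′
      calc x p q p′ q′ h = linear h (solve (x ∷ p ∷ q ∷ p′ ∷ q′ ∷ []))

    apart : ∀ {x x′ j} → x ℕ.< x′ → x′ ℕ.< n → j ℕ.≤ x → 1ℤ + G.entry x j ≤ G.exit x′ j
    apart {x} {suc x′} {j} x<sx′ sx′<n j≤x with ℕ.m<1+n⇒m<n∨m≡n x<sx′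
    ... | inj₂ refl = adjacent sx′<n j≤x
    ... | inj₁ x<x′ = calc (G.entry x j) (G.exit x′ j) (G.entry x′ j) (G.exit (suc x′) j)
            (apart x<x′ (ℕ.<⇒≤ sx′<n) j≤x) (exit≤entry {x′} {B x′} {D x′} (nonneg (ℕ.<⇒≤ sx′<n) j))
            (adjacent sx′<n (ℕ.≤-trans j≤x (ℕ.<⇒≤ x<x′)))
      where
      calc : ∀ p q r s → 1ℤ + p ≤ q → q ≤ r → 1ℤ + r ≤ s → 1ℤ + p ≤ s
      calc p q r s h₁ h₂ h₃ = linear (h₁ ⊞ h₂ ⊞ h₃ ⊞ ℤ.+≤+ (ℕ.z≤n {1})) (solve (p ∷ q ∷ r ∷ s ∷ []))

    -- Induction on the path: in column `j` each path is at least one unit above the previous one,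
    -- and path `j` itself leaves that column at height 0.
    high : ∀ {x j} → x ℕ.< n → j ℕ.≤ x → + x ≤ G.exit x j + + j
    high {x} {j} x<n j≤x with ℕ.m≤n⇒m<n∨m≡n j≤x
    ... | inj₂ refl = calc (+ x) (∑ (B x) x) (∑ (D x) (suc x)) (C.rowsum ℕ.z≤n x<n)
      where
      calc : ∀ x p q → p + q ≡ x → x ≤ x - p - q + x
      calc x p q h = linear (≤-reflexive h) (solve (x ∷ p ∷ q ∷ []))
    high {suc x} {j} sx<n j≤x | inj₁ (ℕ.s≤s j≤) =
      calc (+ x) (G.exit x j) (G.entry x j) (G.exit (suc x) j) (+ j)
        (high (ℕ.<⇒≤ sx<n) j≤) (exit≤entry {x} {B x} {D x} (nonneg (ℕ.<⇒≤ sx<n) j)) (adjacent sx<n j≤)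
      where
      calc : ∀ x p q r j → x ≤ p + j → p ≤ q → 1ℤ + q ≤ r → 1ℤ + x ≤ r + j
      calc x p q r j h₁ h₂ h₃ = linear (h₁ ⊞ h₂ ⊞ h₃) (solve (x ∷ p ∷ q ∷ r ∷ j ∷ []))

    no-meeting : ∀ i i′ → toℕ i ℕ.< toℕ i′ → Disjoint (points (combedFamily i)) (points (combedFamily i′))
    no-meeting i i′ i<i′ {p} (p∈ , p∈′) = clash (encoded-points (encoded i) p∈) (encoded-points (encoded i′) p∈′)
      where
      Located : Fin n → Set
      Located i = ∃ λ j → j ℕ.≤ toℕ i × G.OnColumn (toℕ i) j (G.entry (toℕ i) j) p
      calc : ∀ x y z → x ≤ y → z ≤ x → 1ℤ + y ≤ z → 1ℤ ≤ 0ℤ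
      calc x y z h₁ h₂ h₃ = linear (h₁ ⊞ h₂ ⊞ h₃) (solve (x ∷ y ∷ z ∷ []))
      clash : Located i → Located i′ → ⊥
      clash (j , j≤i , col , _ , hi) (j′ , _ , col′ , lo , _) = 1≰0
        (calc (proj₁ p) (G.entry (toℕ i) j) (G.exit (toℕ i′) j) hi
          (subst (λ j → G.exit (toℕ i′) j ≤ proj₁ p) (ℤ.+-injective (trans (sym col′) col)) lo)
          (apart i<i′ (Fin.toℕ<n i′) j≤i))

  combedFamily-disjoint : IsDisjoint combedFamily
  combedFamily-disjoint i i′ i≢i′ {p} both = order (ℕ.<-cmp (toℕ i) (toℕ i′))
    where
    order : Tri (toℕ i ℕ.< toℕ i′) (toℕ i ≡ toℕ i′) (toℕ i ℕ.> toℕ i′) → ⊥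
    order (tri< i<i′ _ _) = no-meeting i i′ i<i′ {p} both
    order (tri≈ _ i≡i′ _) = i≢i′ (Fin.toℕ-injective i≡i′)
    order (tri> _ _ i>i′) = no-meeting i′ i i>i′ {p} (proj₂ both , proj₁ both)

  combedFamily-Schröder : IsSchröder combedFamily
  combedFamily-Schröder i = All.tabulate λ p∈ → above (encoded-points (encoded i) p∈)
    where
    above : ∀ {p} → (∃ λ j → j ℕ.≤ toℕ i × G.OnColumn (toℕ i) j (G.entry (toℕ i) j) p) → + toℕ i ≤ proj₁ p + proj₂ p
    above (j , j≤i , refl , lo , _) = ≤-trans (high (Fin.toℕ<n i) j≤i) (lo ⊞ ≤-refl)

module _ {n : ℕ} {B : Array₂} (bits : ∀ x y → Bit (B x y)) (lower : ∀ {x y} → x ℕ.≤ y → B x y ≡ 0ℤ) where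

  private
    drops : Array₂
    drops x = (λ _ → 0ℤ) [ x ]≔ + x - ∑ (B x) x

    drop-other : ∀ {x y} → y ≢ x → drops x y ≡ 0ℤ
    drop-other {x} y≢x = update-other (λ _ → 0ℤ) (+ x - ∑ (B x) x) y≢x

    drop-here : ∀ x → drops x x ≡ + x - ∑ (B x) x
    drop-here x = update-same (λ _ → 0ℤ) (+ x - ∑ (B x) x) x

    nonneg : ∀ {x} → x ℕ.< n → ∀ y → 0ℤ ≤ drops x y
    nonneg {x} _ y with y ℕ.≟ x
    ... | no y≢x   = ≤-reflexive (sym (drop-other y≢x))
    ... | yes refl = ≤-trans (ℤ.i≤j⇒0≤j-i (≤-trans (∑-mono x (λ {j} _ → Bit≤1 (bits x j))) (≤-reflexive (∑-ones x))))
                       (≤-reflexive (sym (drop-here x)))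

    rowsum : ∀ {x} → x ℕ.< n → ∑ (B x) x + ∑ (drops x) (suc x) ≡ + x
    rowsum {x} _ = calc (∑ (B x) x) (∑ (drops x) x) (drops x x) (+ x) (∑-zero x (drop-other ∘ ℕ.<⇒≢)) (drop-here x)
      where
      calc : ∀ p q d x → q ≡ 0ℤ → d ≡ x - p → p + (q + d) ≡ x
      calc p q d x h₁ h₂ = linear≡ (h₁ ⊞≡ h₂) (solve (p ∷ q ∷ d ∷ x ∷ []))

  open FromRows {n} bits lower nonneg (drop-other ∘ ℕ.>⇒≢) rowsum public
    renaming (family to cliffFamily; encode-family to encode-cliffFamily; encoded to cliffEncoded)

  cliffFamily-cliffShaped : IsCliffShaped cliffFamily
  cliffFamily-cliffShaped i = encoded-cliff (cliffEncoded i) (drop-other ∘ ℕ.<⇒≢)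

-- For cliffs `D` follows from `B`: the shape makes row `x` vanish before column `x`, and the row
-- sum gives its last entry.
cliff-injective : ∀ {n} (P Q : Family n) → IsCliffShaped P → IsCliffShaped Q → encodeB P ≐ encodeB Q →
  ∀ i → points (P i) ≡ points (Q i)
cliff-injective {n} P Q cliffP cliffQ B≡ i = directions⇒points {P = P i} {Q i}
  (encoded-unique {P = P i} {Q i} (family-encoded P i) (family-encoded Q i) (λ {j} _ → rowB≡ j) rowD≡)
  where
  x = toℕ i
  rowB≡ : ∀ j → arrayB P x j ≡ arrayB Q x j
  rowB≡ j = load≡ (encodeB P) {arrayB Q} (λ i j → trans (B≡ i j) (sym (load-toℕ (encodeB Q) i j)))
    (λ {x} _ n≤y → load-outside (encodeB Q) {x} (inj₂ n≤y)) j (Fin.toℕ<n i)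
  last : (R : Family n) → IsCliffShaped R → arrayD R x x ≡ + x - ∑ (arrayB R x) x
  last R cliffR = calc (∑ (arrayB R x) x) (∑ (arrayD R x) x) (arrayD R x x) (+ x)
    (∑-zero x (encoded-cliff⁻ (family-encoded R i) (proj₁ (cliffR i)))) (family-rowsum R (Fin.toℕ<n i))
    where
    calc : ∀ p q d x → q ≡ 0ℤ → p + (q + d) ≡ x → d ≡ x - p
    calc p q d x h₁ h₂ = linear≡ (sym h₁ ⊞≡ h₂) (solve (p ∷ q ∷ d ∷ x ∷ []))
  rowD≡ : ∀ {j} → j ℕ.≤ x → arrayD P x j ≡ arrayD Q x j
  rowD≡ j≤x with ℕ.m≤n⇒m<n∨m≡n j≤x
  ... | inj₁ j<x  = trans (encoded-cliff⁻ (family-encoded P i) (proj₁ (cliffP i)) j<x)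
                      (sym (encoded-cliff⁻ (family-encoded Q i) (proj₁ (cliffQ i)) j<x))
  ... | inj₂ refl = trans (last P cliffP) (trans (cong (_-_ (+ x)) (∑-cong x (λ {j} _ → rowB≡ j))) (sym (last Q cliffQ)))

-- The bijection between families

module Bijection (m : ℕ) where

  private
    n = suc m

  module Cliff    = Setoid (cliffShapedFamilies n)
  module Disjoint′ = Setoid (disjointSchröderFamilies n)

  combed : (C : Cliff.Carrier) → Combed n 0 (combArrays n (arrayB (proj₁ C)))
  combed C = combArrays-combed (arrayB-bits (proj₁ C)) (arrayB-lower (proj₁ C))

  to : Cliff.Carrier → Disjoint′.Carrier
  to C = combedFamily (combed C) , combedFamily-disjoint (combed C) , combedFamily-Schröder (combed C)

  encode-to : ∀ C → encode (proj₁ (to C)) ≐₂ comb (encodeB (proj₁ C))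
  encode-to C = encode-combedFamily (combed C)

  arrays : Disjoint′.Carrier → Array₂ × Array₂
  arrays P = arrayB (proj₁ P) , arrayD (proj₁ P)

  arrays-combed : ∀ P → Combed n 0 (arrays P)
  arrays-combed P = family-combed (proj₁ P) (proj₁ (proj₂ P))

  from : Disjoint′.Carrier → Cliff.Carrier
  from P = cliffFamily bits lower , cliffFamily-cliffShaped bits lower
    where
    bits = uncombArrays-bits (arrays-combed P)
    lower : ∀ {x y} → x ℕ.≤ y → uncombArrays n (arrays P) x y ≡ 0ℤ
    lower = uncombArrays-lower (arrays-combed P)

  encodeB-from : ∀ P → encodeB (proj₁ (from P)) ≐ uncomb (encode (proj₁ P))
  encodeB-from P = proj₁ (encode-cliffFamily (uncombArrays-bits (arrays-combed P)) (uncombArrays-lower (arrays-combed P)))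

  to∘from : ∀ {C P} → C Cliff.≈ from P → to C Disjoint′.≈ P
  to∘from {C} {P} C≈ = encode-injective (proj₁ (to C)) (proj₁ P)
    ( (λ i j → trans (proj₁ (encode-to C) i j) (trans (proj₁ match (toℕ j) (Fin.toℕ<n i)) (load-toℕ (encodeB (proj₁ P)) i j)))
    , (λ i j → trans (proj₂ (encode-to C) i j) (trans (proj₂ match (Fin.toℕ<n i) ℕ.z≤n) (load-toℕ (encodeD (proj₁ P)) i j))))
    where
    match : Match n 0 (combArrays n (arrayB (proj₁ C))) (arrays P)
    match = comb-uncomb (arrays-combed P)
      (load≡ (encodeB (proj₁ C)) {uncombArrays n (arrays P)}
        (λ i j → trans (proj₁ (encode-cong (proj₁ C) (proj₁ (from P)) C≈) i j) (encodeB-from P i j))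
        (λ x<n n≤y → uncombArrays-lower (arrays-combed P) (ℕ.≤-trans (ℕ.<⇒≤ x<n) n≤y)))

  from∘to : ∀ {P C} → P Disjoint′.≈ to C → from P Cliff.≈ C
  from∘to {P} {C} P≈ = cliff-injective (proj₁ (from P)) (proj₁ C) (proj₂ (from P)) (proj₂ C)
    λ i j → trans (encodeB-from P i j)
      (trans (uncomb-comb (arrayB-bits (proj₁ C)) (arrayB-lower (proj₁ C)) match (toℕ j) (Fin.toℕ<n i))
        (load-toℕ (encodeB (proj₁ C)) i j))
    where
    same : encode (proj₁ P) ≐₂ comb (encodeB (proj₁ C))
    same = (λ i j → trans (proj₁ P≐ i j) (proj₁ (encode-to C) i j)) , (λ i j → trans (proj₂ P≐ i j) (proj₂ (encode-to C) i j))
      where P≐ = encode-cong (proj₁ P) (proj₁ (to C)) P≈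
    module C = Combed (combed C)
    match : Match n 0 (combArrays n (arrayB (proj₁ C))) (arrays P)
    match =
      (λ y x<n → sym (load≡ (encodeB (proj₁ P)) {proj₁ (combArrays n (arrayB (proj₁ C)))} (proj₁ same)
                        (λ x<n n≤y → C.lower (ℕ.≤-trans (ℕ.<⇒≤ x<n) n≤y)) y x<n)) ,
      (λ {x} {y} x<n _ → sym (load≡ (encodeD (proj₁ P)) {proj₂ (combArrays n (arrayB (proj₁ C)))} (proj₂ same)
                                (λ x<n n≤y → C.lowerD (ℕ.<-≤-trans x<n n≤y)) y x<n))

theorem3 : (n : ℕ) →
    Σ (Inverse (cliffShapedFamilies n) (disjointSchröderFamilies n)) λ bij →
    (∀ C → encode (proj₁ (Inverse.to bij C)) ≐₂ comb (encodeB (proj₁ C))) ×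
    (∀ P → encodeB (proj₁ (Inverse.from bij P)) ≐ uncomb (encode (proj₁ P)))
-- The case is split off so that the loop bound `n ∸ 1` becomes `m`; without indices there are no
-- paths to compare.
theorem3 zero = record
  { to        = λ _ → (λ ()) , (λ ()) , (λ ())
  ; from      = λ _ → (λ ()) , (λ ())
  ; to-cong   = λ _ ()
  ; from-cong = λ _ ()
  ; inverse   = (λ _ ()) , (λ _ ())
  } , (λ _ → (λ ()) , (λ ())) , (λ _ ())
theorem3 n@(suc m) = record
  { to        = to
  ; from      = from
  -- `C` is equivalent to `from (to C′)` by way of `C′`, so congruence is an instance of the inverse
  -- law.
  ; to-cong   = λ {C} {C′} C≈C′ → to∘from {C} {to C′} λ i → trans (C≈C′ i) (sym (from∘to {to C′} {C′} (λ _ → refl) i))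
  ; from-cong = λ {P} {P′} P≈P′ → from∘to {P} {from P′} λ i → trans (P≈P′ i) (sym (to∘from {from P′} {P′} (λ _ → refl) i))
  ; inverse   = (λ {P} {C} → to∘from {C} {P}) , (λ {C} {P} → from∘to {P} {C})
  } , encode-to , encodeB-from
  where open Bijection m
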